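{- Let $q\ge 6$ be a prime power and let $\bar{\mathcal C}$ be an $\mathbb F_q$-conic in an $\mathbb F_q$-subplane $\bar\pi$ of $\mathrm{PG}(2,q^3)$ that is exterior to $\ell_\infty$. In the exact-at-infinity Bruck-Bose representation in $\mathrm{PG}(6,q)$, either $\mathcal V([\mathcal C])$ is a 6-dimensional normal rational curve; or $\mathcal V([\mathcal C])$ is a 3-dimensional normal rational curve of $\mathrm{PG}(6,q)$ and $\mathcal V([\mathcal C])^\star$ consists of a 3-dimensional normal rational curve and three T-lines of $\Sigma_\infty^\star$.
   Context: **$\mathbb F_q$-conics.** An $\mathbb F_q$-subplane of $\mathrm{PG}(2,q^3)$ is a subplane of order $q$; it is secant, tangent or exterior to a line if it meets it in $q+1$, $1$ or $0$ points. An $\mathbb F_q$-conic is a non-degenerate conic of an $\mathbb F_q$-subplane. For an $\mathbb F_q$-conic $\bar{\mathcal C}$, $\bar{\mathcal C}^{+}$ is the unique non-degenerate conic of $\mathrm{PG}(2,q^3)$ containing it, and $\bar{\mathcal C}^{++}$ the unique non-degenerate conic of $\mathrm{PG}(2,q^6)$ containing $\bar{\mathcal C}^+$. A line $\ell_\infty$ of $\mathrm{PG}(2,q^3)$ is fixed as line at infinity. **Normal rational curves.** An $r$-dimensional normal rational curve in $\mathrm{PG}(n,q)$ is a set of points lying in an $r$-space and projectively equivalent to $\{(1,\theta,\dots,\theta^r):\theta\in\mathbb F_q\}\cup\{(0,\dots,0,1)\}$; it extends naturally to a normal rational curve over extension fields. **Conjugacy.** For an $\mathbb F_q$-subplane $\bar\pi$,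 $\bar{\mathsf c}_\pi$ is the collineation $\bar X\mapsto B\bar X^q$ ($B\in\mathrm{GL}(3,q^3)$) of $\mathrm{PG}(2,q^3)$ that has order 3 and fixes $\bar\pi$ pointwise; the same formula defines it on $\mathrm{PG}(2,q^6)$, where it has order 6. **Bose representation.** Embed $\mathrm{PG}(8,q)\subset\mathrm{PG}(8,q^3)\subset\mathrm{PG}(8,q^6)$; $X^q$ is obtained by raising coordinates to the $q$-th power. For a subspace or variety $\mathcal K$ given over $\mathbb F_q$, $\mathcal K^\star$ and $\mathcal K^{\star\star}$ denote its extensions to $\mathbb F_{q^3}$ and $\mathbb F_{q^6}$; for a subspace $\Sigma$ of $\mathrm{PG}(8,q^3)$, $\Sigma^{\star\star}$ is its extension to $\mathrm{PG}(8,q^6)$. Let $\Gamma$ be a plane of $\mathrm{PG}(8,q^3)$ disjoint from $\mathrm{PG}(8,q)$ such that $\Gamma,\Gamma^q,\Gamma^{q^2}$ span $\mathrm{PG}(8,q^3)$. The planes $[\![X]\!]=\langle X,X^q,X^{q^2}\rangle\cap\mathrm{PG}(8,q)$, $X\in\Gamma$, form a regular 2-spread of $\mathrm{PG}(8,q)$. Identify $\mathrm{PG}(2,q^3)$ with $\Gamma$ (and $\mathrm{PG}(2,q^6)$ with $\Gamma^{\star\star}$) by a linear isomorphism, $\bar X\leftrightarrow X$; dropping the bar denotes the corresponding object in $\Gamma$ or $\Gamma^{\star\star}$. **Scroll-planes.** For $X\in\Gamma^{\star\star}$, the $\pi$-scroll-plane is $(\!(X)\!)_\pi=\langle X,(X^{\mathsf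 c_\pi^5})^q,(X^{\mathsf c_\pi^4})^{q^2}\rangle$; for $X\in\Gamma$ this is $\langle X,(X^{\mathsf c_\pi^2})^q,(X^{\mathsf c_\pi})^{q^2}\rangle$. **Exact-at-infinity Bruck-Bose representation.** Let $g\subset\Gamma$ be the line corresponding to $\ell_\infty$, $\Sigma_\infty=\langle g,g^q,g^{q^2}\rangle\cap\mathrm{PG}(8,q)$ (a 5-space), and $\Sigma_{6,q}\cong\mathrm{PG}(6,q)$ a 6-space of $\mathrm{PG}(8,q)$ containing $\Sigma_\infty$ as its hyperplane at infinity. The planes $[\![X]\!]$, $X\in g$, form a regular 2-spread $\mathcal S$ of $\Sigma_\infty$, with transversal lines $g,g^q,g^{q^2}$. A T-line of $\Sigma_\infty^\star$ is a line meeting two of $g,g^q,g^{q^2}$. For a point $\bar X$ let $[X]=[\![X]\!]\cap\Sigma_{6,q}$: a point of $\Sigma_{6,q}\setminus\Sigma_\infty$ if $\bar X\notin\ell_\infty$, the spread plane $[\![X]\!]$ if $\bar X\in\ell_\infty$. $[\mathcal C]$ is the set of points lying in the $[X]$, $\bar X\in\bar{\mathcal C}$. **Varieties.** It is known that the pointset of $\{[\![X]\!]:X\in\mathcal C\}$ is an intersection $\mathcal V([\![\mathcal C]\!])$ of nine quadrics of $\mathrm{PG}(8,q)$, that $\mathcal V([\![\mathcal C]\!])^\star$ is the set of points on the planes $(\!(X)\!)_\pi$, $X\in\mathcal C^+$, and $\mathcal V([\![\mathcal C]\!])^{\star\star}$ is the set of points on the planes $(\!(X)\!)_\pi$, $X\in\mathcal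 C^{++}$. Put $\mathcal V([\mathcal C])=\mathcal V([\![\mathcal C]\!])\cap\Sigma_{6,q}$ (its pointset is $[\mathcal C]$), with extension $\mathcal V([\mathcal C])^\star=\mathcal V([\![\mathcal C]\!])^\star\cap\Sigma_{6,q}^\star$. -}

module Defs where

open import Level using (0ℓ)
open import Algebra.Bundles using (CommutativeRing)
open import Algebra.Structures using (IsCommutativeRing)
import Algebra.Properties.Semiring.Exp as Exp
open import Data.Nat.Base as ℕ using (ℕ; zero; suc)
open import Data.Nat.Primality using (Prime)
open import Data.Fin.Base using (Fin; zero; suc; toℕ)
open import Data.Product using (_×_; ∃-syntax; Σ-syntax)
open import Data.Sum using (_⊎_)
open import Data.Vec.Base
  using (Vec; []; _∷_; _++_; _∷ʳ_; map; zipWith; replicate; tabulate)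
open import Data.Vec.Relation.Unary.All using (All)
open import Relation.Binary.PropositionalEquality using (_≡_; _≢_)
open import Relation.Nullary using (¬_)
open import Relation.Unary using (Pred; _∈_; _⊆_; _≐_; _∩_; _∪_; _≬_; U; ∅)

IsPrimePower : ℕ → Set
IsPrimePower n = ∃[ p ] ∃[ k ] (Prime p × 1 ℕ.≤ k × n ≡ p ℕ.^ k)

-- Propositional equality loses no generality here: only finite fields are
-- considered, and every finite field can be carried by some Fin n.
record Field : Set₁ where
  infix  8 -_
  infixl 7 _*_
  infixl 6 _+_
  field
    Carrier           : Set
    _+_ _*_           : Carrier → Carrier → Carrier
    -_                : Carrier → Carrier
    0# 1#             : Carrier
    isCommutativeRing : IsCommutativeRing _≡_ _+_ _*_ -_ 0# 1#
    0≢1               : 0# ≢ 1#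
    inverse           : ∀ x → x ≢ 0# → ∃[ y ] x * y ≡ 1#

  commutativeRing : CommutativeRing 0ℓ 0ℓ
  commutativeRing = record { isCommutativeRing = isCommutativeRing }

-- Used with 𝕂 a field of order q³.
module Geometry (𝕂 : Field) (q : ℕ) where

  open Field 𝕂 renaming (Carrier to K)
  open Exp (CommutativeRing.semiring commutativeRing) using (_^_)

  -- GF(q) is the fixed field of x ↦ x^q in GF(q³).
  𝔽q 𝔽q³ : Pred K 0ℓ
  𝔽q x = x ^ q ≡ x
  𝔽q³  = U

  ----------------------------------------------------------------------
  -- Linear algebra

  𝟎 : ∀ {n} → Vec K n
  𝟎 = replicate _ 0#

  infixl 6 _+ᵛ_
  _+ᵛ_ : ∀ {n} → Vec K n → Vec K n → Vec K n
  _+ᵛ_ = zipWith _+_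

  infixr 7 _·ᵛ_
  _·ᵛ_ : ∀ {n} → K → Vec K n → Vec K n
  c ·ᵛ v = map (c *_) v

  infix 7 _∙_
  _∙_ : ∀ {n} → Vec K n → Vec K n → K
  []       ∙ []       = 0#
  (x ∷ xs) ∙ (y ∷ ys) = x * y + xs ∙ ys

  -- Also the product of the matrix with columns vs by the vector cs.
  lincomb : ∀ {m n} → Vec K m → Vec (Vec K n) m → Vec K n
  lincomb []       []       = 𝟎
  lincomb (c ∷ cs) (v ∷ vs) = c ·ᵛ v +ᵛ lincomb cs vs

  LinIndep : Pred K 0ℓ → ∀ {m n} → Vec (Vec K n) m → Set
  LinIndep k vs = ∀ cs → All k cs → lincomb cs vs ≡ 𝟎 → cs ≡ 𝟎

  frob : ∀ {n} → Vec K n → Vec K n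
  frob = map (_^ q)

  ----------------------------------------------------------------------
  -- Projective spaces

  infix 4 _∼_
  _∼_ : ∀ {n} → Vec K n → Vec K n → Set
  u ∼ v = ∃[ c ] (c ≢ 0# × u ≡ c ·ᵛ v)

  -- Point n represents the points of PG(n-1,q³), with equality of points
  -- being _∼_ on vec; every set of points used below respects it.
  record Point (n : ℕ) : Set where
    constructor point
    field
      vec     : Vec K n
      nonzero : vec ≢ 𝟎
  open Point public

  PointSet : ℕ → Set₁
  PointSet n = Pred (Point n) 0ℓ

  PG[_] : Pred K 0ℓ → ∀ {n} → PointSet n
  PG[ k ] P = ∃[ v ] (All k v × vec P ∼ v)

  SpanOver : Pred K 0ℓ → ∀ {m n} → Vec (Vec K n) m → PointSet n
  SpanOver k vs P = ∃[ cs ] (All k cs × vec P ∼ lincomb cs vs)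

  ⟨_⟩ : ∀ {m n} → Vec (Vec K n) m → PointSet n
  ⟨_⟩ = SpanOver 𝔽q³

  Span : ∀ {n} → PointSet n → PointSet n
  Span A P = ∃[ m ] ∃[ Xs ] ∃[ cs ]
    (All A {m} Xs × vec P ≡ lincomb cs (map vec Xs))

  conj : ∀ {n} → PointSet n → PointSet n
  conj A P = ∃[ X ] (X ∈ A × vec P ∼ frob (vec X))

  HasSize : ∀ {n} → ℕ → PointSet n → Set
  HasSize {n} s A = Σ[ f ∈ (Fin s → Point n) ] ((∀ i → f i ∈ A)
    × (∀ i j → vec (f i) ∼ vec (f j) → i ≡ j)
    × (∀ P → P ∈ A → ∃[ i ] vec P ∼ vec (f i)))

  ----------------------------------------------------------------------
  -- The plane PG(2,q³)

  -- The line of PG(2,q³) with the given dual coordinates.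
  line : Point 3 → PointSet 3
  line ℓ P = vec ℓ ∙ vec P ≡ 0#

  TwoPointsOn : PointSet 3 → Point 3 → Set
  TwoPointsOn S ℓ = ∃[ P ] ∃[ Q ]
    (P ∈ S ∩ line ℓ × Q ∈ S ∩ line ℓ × ¬ vec P ∼ vec Q)

  record IsSubplane (order : ℕ) (S : PointSet 3) : Set where
    field
      respects   : ∀ P Q → vec P ∼ vec Q → P ∈ S → Q ∈ S
      meet       : ∀ ℓ m → TwoPointsOn S ℓ → TwoPointsOn S m →
                   ∃[ P ] P ∈ S ∩ (line ℓ ∩ line m)
      linePoints : ∀ ℓ → TwoPointsOn S ℓ → HasSize (suc order) (S ∩ line ℓ)
      quadrangle : Σ[ P ∈ (Fin 4 → Point 3) ] ((∀ i → P i ∈ S)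
        × (∀ ℓ i j k → i ≢ j → j ≢ k → i ≢ k →
           ¬ (P i ∈ line ℓ × P j ∈ line ℓ × P k ∈ line ℓ)))

  Exterior : PointSet 3 → Point 3 → Set
  Exterior S ℓ = S ∩ line ℓ ⊆ ∅

  ----------------------------------------------------------------------
  -- Quadrics and conics

  -- A matrix (aᵢⱼ), not necessarily symmetric, stands for the quadratic form
  -- Σ aᵢⱼ xᵢ xⱼ; in this way every quadratic form arises in any characteristic.
  Form : ℕ → Set
  Form n = Vec (Vec K n) n

  eval : ∀ {n} → Form n → Vec K n → K
  eval A v = v ∙ map (_∙ v) A

  FormOver : Pred K 0ℓ → ∀ {n} → Form n → Set
  FormOver k A = All (All k) A

  Zeros : ∀ {m n} → Vec (Form n) m → PointSet n
  Zeros As P = All (λ A → eval A (vec P) ≡ 0#) As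

  -- The quadric has no singular point: no nonzero v is a zero of the form
  -- lying in the radical of its polarisation.
  NonDegenerate : Pred K 0ℓ → ∀ {n} → Form n → Set
  NonDegenerate k A = ∀ v → All k v → eval A v ≡ 0# →
    (∀ w → All k w → eval A (v +ᵛ w) ≡ eval A v + eval A w) → v ≡ 𝟎

  IsConic : PointSet 3 → Set
  IsConic C = ∃[ A ] (NonDegenerate 𝔽q³ A × C ≐ Zeros (A ∷ []))

  -- The columns of M give coordinates over GF(q) on the subplane S (every
  -- subplane of order q of PG(2,q³) admits such M), and C is a non-degenerate
  -- conic of S in these coordinates.
  IsConicOf : PointSet 3 → PointSet 3 → Set
  IsConicOf S C = ∃[ M ] (LinIndep 𝔽q³ {3} M × S ≐ SpanOver 𝔽q M
    × ∃[ A ] (FormOver 𝔽q A × NonDegenerate 𝔽q A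
      × C ≐ λ P → ∃[ x ] (All 𝔽q x × eval A x ≡ 0# × vec P ∼ lincomb x M)))

  ----------------------------------------------------------------------
  -- Normal rational curves

  curve : Pred K 0ℓ → ∀ {n} (r : ℕ) → Vec (Vec K n) (suc r) → PointSet n
  curve k r vs P =
      (∃[ θ ] (k θ × vec P ∼ lincomb (tabulate λ i → θ ^ toℕ i) vs))
    ⊎ vec P ∼ lincomb (replicate r 0# ∷ʳ 1#) vs

  -- N is an r-dimensional normal rational curve over k in the subspace Σ: the
  -- image of the standard one under an injective k-linear map onto an r-space.
  IsNRC : Pred K 0ℓ → ∀ {n} → ℕ → PointSet n → PointSet n → Set
  IsNRC k {n} r Σ N = ∃[ vs ] (All (All k) {suc r} vs × LinIndep k vs
    × SpanOver k vs ⊆ Σ × N ≐ curve k {n} r vs)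

  ----------------------------------------------------------------------
  -- The map X ↦ B X^q of PG(2,q³) attached to a subplane

  semilinear : Vec (Vec K 3) 3 → Vec K 3 → Vec K 3
  semilinear B x = lincomb (frob x) B

  record IsConjugacy (S : PointSet 3) (B : Vec (Vec K 3) 3) : Set where
    private c = semilinear B
    field
      invertible   : LinIndep 𝔽q³ B
      fixesS       : ∀ P → P ∈ S → c (vec P) ∼ vec P
      cubeIdentity : ∀ (P : Point 3) → c (c (c (vec P))) ∼ vec P
      notIdentity  : ¬ (∀ (P : Point 3) → c (vec P) ∼ vec P)

  ----------------------------------------------------------------------
  -- The Bose representation in PG(8,q)

  -- The basis G of the plane Γ determines the identification
  -- x ↦ x₀G₀ + x₁G₁ + x₂G₂ of PG(2,q³) with Γ.
  record Bose : Set where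
    field
      G         : Vec (Vec K 9) 3
      plane     : LinIndep 𝔽q³ G
      disjoint  : ⟨ G ⟩ ∩ PG[ 𝔽q ] ⊆ ∅
      spanning  : ∀ P → P ∈ ⟨ G ++ map frob G ++ map (λ v → frob (frob v)) G ⟩

    γ : Vec K 3 → Vec K 9
    γ x = lincomb x G

    ⟦_⟧ : Vec K 3 → PointSet 9
    ⟦ x ⟧ = ⟨ γ x ∷ frob (γ x) ∷ frob (frob (γ x)) ∷ [] ⟩ ∩ PG[ 𝔽q ]

    scrollPlane : Vec (Vec K 3) 3 → Vec K 3 → PointSet 9
    scrollPlane B x =
      ⟨ γ x ∷ frob (γ (c (c x))) ∷ frob (frob (γ (c x))) ∷ [] ⟩
      where c = semilinear B

    -- The quadrics As have the points of the planes ⟦ X ⟧, X ∈ C, as their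
    -- common points over GF(q), and the points of the scroll-planes of
    -- X ∈ C⁺ as their common points over GF(q³).
    record IsVarietyOf (B : Vec (Vec K 3) 3) (C C⁺ : PointSet 3)
                       {m} (As : Vec (Form 9) m) : Set where
      field
        over𝔽q     : All (FormOver 𝔽q) As
        points     : Zeros As ∩ PG[ 𝔽q ]
                     ≐ λ P → ∃[ X ] (X ∈ C × P ∈ ⟦ vec X ⟧)
        extension  : Zeros As
                     ≐ λ P → ∃[ X ] (X ∈ C⁺ × P ∈ scrollPlane B (vec X))

    --------------------------------------------------------------------
    -- The exact-at-infinity Bruck-Bose representation in PG(6,q)

    module AtInfinity (ℓ∞ : Point 3) where

      g : PointSet 9
      g P = ∃[ X ] (X ∈ line ℓ∞ × vec P ∼ γ (vec X))

      transversal : Fin 3 → PointSet 9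
      transversal zero             = g
      transversal (suc zero)       = conj g
      transversal (suc (suc zero)) = conj (conj g)

      Σ∞⋆ Σ∞ : PointSet 9
      Σ∞⋆ = Span (g ∪ (conj g ∪ conj (conj g)))
      Σ∞  = Σ∞⋆ ∩ PG[ 𝔽q ]

      IsTLine : PointSet 9 → Set
      IsTLine ℓ = (∃[ uv ] (LinIndep 𝔽q³ {2} uv × ℓ ≐ ⟨ uv ⟩)) × ℓ ⊆ Σ∞⋆
        × ∃[ i ] ∃[ j ] (i ≢ j × ℓ ≬ transversal i × ℓ ≬ transversal j)

      record SixSpace : Set where
        field
          basis       : Vec (Vec K 9) 7
          basisOver𝔽q : All (All 𝔽q) basis
          independent : LinIndep 𝔽q basis

          containsΣ∞  : Σ∞ ⊆ SpanOver 𝔽q basis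

        Σ₆ Σ₆⋆ : PointSet 9
        Σ₆  = SpanOver 𝔽q basis
        Σ₆⋆ = ⟨ basis ⟩

        𝒱 𝒱⋆ : ∀ {m} → Vec (Form 9) m → PointSet 9
        𝒱  As = Zeros As ∩ Σ₆
        𝒱⋆ As = Zeros As ∩ Σ₆⋆

{-# OPTIONS --safe #-}
module Submission where

-- Write K = GF(q³). In coordinates adapted to Γ, Γ^q, Γ^{q²} a point of PG(8,q³) is a triple
-- (a, b, c) of vectors of K³, x ↦ x^q acts as (a, b, c) ↦ (c^q, a^q, b^q), the scroll-plane of x
-- consists of the triples (s x, t x, u x), and the 6-space is given by n·a = n^q·b = n^{q²}·c, where
-- n·x = 0 is the line at infinity. A zero over GF(q) of the ternary form turns the conic into
-- x(θ) = (1, θ, θ²), so that its points in the 6-space are (L₁L₂ x, L₀L₂ x, L₀L₁ x) with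
-- L₀, L₁, L₂ the conjugates of the quadratic n·x(θ). The coefficients of these sextics are
-- independent unless the conic passes through the vertices of the triangle L₀L₁L₂ = 0. In that case
-- Lᵢ is a multiple of (θ - θⱼ)(θ - θₖ) for three conjugate parameters, the common factor
-- (θ - θ₀)(θ - θ₁)(θ - θ₂) cancels and leaves a twisted cubic, and the scroll-planes of the three
-- vertices meet the 6-space in T-lines.

open import Algebra.Bundles using (CommutativeRing)
import Algebra.Properties.AbelianGroup as AbelianGroupProperties
import Algebra.Properties.CommutativeMonoid.Sum as Sum
import Algebra.Properties.CommutativeSemiring.Binomial as Binomial
import Algebra.Properties.CommutativeSemiring.Exp as CommutativeExp
import Algebra.Properties.Ring as RingProperties
import Algebra.Properties.Semiring.Exp as Exp
import Algebra.Properties.Semiring.Mult as Multiple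
import Algebra.Properties.Semiring.Mult.TCOptimised as Mult
import Algebra.Solver.Ring as RingSolver
import Algebra.Solver.Ring.AlmostCommutativeRing as ACR
open import Data.Bool.Base using (Bool; false; true)
open import Data.Empty using (⊥-elim)
open import Data.Fin.Base as Fin′ using (Fin; fromℕ; inject₁; punchOut; suc; toℕ; zero)
open import Data.Fin.Permutation using (Permutation′; permutation)
import Data.Fin.Properties as Fin
open import Data.Integer.Base as ℤ using (+0; +[1+_]; -[1+_]; ℤ)
import Data.Integer.Properties as ℤ
open import Data.Maybe.Base using (Maybe; just; nothing)
open import Data.Nat.Base as ℕ using (suc; s≤s; zero; z≤n; ℕ)
open import Data.Nat.Combinatorics as ℕ using (k![n∸k]!∣n!; nCk≡n!/k![n-k]!; nCn≡1)
open import Data.Nat.DivMod using (m/n*n≡m)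
open import Data.Nat.Divisibility using (>⇒∤; _∣_; _∤_; divides; m∣m*n; ∣1⇒≡1)
open import Data.Nat.Primality using (Prime; euclidsLemma; prime⇒nonTrivial)
import Data.Nat.Properties as ℕ
open import Data.Product using (_,_; _×_; proj₁; proj₂; Σ-syntax; ∃-syntax)
open import Data.Product.Function.NonDependent.Propositional using (_×-↔_)
open import Data.Product.Properties using (,-injectiveˡ)
open import Data.Sum using (_⊎_; inj₁; inj₂)
open import Data.Unit using (tt)
open import Data.Vec.Base using (Vec; []; _++_; _[_]≔_; _∷_; _∷ʳ_; lookup; map; replicate; splitAt; tabulate)
import Data.Vec.Functional as Functional
open import Data.Vec.Properties using (map-cong; map-id; map-∘; zipWith-assoc; zipWith-comm; zipWith-identityʳ; zipWith-identityˡ; ∷-injectiveʳ; ∷-injectiveˡ)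
open import Data.Vec.Relation.Unary.All as All using (All; []; _∷_)
import Data.Vec.Relation.Unary.All.Properties as All
open import Defs
open import Function.Base using (_∘_; case_of_)
open import Function.Bundles using (_↔_; mk↔ₛ′; module Inverse)
open import Function.Construct.Composition using (_↔-∘_)
open import Function.Construct.Identity using (↔-id)
open import Function.Construct.Symmetry using (↔-sym)
open import Function.Definitions using (Injective)
open import Relation.Binary.Definitions using (DecidableEquality; tri<; tri>; tri≈)
open import Relation.Binary.PropositionalEquality
open import Relation.Nullary using (Dec; _×-dec_; contradiction; does; no; yes; ¬?; ¬_)
open import Relation.Nullary.Decidable as Dec using (dec-false; dec-true)
open import Relation.Unary using (Decidable; _∈_; _∪_; _≐_; _⊆_)

-- One fact carries most of the argument. In coordinates over a frame `M` of the subplane, the line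
-- at infinity is exterior exactly when its coordinate vector `m` is independent over GF(q). Then
-- `m` is a GF(q)-basis of K and its Moore matrix, with rows `m`, `m^q`, `m^(q²)`, is nonsingular.
-- This makes the three conjugate lines a triangle and puts each transversal line inside the
-- extended 6-space. Points are known only up to scalars and GF(q) only as the fixed set of `φ`, so
-- a descent from K to GF(q) goes through the trace or compares a scalar with its conjugate. The two
-- cases come from a Hankel matrix. A relation among the coefficients of the sextics makes three
-- overlapping vectors multiples of one vertex `p` of the triangle, and such multiples can be
-- nonzero only if `p` is on the conic. Dimension theory is replaced by counting in the finite
-- field: injective maps of K^n into itself are onto, and n + 1 vectors of K^n are dependent by the
-- pigeonhole principle.

-- Integer coefficients let the solver cancel terms although equality in the field does not compute.
module IntegerCoefficients (𝕂 : Field) where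

  open Field 𝕂 using (commutativeRing)
  open CommutativeRing commutativeRing
    using (_+_; _*_; -_; 0#; 1#; semiring; ring; +-identityˡ; +-identityʳ; -‿inverseʳ; +-comm; +-assoc; *-comm)
  open Mult semiring using (×-homo-+; ×1-homo-*; 1+×) renaming (_×_ to infixl 8 _×′_)
  open RingProperties ring using (-0#≈0#; -‿distribˡ-*; -‿distribʳ-*)
  open AbelianGroupProperties (CommutativeRing.+-abelianGroup commutativeRing) using (⁻¹-∙-comm; ⁻¹-involutive)
  open ≡-Reasoning

  ⟦_⟧ᶻ : ℤ → Field.Carrier 𝕂
  ⟦ ℤ.+ n      ⟧ᶻ = n ×′ 1#
  ⟦ -[1+ n ] ⟧ᶻ = - (suc n ×′ 1#)

  ⊖-homo : ∀ m n → ⟦ m ℤ.⊖ n ⟧ᶻ ≡ m ×′ 1# + - (n ×′ 1#)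
  ⊖-homo zero zero = sym (-‿inverseʳ 0#)
  ⊖-homo zero (suc n) = sym (+-identityˡ _)
  ⊖-homo (suc m) zero = sym (trans (cong ((suc m ×′ 1#) +_) -0#≈0#) (+-identityʳ _))
  ⊖-homo (suc m) (suc n) = begin
    ⟦ suc m ℤ.⊖ suc n ⟧ᶻ                     ≡⟨ cong ⟦_⟧ᶻ (ℤ.[1+m]⊖[1+n]≡m⊖n m n) ⟩
    ⟦ m ℤ.⊖ n ⟧ᶻ                             ≡⟨ ⊖-homo m n ⟩
    a + - b                                  ≡⟨ cong (a +_) (sym (+-identityˡ _)) ⟩
    a + (0# + - b)                           ≡⟨ cong (λ z → a + (z + - b)) (sym (-‿inverseʳ 1#)) ⟩
    a + ((1# + - 1#) + - b)                  ≡⟨ cong (a +_) (+-assoc _ _ _) ⟩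
    a + (1# + (- 1# + - b))                  ≡⟨ sym (+-assoc _ _ _) ⟩
    (a + 1#) + (- 1# + - b)                  ≡⟨ cong₂ _+_ (+-comm a 1#) (⁻¹-∙-comm 1# b) ⟩
    (1# + a) + - (1# + b)                    ≡⟨ cong₂ (λ x y → x + - y) (sym (1+× m 1#)) (sym (1+× n 1#)) ⟩
    suc m ×′ 1# + - (suc n ×′ 1#)            ∎
    where a = m ×′ 1# ; b = n ×′ 1#

  +-homo : ∀ x y → ⟦ x ℤ.+ y ⟧ᶻ ≡ ⟦ x ⟧ᶻ + ⟦ y ⟧ᶻ
  +-homo (ℤ.+ m) (ℤ.+ n) = ×-homo-+ 1# m n
  +-homo (ℤ.+ m) -[1+ n ] = ⊖-homo m (suc n)
  +-homo -[1+ m ] (ℤ.+ n) = trans (⊖-homo n (suc m)) (+-comm _ _)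
  +-homo -[1+ m ] -[1+ n ] = begin
    - (suc (suc (m ℕ.+ n)) ×′ 1#)            ≡⟨ cong (λ k → - (suc k ×′ 1#)) (sym (ℕ.+-suc m n)) ⟩
    - ((suc m ℕ.+ suc n) ×′ 1#)              ≡⟨ cong -_ (×-homo-+ 1# (suc m) (suc n)) ⟩
    - (suc m ×′ 1# + suc n ×′ 1#)            ≡⟨ sym (⁻¹-∙-comm _ _) ⟩
    - (suc m ×′ 1#) + - (suc n ×′ 1#)        ∎

  -‿homo : ∀ x → ⟦ ℤ.- x ⟧ᶻ ≡ - ⟦ x ⟧ᶻ
  -‿homo +0 = sym -0#≈0#
  -‿homo +[1+ n ] = refl
  -‿homo -[1+ n ] = sym (⁻¹-involutive _)

  +*-homo : ∀ m y → ⟦ ℤ.+ m ℤ.* y ⟧ᶻ ≡ (m ×′ 1#) * ⟦ y ⟧ᶻ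
  +*-homo m (ℤ.+ n) = trans (cong ⟦_⟧ᶻ (sym (ℤ.pos-* m n))) (×1-homo-* m n)
  +*-homo m -[1+ n ] = begin
    ⟦ ℤ.+ m ℤ.* -[1+ n ] ⟧ᶻ               ≡⟨ cong ⟦_⟧ᶻ (sym (ℤ.neg-distribʳ-* (ℤ.+ m) (ℤ.+ suc n))) ⟩
    ⟦ ℤ.- (ℤ.+ m ℤ.* ℤ.+ suc n) ⟧ᶻ          ≡⟨ -‿homo (ℤ.+ m ℤ.* ℤ.+ suc n) ⟩
    - ⟦ ℤ.+ m ℤ.* ℤ.+ suc n ⟧ᶻ              ≡⟨ cong -_ (+*-homo m (ℤ.+ suc n)) ⟩
    - ((m ×′ 1#) * (suc n ×′ 1#))       ≡⟨ -‿distribʳ-* _ _ ⟩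
    (m ×′ 1#) * ⟦ -[1+ n ] ⟧ᶻ           ∎

  *-homo : ∀ x y → ⟦ x ℤ.* y ⟧ᶻ ≡ ⟦ x ⟧ᶻ * ⟦ y ⟧ᶻ
  *-homo (ℤ.+ m) y = +*-homo m y
  *-homo -[1+ m ] y = begin
    ⟦ -[1+ m ] ℤ.* y ⟧ᶻ                 ≡⟨ cong ⟦_⟧ᶻ (sym (ℤ.neg-distribˡ-* (ℤ.+ suc m) y)) ⟩
    ⟦ ℤ.- (ℤ.+ suc m ℤ.* y) ⟧ᶻ            ≡⟨ -‿homo (ℤ.+ suc m ℤ.* y) ⟩
    - ⟦ ℤ.+ suc m ℤ.* y ⟧ᶻ                ≡⟨ cong -_ (+*-homo (suc m) y) ⟩
    - ((suc m ×′ 1#) * ⟦ y ⟧ᶻ)          ≡⟨ -‿distribˡ-* _ _ ⟩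
    ⟦ -[1+ m ] ⟧ᶻ * ⟦ y ⟧ᶻ              ∎

  ℤ⟶𝕂 : ℤ.+-*-rawRing ACR.-Raw-AlmostCommutative⟶ ACR.fromCommutativeRing commutativeRing
  ℤ⟶𝕂 = record
    { ⟦_⟧ = ⟦_⟧ᶻ ; +-homo = +-homo ; *-homo = *-homo ; -‿homo = -‿homo ; 0-homo = refl ; 1-homo = refl }

  -- Distinct integers may have equal images in positive characteristic, so inequality yields no
  -- verdict.
  coefficient-≟ : ∀ x y → Maybe (⟦ x ⟧ᶻ ≡ ⟦ y ⟧ᶻ)
  coefficient-≟ x y with x ℤ.≟ y
  ... | yes p = just (cong ⟦_⟧ᶻ p)
  ... | no _  = nothing

  open RingSolver ℤ.+-*-rawRing (ACR.fromCommutativeRing commutativeRing) ℤ⟶𝕂 coefficient-≟ public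
    using (Polynomial; solve; con; _:+_; _:*_; _:-_; :-_; _:=_)

  𝟘 𝟙 : ∀ {n} → Polynomial n
  𝟘 = con (ℤ.+ 0)
  𝟙 = con (ℤ.+ 1)

-- Counting on finite sets

abstract

  -- Punching a missed value out of the codomain would inject `Fin (suc n)` into `Fin n`.
  Fin-injective⇒surjective : ∀ {n} {f : Fin n → Fin n} → Injective _≡_ _≡_ f → ∀ y → ∃[ x ] f x ≡ y
  Fin-injective⇒surjective {suc n} {f} f-inj y with Fin.any? (λ x → f x Fin.≟ y)
  ... | yes hit = hit
  ... | no miss = contradiction
    (Fin.injective⇒≤ {f = λ x → punchOut (y≢f x)} (λ eq → f-inj (Fin.punchOut-injective (y≢f _) (y≢f _) eq)))
    ℕ.1+n≰n
    where y≢f : ∀ x → y ≢ f x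
          y≢f x eq = miss (x , sym eq)

module _ {X : Set} {n} (iso : X ↔ Fin n) where

  open Inverse iso

  private
    from∘to : ∀ x → from (to x) ≡ x
    from∘to x = inverseʳ refl
    to∘from : ∀ i → to (from i) ≡ i
    to∘from i = inverseˡ refl

  to-injective : ∀ {x y} → to x ≡ to y → x ≡ y
  to-injective {x} {y} eq = trans (sym (from∘to x)) (trans (cong from eq) (from∘to y))

  from-injective : ∀ {i j} → from i ≡ from j → i ≡ j
  from-injective {i} {j} eq = trans (sym (to∘from i)) (trans (cong to eq) (to∘from j))

  abstract

    injective⇒surjective : ∀ {f : X → X} → Injective _≡_ _≡_ f → ∀ y → ∃[ x ] f x ≡ y
    injective⇒surjective {f} f-inj y
      with Fin-injective⇒surjective {f = λ i → to (f (from i))}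
        (λ {i} {j} eq → trans (sym (to∘from i)) (trans (cong to (f-inj (to-injective eq))) (to∘from j))) (to y)
    ... | i , eq = from i , to-injective eq

    -- A section of `f` is injective, hence onto by counting, which turns it into a two-sided
    -- inverse.
    surjective⇒injective : ∀ {f : X → X} → (∀ y → ∃[ x ] f x ≡ y) → Injective _≡_ _≡_ f
    surjective⇒injective {f} f-surj {x} {y} eq = trans (sym (s∘f x)) (trans (cong s eq) (s∘f y))
      where
      s : X → X
      s y = proj₁ (f-surj y)
      f∘s : ∀ y → f (s y) ≡ y
      f∘s y = proj₂ (f-surj y)
      s-inj : Injective _≡_ _≡_ s
      s-inj {u} {v} e = trans (sym (f∘s u)) (trans (cong f e) (f∘s v))
      s∘f : ∀ x → s (f x) ≡ x
      s∘f x with injective⇒surjective s-inj x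
      ... | z , refl = cong s (f∘s z)

abstract

  -- This makes K^n a finite set, so that counting can replace dimension theory.
  Vec↔Fin : ∀ {X : Set} {n} → X ↔ Fin n → ∀ k → Vec X k ↔ Fin (n ℕ.^ k)
  Vec↔Fin iso zero = mk↔ₛ′ (λ _ → zero) (λ _ → []) (λ { zero → refl }) (λ { [] → refl })
  Vec↔Fin {X} iso (suc k) =
    ↔-sym Fin.*↔× ↔-∘ ((iso ×-↔ Vec↔Fin iso k) ↔-∘ uncons↔)
    where
    uncons↔ : Vec X (suc k) ↔ (X × Vec X k)
    uncons↔ = mk↔ₛ′ (λ { (x ∷ xs) → x , xs }) (λ { (x , xs) → x ∷ xs }) (λ _ → refl) (λ { (x ∷ xs) → refl })

-- Binomial coefficients modulo a prime

prime∤! : ∀ {p} → Prime p → ∀ k → k ℕ.< p → p ∤ k ℕ.!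
prime∤! {p} pp zero _ p∣1 = ℕ.nonTrivial⇒≢1 {{prime⇒nonTrivial pp}} (∣1⇒≡1 p∣1)
prime∤! pp (suc k) k<p p∣ with euclidsLemma (suc k) (k ℕ.!) pp p∣
... | inj₁ h = >⇒∤ k<p h
... | inj₂ h = prime∤! pp k (ℕ.<-trans (ℕ.n<1+n k) k<p) h

-- The prime divides p! = C(p,k) k! (p - k)!, and it divides neither factorial because k and p - k
-- are both below p.
prime∣binomial : ∀ {p k} → Prime p → 0 ℕ.< k → k ℕ.< p → p ∣ p ℕ.C k
prime∣binomial {p@(suc p-1)} {k@(suc k-1)} pp 0<k k<p
  with euclidsLemma (p ℕ.C k) (k ℕ.! ℕ.* (p ℕ.∸ k) ℕ.!) pp (subst (p ∣_) (sym eq) (m∣m*n (p-1 ℕ.!)))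
  where
  instance _ = k ℕ.!* (p ℕ.∸ k) !≢0
  eq : (p ℕ.C k) ℕ.* (k ℕ.! ℕ.* (p ℕ.∸ k) ℕ.!) ≡ p ℕ.!
  eq = trans (cong (ℕ._* (k ℕ.! ℕ.* (p ℕ.∸ k) ℕ.!)) (nCk≡n!/k![n-k]! (ℕ.<⇒≤ k<p))) (m/n*n≡m (k![n∸k]!∣n! (ℕ.<⇒≤ k<p)))
... | inj₁ h = h
... | inj₂ h with euclidsLemma (k ℕ.!) _ pp h
...   | inj₁ h′ = contradiction h′ (prime∤! pp k k<p)
...   | inj₂ h′ = contradiction h′ (prime∤! pp (p ℕ.∸ k) (ℕ.∸-monoʳ-< 0<k (ℕ.<⇒≤ k<p)))

-- Finite fields: Fermat's identity, the characteristic and the Frobenius map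

module FiniteField (𝕂 : Field) {N : ℕ} (iso : Field.Carrier 𝕂 ↔ Fin N) where

  open Field 𝕂 using (inverse; 0≢1; commutativeRing) renaming (Carrier to K)
  open CommutativeRing commutativeRing
    using (_+_; _*_; -_; 0#; 1#; semiring; commutativeSemiring; +-commutativeMonoid; *-commutativeMonoid;
           zeroˡ; zeroʳ; *-comm; *-assoc; *-identityˡ; *-identityʳ; +-identityˡ; +-identityʳ; +-assoc; +-comm; -‿inverseʳ; -‿inverseˡ) public
  open IntegerCoefficients 𝕂 public
  open Exp semiring using (_^_; ^-assocʳ)
  open CommutativeExp commutativeSemiring using (^-distrib-*)
  module Multiples = Multiple semiring
  open Multiples using (×1-homo-*) renaming (_×_ to _⊗_)
  module Π = Sum *-commutativeMonoid
  module Σ′ = Sum +-commutativeMonoid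
  open Inverse iso using (to; from; inverseˡ; inverseʳ)

  infix 4 _≟_
  _≟_ : DecidableEquality K
  x ≟ y with to x Fin.≟ to y
  ... | yes eq = yes (to-injective iso eq)
  ... | no neq = no (neq ∘ cong to)

  from∘to : ∀ x → from (to x) ≡ x
  from∘to x = inverseʳ refl

  x*y≡0⇒y≡0 : ∀ {x y} → x ≢ 0# → x * y ≡ 0# → y ≡ 0#
  x*y≡0⇒y≡0 {x} {y} x≢0 xy≡0 with inverse x x≢0
  ... | z , xz≡1 = begin
    y            ≡⟨ sym (*-identityˡ y) ⟩
    1# * y       ≡⟨ cong (_* y) (trans (sym xz≡1) (*-comm x z)) ⟩
    z * x * y    ≡⟨ *-assoc z x y ⟩
    z * (x * y)  ≡⟨ trans (cong (z *_) xy≡0) (zeroʳ z) ⟩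
    0#           ∎
    where open ≡-Reasoning

  *-≢0 : ∀ {x y} → x ≢ 0# → y ≢ 0# → x * y ≢ 0#
  *-≢0 x≢0 y≢0 = y≢0 ∘ x*y≡0⇒y≡0 x≢0

  ^-≡0 : ∀ {x} n → x ^ n ≡ 0# → x ≡ 0#
  ^-≡0 zero e = contradiction (sym e) 0≢1
  ^-≡0 {x} (suc n) e with x ≟ 0#
  ... | yes z = z
  ... | no nz = ^-≡0 n (x*y≡0⇒y≡0 nz e)

  abstract

    -- The inverse of 0# is 0#.
    infix 9 _⁻¹
    _⁻¹ : K → K
    x ⁻¹ with x ≟ 0#
    ... | yes _ = 0#
    ... | no nz = proj₁ (inverse x nz)

    *-inverseʳ : ∀ {x} → x ≢ 0# → x * x ⁻¹ ≡ 1#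
    *-inverseʳ {x} nz with x ≟ 0#
    ... | yes z = contradiction z nz
    ... | no nz′ = proj₂ (inverse x nz′)

  *-inverseˡ : ∀ {x} → x ≢ 0# → x ⁻¹ * x ≡ 1#
  *-inverseˡ nz = trans (*-comm _ _) (*-inverseʳ nz)

  ⁻¹-≢0 : ∀ {x} → x ≢ 0# → x ⁻¹ ≢ 0#
  ⁻¹-≢0 {x} nz e = 0≢1 (trans (sym (zeroʳ x)) (trans (cong (x *_) (sym e)) (*-inverseʳ nz)))

  difference : ∀ {x y} → x ≡ y → x + - y ≡ 0#
  difference {x} refl = -‿inverseʳ x

  difference⇒≡ : ∀ {x y} → x + - y ≡ 0# → x ≡ y
  difference⇒≡ {x} {y} e = trans (solve 2 (λ x y → x := (x :- y) :+ y) refl x y) (trans (cong (_+ y) e) (+-identityˡ y))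

  *-cancelˡ : ∀ {x y z} → x ≢ 0# → x * y ≡ x * z → y ≡ z
  *-cancelˡ {x} {y} {z} nz e = difference⇒≡ (x*y≡0⇒y≡0 nz (trans (solve 3 (λ x y z → x :* (y :- z) := x :* y :- x :* z) refl x y z) (difference e)))

  -- Linear combinations of hypotheses: the remaining identity is for the ring solver.
  infixr 5 _⟪_⟫_
  data Zero : K → Set where
    done    : Zero 0#
    _⟪_⟫_  : ∀ k {u v z} → u ≡ v → Zero z → Zero (k * (u + - v) + z)

  zero-≡ : ∀ {z} → Zero z → z ≡ 0#
  zero-≡ done = refl
  zero-≡ (k ⟪ e ⟫ h) = trans (cong₂ (λ d z → k * d + z) (difference e) (zero-≡ h)) (trans (+-identityʳ _) (zeroʳ k))

  combine : ∀ {x y z} → Zero z → x ≡ y + z → x ≡ y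
  combine {y = y} h e = trans e (trans (cong (y +_) (zero-≡ h)) (+-identityʳ y))

  private
    shift : (f g : K → K) → (∀ x → f (g x) ≡ x) → (∀ x → g (f x) ≡ x) → Permutation′ N
    shift f g fg gf = permutation (λ i → to (f (from i))) (λ i → to (g (from i)))
      (λ i → trans (cong (to ∘ f) (from∘to _)) (trans (cong to (fg _)) (inverseˡ refl)))
      (λ i → trans (cong (to ∘ g) (from∘to _)) (trans (cong to (gf _)) (inverseˡ refl)))

  -- Adding 1 permutes the field, so the sum S of all elements satisfies S = S + N·1.
  characteristic : N ⊗ 1# ≡ 0#
  characteristic = begin
    N ⊗ 1#                     ≡⟨ solve 2 (λ s n → n := :- s :+ (s :+ n)) refl S (N ⊗ 1#) ⟩
    - S + (S + N ⊗ 1#)         ≡⟨ cong (- S +_) (sym S≡S+N) ⟩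
    - S + S                    ≡⟨ -‿inverseˡ S ⟩
    0#                         ∎
    where
    open ≡-Reasoning
    S = Σ′.sum from
    π = shift (_+ 1#) (_+ - 1#)
      (λ x → solve 1 (λ x → x :- 𝟙 :+ 𝟙 := x) refl x)
      (λ x → solve 1 (λ x → x :+ 𝟙 :- 𝟙 := x) refl x)
    S≡S+N : S ≡ S + N ⊗ 1#
    S≡S+N = begin
      S                                            ≡⟨ Σ′.∑-permute from π ⟩
      Σ′.sum (λ i → from (to (from i + 1#)))       ≡⟨ Σ′.sum-cong-≗ (λ i → from∘to (from i + 1#)) ⟩
      Σ′.sum (λ i → from i + 1#)                   ≡⟨ Σ′.∑-distrib-+ from (λ _ → 1#) ⟩
      S + Σ′.sum {N} (λ _ → 1#)                    ≡⟨ cong (S +_) (Σ′.sum-replicate N) ⟩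
      S + N ⊗ 1#                                   ∎

  private
    Π-≢0 : ∀ {n} (f : Fin n → K) → (∀ i → f i ≢ 0#) → Π.sum f ≢ 0#
    Π-≢0 {zero} f nz e = 0≢1 (sym e)
    Π-≢0 {suc n} f nz = *-≢0 (nz zero) (Π-≢0 (f ∘ suc) (nz ∘ suc))

    Π-except : ∀ {n} (f : Fin n → K) i → (∀ j → j ≢ i → f j ≡ 1#) → Π.sum f ≡ f i
    Π-except {suc n} f i e = begin
      Π.sum f                              ≡⟨ Π.sum-remove f ⟩
      f i * Π.sum (Functional.removeAt f i)
        ≡⟨ cong (f i *_) (trans (Π.sum-cong-≗ (λ j → e _ (Fin.punchInᵢ≢i i j))) (Π.sum-replicate-zero n)) ⟩
      f i * 1#                             ≡⟨ *-identityʳ _ ⟩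
      f i                                  ∎
      where open ≡-Reasoning

  -- Multiplication by x ≠ 0 permutes the field. With 0 replaced by 1 (the map `g`), the product of
  -- all elements changes by the product of the factors `h`, so the latter product is 1. The
  -- correcting factors `k`, equal to x at 0 and to 1 elsewhere, make `h y * k y` the constant x.
  fermat : ∀ x → x ^ N ≡ x
  fermat x with x ≟ 0#
  ... | yes refl = 0^ (to 0#)
    where
    0^ : ∀ {n} → Fin n → 0# ^ n ≡ 0#
    0^ {suc n} _ = zeroˡ _
  ... | no x≢0 = begin
    x ^ N                               ≡⟨ sym (Π.sum-replicate N) ⟩
    Π.sum {N} (λ _ → x)                 ≡⟨ Π.sum-cong-≗ (λ i → h*k (from i)) ⟩
    Π.sum (λ i → h (from i) * k (from i)) ≡⟨ Π.∑-distrib-+ (h ∘ from) (k ∘ from) ⟩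
    Π.sum (h ∘ from) * Π.sum (k ∘ from) ≡⟨ cong₂ _*_ Πh≡1 Πk≡x ⟩
    1# * x                              ≡⟨ *-identityˡ x ⟩
    x                                   ∎
    where
    open ≡-Reasoning
    h k g : K → K
    h y with y ≟ 0#
    ... | yes _ = 1#
    ... | no _ = x
    k y with y ≟ 0#
    ... | yes _ = x
    ... | no _ = 1#
    g y with y ≟ 0#
    ... | yes _ = 1#
    ... | no _ = y
    h*k : ∀ y → x ≡ h y * k y
    h*k y with y ≟ 0#
    ... | yes _ = sym (*-identityˡ x)
    ... | no _ = sym (*-identityʳ x)
    g≢0 : ∀ y → g y ≢ 0#
    g≢0 y with y ≟ 0#
    ... | yes _ = 0≢1 ∘ sym
    ... | no nz = nz
    g-* : ∀ y → g (x * y) ≡ h y * g y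
    g-* y with y ≟ 0# | x * y ≟ 0#
    ... | yes _ | yes _ = sym (*-identityˡ 1#)
    ... | yes refl | no nz = contradiction (zeroʳ x) nz
    ... | no nz | yes z = contradiction (x*y≡0⇒y≡0 x≢0 z) nz
    ... | no _ | no _ = refl
    k-1 : ∀ j → j ≢ to 0# → k (from j) ≡ 1#
    k-1 j j≢ with from j ≟ 0#
    ... | yes z = contradiction (trans (sym (inverseˡ refl)) (cong to z)) j≢
    ... | no _ = refl
    k-x : k (from (to 0#)) ≡ x
    k-x with from (to 0#) ≟ 0#
    ... | yes _ = refl
    ... | no nz = contradiction (from∘to 0#) nz
    Πk≡x : Π.sum (k ∘ from) ≡ x
    Πk≡x = trans (Π-except (k ∘ from) (to 0#) k-1) k-x
    G = Π.sum (g ∘ from)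
    π = shift (x *_) (x ⁻¹ *_)
      (λ y → trans (sym (*-assoc _ _ _)) (trans (cong (_* y) (*-inverseʳ x≢0)) (*-identityˡ y)))
      (λ y → trans (sym (*-assoc _ _ _)) (trans (cong (_* y) (*-inverseˡ x≢0)) (*-identityˡ y)))
    G≡ : G ≡ Π.sum (h ∘ from) * G
    G≡ = begin
      G                                              ≡⟨ Π.∑-permute (g ∘ from) π ⟩
      Π.sum (λ i → g (from (to (x * from i))))       ≡⟨ Π.sum-cong-≗ (λ i → trans (cong g (from∘to _)) (g-* (from i))) ⟩
      Π.sum (λ i → h (from i) * g (from i))          ≡⟨ Π.∑-distrib-+ (h ∘ from) (g ∘ from) ⟩
      Π.sum (h ∘ from) * G                           ∎
    Πh≡1 : Π.sum (h ∘ from) ≡ 1#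
    Πh≡1 = *-cancelˡ (Π-≢0 (g ∘ from) (g≢0 ∘ from))
      (trans (*-comm G _) (trans (sym G≡) (sym (*-identityʳ G))))

  module _ {p} (pp : Prime p) (char : p ⊗ 1# ≡ 0#) where

    private
      multiple-zero : ∀ {n} x → p ∣ n → n ⊗ x ≡ 0#
      multiple-zero {n} x (divides k refl) = begin
        (k ℕ.* p) ⊗ x              ≡⟨ cong ((k ℕ.* p) ⊗_) (sym (*-identityˡ x)) ⟩
        (k ℕ.* p) ⊗ (1# * x)       ≡⟨ sym (Multiples.×-assoc-* (k ℕ.* p) 1# x) ⟩
        (k ℕ.* p) ⊗ 1# * x         ≡⟨ cong (_* x) (×1-homo-* k p) ⟩
        (k ⊗ 1#) * (p ⊗ 1#) * x    ≡⟨ cong (λ z → (k ⊗ 1#) * z * x) char ⟩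
        (k ⊗ 1#) * 0# * x          ≡⟨ trans (cong (_* x) (zeroʳ _)) (zeroˡ x) ⟩
        0#                         ∎
        where open ≡-Reasoning

      -- The inner binomial coefficients are multiples of p and vanish, which leaves the two extreme
      -- terms of the binomial theorem.
      frobenius₁ : ∀ x y → (x + y) ^ p ≡ x ^ p + y ^ p
      frobenius₁ x y = trans (Binomial.theorem commutativeSemiring p x y) (go p pp refl)
        where
        open ≡-Reasoning
        t : ∀ n → Fin (suc n) → K
        t n k = (n ℕ.C toℕ k) ⊗ ((x ^ toℕ k) * (y ^ (n ℕ.∸ toℕ k)))
        -- The exponent becomes a variable n with p ≡ n, because the end terms of the sum can be
        -- split off only from a visible successor.
        go : ∀ n → Prime n → p ≡ n → Σ′.sum (t n) ≡ x ^ n + y ^ n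
        go (suc m) _ p≡n = begin
          t (suc m) zero + Σ′.sum (t (suc m) ∘ suc)
            ≡⟨ cong (t (suc m) zero +_) (Σ′.sum-init-last (t (suc m) ∘ suc)) ⟩
          t (suc m) zero + (Σ′.sum (λ i → t (suc m) (suc (inject₁ i))) + t (suc m) (suc (fromℕ m)))
            ≡⟨ cong₂ (λ a b → t (suc m) zero + (a + b)) (trans (Σ′.sum-cong-≗ middle) (Σ′.sum-replicate-zero m)) last-term ⟩
          t (suc m) zero + (0# + x ^ suc m)
            ≡⟨ cong₂ _+_ first-term (+-identityˡ _) ⟩
          y ^ suc m + x ^ suc m
            ≡⟨ +-comm _ _ ⟩
          x ^ suc m + y ^ suc m ∎
          where
          middle : ∀ i → t (suc m) (suc (inject₁ i)) ≡ 0#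
          middle i = multiple-zero _ (subst (_∣ suc m ℕ.C suc (toℕ (inject₁ i))) (sym p≡n)
            (prime∣binomial (subst Prime p≡n pp) (s≤s z≤n)
              (s≤s (subst (ℕ._< m) (sym (Fin.toℕ-inject₁ i)) (Fin.toℕ<n i)))))
          first-term : t (suc m) zero ≡ y ^ suc m
          first-term = trans (+-identityʳ _) (*-identityˡ _)
          last-term : t (suc m) (suc (fromℕ m)) ≡ x ^ suc m
          last-term rewrite Fin.toℕ-fromℕ m | nCn≡1 (suc m) | ℕ.n∸n≡0 m = trans (+-identityʳ _) (*-identityʳ _)

    frobenius : ∀ k x y → (x + y) ^ (p ℕ.^ k) ≡ x ^ (p ℕ.^ k) + y ^ (p ℕ.^ k)
    frobenius zero x y = trans (*-identityʳ _) (sym (cong₂ _+_ (*-identityʳ x) (*-identityʳ y)))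
    frobenius (suc k) x y = begin
      (x + y) ^ (p ℕ.* p ℕ.^ k)                          ≡⟨ sym (^-assocʳ (x + y) p (p ℕ.^ k)) ⟩
      ((x + y) ^ p) ^ (p ℕ.^ k)                          ≡⟨ cong (_^ (p ℕ.^ k)) (frobenius₁ x y) ⟩
      (x ^ p + y ^ p) ^ (p ℕ.^ k)                        ≡⟨ frobenius k (x ^ p) (y ^ p) ⟩
      (x ^ p) ^ (p ℕ.^ k) + (y ^ p) ^ (p ℕ.^ k)          ≡⟨ cong₂ _+_ (^-assocʳ x p _) (^-assocʳ y p _) ⟩
      x ^ (p ℕ.* p ℕ.^ k) + y ^ (p ℕ.* p ℕ.^ k)          ∎
      where open ≡-Reasoning

  -- The order p^k of the field vanishes in it, and p^k · 1 is the k-th power of p · 1, so p · 1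
  -- vanishes as well.
  prime-characteristic : ∀ p k → N ≡ p ℕ.^ k → p ⊗ 1# ≡ 0#
  prime-characteristic p k N≡ = ^-≡0 k (trans (sym (power k)) (trans (cong (_⊗ 1#) (sym N≡)) characteristic))
    where
    power : ∀ k → (p ℕ.^ k) ⊗ 1# ≡ (p ⊗ 1#) ^ k
    power zero = +-identityʳ 1#
    power (suc k) = trans (×1-homo-* p (p ℕ.^ k)) (cong ((p ⊗ 1#) *_) (power k))

-- The field K of order q³, its automorphism φ and linear algebra over K

module GaloisField (q : ℕ) (q-pp : IsPrimePower q) (6≤q : 6 ℕ.≤ q)
                   (𝕂 : Field) (iso : Field.Carrier 𝕂 ↔ Fin (q ℕ.^ 3)) where

  open Field 𝕂 public using (0≢1) renaming (Carrier to K)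
  open FiniteField 𝕂 iso public
  open Exp semiring public using (_^_)
  open Exp semiring using (^-assocʳ)
  open CommutativeExp commutativeSemiring using (^-distrib-*)
  open Geometry 𝕂 q public

  1≢0 : 1# ≢ 0#
  1≢0 = 0≢1 ∘ sym

  φ : K → K
  φ x = x ^ q

  φ-+ : ∀ x y → φ (x + y) ≡ φ x + φ y
  φ-+ x y = let (p , k , pp , _ , q≡) = q-pp in subst (λ n → (x + y) ^ n ≡ x ^ n + y ^ n) (sym q≡)
    (frobenius pp (prime-characteristic p (k ℕ.* 3) (trans (cong (ℕ._^ 3) q≡) (ℕ.^-*-assoc p k 3))) k x y)

  φ-* : ∀ x y → φ (x * y) ≡ φ x * φ y
  φ-* x y = ^-distrib-* x y q

  φ³ : ∀ x → φ (φ (φ x)) ≡ x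
  φ³ x = begin
    ((x ^ q) ^ q) ^ q       ≡⟨ cong (_^ q) (^-assocʳ x q q) ⟩
    (x ^ (q ℕ.* q)) ^ q     ≡⟨ ^-assocʳ x (q ℕ.* q) q ⟩
    x ^ (q ℕ.* q ℕ.* q)     ≡⟨ cong (x ^_) (trans (ℕ.*-assoc q q q) (cong (λ n → q ℕ.* (q ℕ.* n)) (sym (ℕ.*-identityʳ q)))) ⟩
    x ^ (q ℕ.^ 3)           ≡⟨ fermat x ⟩
    x                       ∎
    where open ≡-Reasoning

  φ-0 : φ 0# ≡ 0#
  φ-0 = 0^ 6≤q
    where
    0^ : ∀ {n} → 6 ℕ.≤ n → 0# ^ n ≡ 0#
    0^ (s≤s _) = zeroˡ _

  φ-1 : φ 1# ≡ 1#
  φ-1 = 1^ q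
    where
    1^ : ∀ n → 1# ^ n ≡ 1#
    1^ zero = refl
    1^ (suc n) = trans (*-identityˡ _) (1^ n)

  φ-neg : ∀ x → φ (- x) ≡ - φ x
  φ-neg x = begin
    φ (- x)                       ≡⟨ solve 2 (λ a b → a := (a :+ b) :- b) refl (φ (- x)) (φ x) ⟩
    (φ (- x) + φ x) + - φ x       ≡⟨ cong (_+ - φ x) (trans (sym (φ-+ (- x) x)) (trans (cong φ (-‿inverseˡ x)) φ-0)) ⟩
    0# + - φ x                    ≡⟨ +-identityˡ _ ⟩
    - φ x                         ∎
    where open ≡-Reasoning

  φ-≢0 : ∀ {x} → x ≢ 0# → φ x ≢ 0#
  φ-≢0 nz = nz ∘ ^-≡0 q

  φ-⁻¹ : ∀ {x} → x ≢ 0# → φ (x ⁻¹) ≡ φ x ⁻¹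
  φ-⁻¹ {x} nz = *-cancelˡ (φ-≢0 nz) (begin
    φ x * φ (x ⁻¹)   ≡⟨ sym (φ-* x (x ⁻¹)) ⟩
    φ (x * x ⁻¹)     ≡⟨ trans (cong φ (*-inverseʳ nz)) φ-1 ⟩
    1#               ≡⟨ sym (*-inverseʳ (φ-≢0 nz)) ⟩
    φ x * φ x ⁻¹     ∎)
    where open ≡-Reasoning

  𝔽q-+ : ∀ {x y} → 𝔽q x → 𝔽q y → 𝔽q (x + y)
  𝔽q-+ {x} {y} fx fy = trans (φ-+ x y) (cong₂ _+_ fx fy)
  𝔽q-* : ∀ {x y} → 𝔽q x → 𝔽q y → 𝔽q (x * y)
  𝔽q-* {x} {y} fx fy = trans (φ-* x y) (cong₂ _*_ fx fy)
  𝔽q-neg : ∀ {x} → 𝔽q x → 𝔽q (- x)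
  𝔽q-neg {x} fx = trans (φ-neg x) (cong -_ fx)
  𝔽q-⁻¹ : ∀ {x} → x ≢ 0# → 𝔽q x → 𝔽q (x ⁻¹)
  𝔽q-⁻¹ nz fx = trans (φ-⁻¹ nz) (cong _⁻¹ fx)

  𝔽q? : Decidable 𝔽q
  𝔽q? x = φ x ≟ x

  ∃? : ∀ {P : K → Set} → Decidable P → Dec (∃[ x ] P x)
  ∃? {P} P? = Dec.map′ (λ (i , p) → Inverse.from iso i , p)
    (λ (x , p) → Inverse.to iso x , subst P (sym (from∘to x)) p)
    (Fin.any? (P? ∘ Inverse.from iso))

  Tr : K → K
  Tr x = x + φ x + φ (φ x)

  +ᵛ-comm : ∀ {n} (u v : Vec K n) → u +ᵛ v ≡ v +ᵛ u
  +ᵛ-comm = zipWith-comm +-comm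
  +ᵛ-assoc : ∀ {n} (u v w : Vec K n) → (u +ᵛ v) +ᵛ w ≡ u +ᵛ (v +ᵛ w)
  +ᵛ-assoc = zipWith-assoc +-assoc
  +ᵛ-identityˡ : ∀ {n} (u : Vec K n) → 𝟎 +ᵛ u ≡ u
  +ᵛ-identityˡ = zipWith-identityˡ +-identityˡ
  +ᵛ-identityʳ : ∀ {n} (u : Vec K n) → u +ᵛ 𝟎 ≡ u
  +ᵛ-identityʳ = zipWith-identityʳ +-identityʳ

  +ᵛ-interchange : ∀ {n} (a b c d : Vec K n) → (a +ᵛ b) +ᵛ (c +ᵛ d) ≡ (a +ᵛ c) +ᵛ (b +ᵛ d)
  +ᵛ-interchange [] [] [] [] = refl
  +ᵛ-interchange (a ∷ as) (b ∷ bs) (c ∷ cs) (d ∷ ds) = cong₂ _∷_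
    (solve 4 (λ a b c d → (a :+ b) :+ (c :+ d) := (a :+ c) :+ (b :+ d)) refl a b c d) (+ᵛ-interchange as bs cs ds)

  ·ᵛ-identity : ∀ {n} (v : Vec K n) → 1# ·ᵛ v ≡ v
  ·ᵛ-identity v = trans (map-cong *-identityˡ v) (map-id v)
  ·ᵛ-assoc : ∀ {n} a b (v : Vec K n) → a ·ᵛ (b ·ᵛ v) ≡ (a * b) ·ᵛ v
  ·ᵛ-assoc a b v = trans (sym (map-∘ _ _ v)) (map-cong (λ x → sym (*-assoc a b x)) v)
  ·ᵛ-zeroˡ : ∀ {n} (v : Vec K n) → 0# ·ᵛ v ≡ 𝟎
  ·ᵛ-zeroˡ [] = refl
  ·ᵛ-zeroˡ (x ∷ v) = cong₂ _∷_ (zeroˡ x) (·ᵛ-zeroˡ v)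
  ·ᵛ-zeroʳ : ∀ {n} a → a ·ᵛ 𝟎 {n} ≡ 𝟎
  ·ᵛ-zeroʳ {zero} a = refl
  ·ᵛ-zeroʳ {suc n} a = cong₂ _∷_ (zeroʳ a) (·ᵛ-zeroʳ a)
  ·ᵛ-distribˡ : ∀ {n} a (u v : Vec K n) → a ·ᵛ (u +ᵛ v) ≡ a ·ᵛ u +ᵛ a ·ᵛ v
  ·ᵛ-distribˡ a [] [] = refl
  ·ᵛ-distribˡ a (x ∷ u) (y ∷ v) = cong₂ _∷_ (solve 3 (λ a x y → a :* (x :+ y) := a :* x :+ a :* y) refl a x y) (·ᵛ-distribˡ a u v)
  ·ᵛ-distribʳ : ∀ {n} a b (v : Vec K n) → (a + b) ·ᵛ v ≡ a ·ᵛ v +ᵛ b ·ᵛ v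
  ·ᵛ-distribʳ a b [] = refl
  ·ᵛ-distribʳ a b (x ∷ v) = cong₂ _∷_ (solve 3 (λ a b x → (a :+ b) :* x := a :* x :+ b :* x) refl a b x) (·ᵛ-distribʳ a b v)
  ·ᵛ-inverse : ∀ {n a} (v : Vec K n) → a ≢ 0# → a ⁻¹ ·ᵛ (a ·ᵛ v) ≡ v
  ·ᵛ-inverse {a = a} v nz = trans (·ᵛ-assoc (a ⁻¹) a v) (trans (cong (_·ᵛ v) (*-inverseˡ nz)) (·ᵛ-identity v))

  ·ᵛ-≡𝟎 : ∀ {n a} {v : Vec K n} → a ≢ 0# → a ·ᵛ v ≡ 𝟎 → v ≡ 𝟎
  ·ᵛ-≡𝟎 {a = a} {v} nz e = trans (sym (·ᵛ-inverse v nz)) (trans (cong (a ⁻¹ ·ᵛ_) e) (·ᵛ-zeroʳ _))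

  𝟎? : ∀ {n} (v : Vec K n) → Dec (v ≡ 𝟎)
  𝟎? [] = yes refl
  𝟎? (x ∷ v) = Dec.map′ (λ (a , b) → cong₂ _∷_ a b) (λ e → ∷-injectiveˡ e , ∷-injectiveʳ e) ((x ≟ 0#) ×-dec 𝟎? v)

  difference-≡𝟎 : ∀ {n} (u v : Vec K n) → u +ᵛ (- 1#) ·ᵛ v ≡ 𝟎 → u ≡ v
  difference-≡𝟎 [] [] _ = refl
  difference-≡𝟎 (x ∷ u) (y ∷ v) e = cong₂ _∷_
    (combine (1# ⟪ ∷-injectiveˡ e ⟫ done) (solve 2 (λ x y →
      x := y :+ (𝟙 :* ((x :+ (:- 𝟙) :* y) :- 𝟘) :+ 𝟘)) refl x y))
    (difference-≡𝟎 u v (∷-injectiveʳ e))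

  -ᵛ-self : ∀ {n} (v : Vec K n) → v +ᵛ (- 1#) ·ᵛ v ≡ 𝟎
  -ᵛ-self [] = refl
  -ᵛ-self (x ∷ v) = cong₂ _∷_ (solve 1 (λ x → x :+ (:- 𝟙) :* x := 𝟘) refl x) (-ᵛ-self v)

  all-U : ∀ {n} (v : Vec K n) → All 𝔽q³ v
  all-U v = All.universal (λ _ → tt) v

  lincomb-+ : ∀ {m n} (cs ds : Vec K m) (vs : Vec (Vec K n) m) → lincomb (cs +ᵛ ds) vs ≡ lincomb cs vs +ᵛ lincomb ds vs
  lincomb-+ [] [] [] = sym (+ᵛ-identityˡ 𝟎)
  lincomb-+ (c ∷ cs) (d ∷ ds) (v ∷ vs) = trans (cong₂ _+ᵛ_ (·ᵛ-distribʳ c d v) (lincomb-+ cs ds vs)) (+ᵛ-interchange _ _ _ _)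

  lincomb-· : ∀ {m n} c (cs : Vec K m) (vs : Vec (Vec K n) m) → lincomb (c ·ᵛ cs) vs ≡ c ·ᵛ lincomb cs vs
  lincomb-· c [] [] = sym (·ᵛ-zeroʳ c)
  lincomb-· c (d ∷ ds) (v ∷ vs) = trans (cong₂ _+ᵛ_ (sym (·ᵛ-assoc c d v)) (lincomb-· c ds vs)) (sym (·ᵛ-distribˡ c _ _))

  lincomb-𝟎 : ∀ {m n} (vs : Vec (Vec K n) m) → lincomb 𝟎 vs ≡ 𝟎
  lincomb-𝟎 [] = refl
  lincomb-𝟎 (v ∷ vs) = trans (cong₂ _+ᵛ_ (·ᵛ-zeroˡ v) (lincomb-𝟎 vs)) (+ᵛ-identityˡ 𝟎)

  lincomb-++ : ∀ {m m′ n} (cs : Vec K m) (ds : Vec K m′) (vs : Vec (Vec K n) m) ws →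
    lincomb (cs ++ ds) (vs ++ ws) ≡ lincomb cs vs +ᵛ lincomb ds ws
  lincomb-++ [] ds [] ws = sym (+ᵛ-identityˡ _)
  lincomb-++ (c ∷ cs) ds (v ∷ vs) ws = trans (cong (c ·ᵛ v +ᵛ_) (lincomb-++ cs ds vs ws)) (sym (+ᵛ-assoc _ _ _))

  record Linear {m n} (f : Vec K m → Vec K n) : Set where
    field
      additive    : ∀ u v → f (u +ᵛ v) ≡ f u +ᵛ f v
      homogeneous : ∀ c v → f (c ·ᵛ v) ≡ c ·ᵛ f v

    zero-↦ : f 𝟎 ≡ 𝟎
    zero-↦ = trans (cong f (sym (·ᵛ-zeroˡ 𝟎))) (trans (homogeneous 0# 𝟎) (·ᵛ-zeroˡ _))

    lincomb-↦ : ∀ {k} (cs : Vec K k) vs → f (lincomb cs vs) ≡ lincomb cs (map f vs)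
    lincomb-↦ [] [] = zero-↦
    lincomb-↦ (c ∷ cs) (v ∷ vs) = trans (additive _ _) (cong₂ _+ᵛ_ (homogeneous c v) (lincomb-↦ cs vs))

    injective : (∀ v → f v ≡ 𝟎 → v ≡ 𝟎) → ∀ {u v} → f u ≡ f v → u ≡ v
    injective ker {u} {v} e = difference-≡𝟎 u v (ker _ (trans (additive u _) (trans (cong₂ _+ᵛ_ e (homogeneous (- 1#) v)) (-ᵛ-self _))))

  open Linear public

  lincomb-linear : ∀ {m n} (vs : Vec (Vec K n) m) → Linear (λ cs → lincomb cs vs)
  lincomb-linear vs = record { additive = λ u v → lincomb-+ u v vs ; homogeneous = λ c v → lincomb-· c v vs }

  lincomb-lincomb : ∀ {l m n} (cs : Vec K l) (us : Vec (Vec K m) l) (vs : Vec (Vec K n) m) →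
    lincomb (lincomb cs us) vs ≡ lincomb cs (map (λ u → lincomb u vs) us)
  lincomb-lincomb cs us vs = lincomb-↦ (lincomb-linear vs) cs us

  frob-+ : ∀ {n} (u v : Vec K n) → frob (u +ᵛ v) ≡ frob u +ᵛ frob v
  frob-+ [] [] = refl
  frob-+ (x ∷ u) (y ∷ v) = cong₂ _∷_ (φ-+ x y) (frob-+ u v)
  frob-· : ∀ {n} c (v : Vec K n) → frob (c ·ᵛ v) ≡ φ c ·ᵛ frob v
  frob-· c [] = refl
  frob-· c (x ∷ v) = cong₂ _∷_ (φ-* c x) (frob-· c v)
  frob-𝟎 : ∀ {n} → frob (𝟎 {n}) ≡ 𝟎
  frob-𝟎 {zero} = refl
  frob-𝟎 {suc n} = cong₂ _∷_ φ-0 frob-𝟎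
  frob³ : ∀ {n} (v : Vec K n) → frob (frob (frob v)) ≡ v
  frob³ [] = refl
  frob³ (x ∷ v) = cong₂ _∷_ (φ³ x) (frob³ v)
  frob-lincomb : ∀ {m n} (cs : Vec K m) (vs : Vec (Vec K n) m) → frob (lincomb cs vs) ≡ lincomb (frob cs) (map frob vs)
  frob-lincomb [] [] = frob-𝟎
  frob-lincomb (c ∷ cs) (v ∷ vs) = trans (frob-+ _ _) (cong₂ _+ᵛ_ (frob-· c v) (frob-lincomb cs vs))

  frob-fixed : ∀ {n} {v : Vec K n} → All 𝔽q v → frob v ≡ v
  frob-fixed [] = refl
  frob-fixed (e ∷ es) = cong₂ _∷_ e (frob-fixed es)
  fixed⇒All : ∀ {n} {v : Vec K n} → frob v ≡ v → All 𝔽q v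
  fixed⇒All {v = []} _ = []
  fixed⇒All {v = x ∷ v} e = ∷-injectiveˡ e ∷ fixed⇒All (∷-injectiveʳ e)

  frob-≡𝟎 : ∀ {n} {v : Vec K n} → frob v ≡ 𝟎 → v ≡ 𝟎
  frob-≡𝟎 {v = v} e = trans (sym (frob³ v)) (trans (cong (frob ∘ frob) e) (trans (cong frob frob-𝟎) frob-𝟎))

  φ-∙ : ∀ {n} (u v : Vec K n) → φ (u ∙ v) ≡ frob u ∙ frob v
  φ-∙ [] [] = φ-0
  φ-∙ (x ∷ u) (y ∷ v) = trans (φ-+ _ _) (cong₂ _+_ (φ-* x y) (φ-∙ u v))

  ∙-comm : ∀ {n} (u v : Vec K n) → u ∙ v ≡ v ∙ u
  ∙-comm [] [] = refl
  ∙-comm (x ∷ u) (y ∷ v) = cong₂ _+_ (*-comm x y) (∙-comm u v)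
  ∙-+ : ∀ {n} (w u v : Vec K n) → w ∙ (u +ᵛ v) ≡ w ∙ u + w ∙ v
  ∙-+ [] [] [] = sym (+-identityˡ 0#)
  ∙-+ (z ∷ w) (x ∷ u) (y ∷ v) = trans (cong (z * (x + y) +_) (∙-+ w u v))
    (solve 5 (λ z x y a b → z :* (x :+ y) :+ (a :+ b) := (z :* x :+ a) :+ (z :* y :+ b)) refl z x y (w ∙ u) (w ∙ v))
  ∙-· : ∀ {n} (w : Vec K n) c v → w ∙ (c ·ᵛ v) ≡ c * (w ∙ v)
  ∙-· [] c [] = sym (zeroʳ c)
  ∙-· (z ∷ w) c (x ∷ v) = trans (cong (z * (c * x) +_) (∙-· w c v))
    (solve 4 (λ z c x a → z :* (c :* x) :+ c :* a := c :* (z :* x :+ a)) refl z c x (w ∙ v))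
  ∙-𝟎 : ∀ {n} (w : Vec K n) → w ∙ 𝟎 ≡ 0#
  ∙-𝟎 w = trans (cong (w ∙_) (sym (·ᵛ-zeroˡ 𝟎))) (trans (∙-· w 0# 𝟎) (zeroˡ _))
  ∙-lincomb : ∀ {m n} (w : Vec K n) (cs : Vec K m) vs → w ∙ lincomb cs vs ≡ cs ∙ map (w ∙_) vs
  ∙-lincomb w [] [] = ∙-𝟎 w
  ∙-lincomb w (c ∷ cs) (v ∷ vs) = trans (∙-+ w _ _) (cong₂ _+_ (∙-· w c v) (∙-lincomb w cs vs))

  abstract

    -- An injective map of the finite set K^n into itself is onto; this stands in for rank and
    -- nullity.
    linear-surjective : ∀ {n} {f : Vec K n → Vec K n} → Linear f → (∀ v → f v ≡ 𝟎 → v ≡ 𝟎) → ∀ y → ∃[ x ] f x ≡ y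
    linear-surjective {n} lin ker = injective⇒surjective (Vec↔Fin iso n) (injective lin ker)

    linear-injective : ∀ {n} {f : Vec K n → Vec K n} → (∀ y → ∃[ x ] f x ≡ y) → ∀ {u v} → f u ≡ f v → u ≡ v
    linear-injective {n} surj = surjective⇒injective (Vec↔Fin iso n) surj

  1<q³ : 1 ℕ.< q ℕ.^ 3
  1<q³ = ℕ.<-≤-trans (s≤s (s≤s z≤n)) (ℕ.^-monoˡ-≤ 3 6≤q)

  abstract

    -- There are more coefficient vectors than values of the combination, so two of them collide,
    -- and their difference is the relation.
    dependent : ∀ {n} (vs : Vec (Vec K n) (suc n)) → ∃[ cs ] (cs ≢ 𝟎 × lincomb cs vs ≡ 𝟎)
    dependent {n} vs = u +ᵛ (- 1#) ·ᵛ v , u≢v ∘ difference-≡𝟎 u v ,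
        trans (lincomb-+ u ((- 1#) ·ᵛ v) vs) (trans (cong₂ _+ᵛ_ (to-injective (Vec↔Fin iso n) eq) (lincomb-· (- 1#) v vs)) (-ᵛ-self _))
      where
      from : Fin ((q ℕ.^ 3) ℕ.^ suc n) → Vec K (suc n)
      from = Inverse.from (Vec↔Fin iso (suc n))
      combination : Fin ((q ℕ.^ 3) ℕ.^ suc n) → Fin ((q ℕ.^ 3) ℕ.^ n)
      combination i = Inverse.to (Vec↔Fin iso n) (lincomb (from i) vs)
      collision : ∃[ i ] ∃[ j ] (i Fin′.< j × combination i ≡ combination j)
      collision = Fin.pigeonhole (ℕ.^-monoʳ-< (q ℕ.^ 3) 1<q³ (ℕ.n<1+n n)) combination
      i<j : proj₁ collision Fin′.< proj₁ (proj₂ collision)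
      i<j = proj₁ (proj₂ (proj₂ collision))
      eq : combination (proj₁ collision) ≡ combination (proj₁ (proj₂ collision))
      eq = proj₂ (proj₂ (proj₂ collision))
      u v : Vec K (suc n)
      u = from (proj₁ collision)
      v = from (proj₁ (proj₂ collision))
      u≢v : u ≢ v
      u≢v e = Fin.<⇒≢ i<j (from-injective (Vec↔Fin iso (suc n)) e)

-- The trace and the Moore matrix

module Moore (q : ℕ) (q-pp : IsPrimePower q) (6≤q : 6 ℕ.≤ q)
             (𝕂 : Field) (iso : Field.Carrier 𝕂 ↔ Fin (q ℕ.^ 3)) where

  open GaloisField q q-pp 6≤q 𝕂 iso

  -- As φ³ is the identity, the hypothesis at φ(φ x) reads x = φ x.
  φ≡⇒𝔽q : (∀ x → φ x ≡ φ (φ x)) → ∀ x → 𝔽q x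
  φ≡⇒𝔽q e x = trans (cong φ (sym (φ³ x))) (trans (sym (e (φ (φ x)))) (φ³ x))

  -- Dedekind's argument: if the trace vanished, comparing it at x and at z x would give φ = φ².
  trace-nonzero : ∀ {z} → ¬ 𝔽q z → ∃[ x ] Tr x ≢ 0#
  trace-nonzero {z} z∉𝔽q with ∃? (λ x → ¬? (Tr x ≟ 0#))
  ... | yes found = found
  ... | no none = contradiction (φ≡⇒𝔽q φ≡φφ z) z∉𝔽q
    where
    Tr≡0 : ∀ x → Tr x ≡ 0#
    Tr≡0 x with Tr x ≟ 0#
    ... | yes e = e
    ... | no ne = contradiction (x , ne) none
    z′ = φ z ; z″ = φ (φ z)
    -- Tr(z x) - z Tr(x) has no term in x itself.
    shifted : ∀ x → (z′ + - z) * φ x + (z″ + - z) * φ (φ x) ≡ 0#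
    shifted x = combine (1# ⟪ Tr≡0 (z * x) ⟫ - z ⟪ Tr≡0 x ⟫ 1# ⟪ sym (φ-* z x) ⟫ 1# ⟪ sym (trans (cong φ (φ-* z x)) (φ-* z′ (φ x))) ⟫ done)
      (solve 8 (λ z z′ z″ x x′ x″ t t′ →
        (z′ :- z) :* x′ :+ (z″ :- z) :* x″
        := 𝟘 :+ (𝟙 :* ((z :* x :+ t :+ t′) :- 𝟘) :+ ((:- z) :* ((x :+ x′ :+ x″) :- 𝟘)
             :+ (𝟙 :* (z′ :* x′ :- t) :+ (𝟙 :* (z″ :* x″ :- t′) :+ 𝟘)))))
        refl z z′ z″ x (φ x) (φ (φ x)) (φ (z * x)) (φ (φ (z * x))))
    z′-z≢0 : z′ + - z ≢ 0#
    z′-z≢0 e = z∉𝔽q (difference⇒≡ e)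
    -- Here `o′` and `o″` are the conjugates of 1: at 1 the relation says a + b = 0, which turns a
    -- x′ + b x″ = 0 into a x′ = a x″.
    lem : ∀ a b x′ x″ o′ o″ → a * x′ + b * x″ ≡ 0# → a * o′ + b * o″ ≡ 0# → o′ ≡ 1# → o″ ≡ 1# → a * x′ ≡ a * x″
    lem a b x′ x″ o′ o″ e₁ e₂ e₃ e₄ = combine (1# ⟪ e₁ ⟫ - x″ ⟪ e₂ ⟫ (x″ * a) ⟪ e₃ ⟫ (x″ * b) ⟪ e₄ ⟫ done) 
      (solve 6 (λ a b x′ x″ o′ o″ →
        a :* x′ := a :* x″ :+ (𝟙 :* ((a :* x′ :+ b :* x″) :- 𝟘) :+ ((:- x″) :* ((a :* o′ :+ b :* o″) :- 𝟘)
          :+ ((x″ :* a) :* (o′ :- 𝟙) :+ ((x″ :* b) :* (o″ :- 𝟙) :+ 𝟘)))))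
        refl a b x′ x″ o′ o″)
    φ≡φφ : ∀ x → φ x ≡ φ (φ x)
    φ≡φφ x = *-cancelˡ z′-z≢0 (lem (z′ + - z) (z″ + - z) (φ x) (φ (φ x)) (φ 1#) (φ (φ 1#)) (shifted x) (shifted 1#) φ-1 (trans (cong φ φ-1) φ-1))

  trᵛ : ∀ {n} → Vec K n → Vec K n
  trᵛ v = v +ᵛ (frob v +ᵛ frob (frob v))

  trᵛ-fixed : ∀ {n} (v : Vec K n) → frob (trᵛ v) ≡ trᵛ v
  trᵛ-fixed v = begin
    frob (v +ᵛ (frob v +ᵛ frob (frob v)))
      ≡⟨ trans (frob-+ _ _) (cong (frob v +ᵛ_) (trans (frob-+ _ _) (cong (frob (frob v) +ᵛ_) (frob³ v)))) ⟩
    frob v +ᵛ (frob (frob v) +ᵛ v)    ≡⟨ sym (+ᵛ-assoc _ _ _) ⟩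
    (frob v +ᵛ frob (frob v)) +ᵛ v    ≡⟨ +ᵛ-comm _ v ⟩
    v +ᵛ (frob v +ᵛ frob (frob v))    ∎
    where open ≡-Reasoning

  -- A nonzero entry x could be scaled by t x⁻¹ to t, whose trace does not vanish.
  trᵛ-≡𝟎 : ∀ {n t} {v : Vec K n} → Tr t ≢ 0# → (∀ c → trᵛ (c ·ᵛ v) ≡ 𝟎) → v ≡ 𝟎
  trᵛ-≡𝟎 {v = []} _ _ = refl
  trᵛ-≡𝟎 {t = t} {v = x ∷ v} t≢0 e = cong₂ _∷_ x≡0 (trᵛ-≡𝟎 t≢0 (λ c → ∷-injectiveʳ (e c)))
    where
    x≡0 : x ≡ 0#
    x≡0 with x ≟ 0#
    ... | yes z = z
    ... | no nz = contradiction (begin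
        Tr t                                   ≡⟨ +-assoc _ _ _ ⟩
        t + (φ t + φ (φ t))                    ≡⟨ cong (λ y → y + (φ y + φ (φ y))) (sym tx) ⟩
        _                                      ≡⟨ ∷-injectiveˡ (e (t * x ⁻¹)) ⟩
        0#                                     ∎) t≢0
      where
      open ≡-Reasoning
      tx : t * x ⁻¹ * x ≡ t
      tx = trans (*-assoc _ _ _) (trans (cong (t *_) (*-inverseˡ nz)) (*-identityʳ t))

  -- A ratio m₁/m₀ in GF(q) would give the relation (m₁/m₀, -1, 0). The element found here starts
  -- the trace argument.
  𝔽q-proper : (m : Vec K 3) → (∀ x → All 𝔽q x → m ∙ x ≡ 0# → x ≡ 𝟎) → ∃[ z ] ¬ 𝔽q z
  𝔽q-proper (m₀ ∷ m₁ ∷ m₂ ∷ []) indep with 𝔽q? (m₁ * m₀ ⁻¹)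
  ... | no z∉𝔽q = _ , z∉𝔽q
  ... | yes z∈𝔽q = contradiction (∷-injectiveˡ (∷-injectiveʳ (indep (z ∷ - 1# ∷ 0# ∷ []) (z∈𝔽q ∷ 𝔽q-neg φ-1 ∷ φ-0 ∷ []) dot)))
            (λ e → 1≢0 (combine (- 1# ⟪ e ⟫ done) (solve 0 (𝟙 := 𝟘 :+ ((:- 𝟙) :* ((:- 𝟙) :- 𝟘) :+ 𝟘)) refl)))
    where
    z = m₁ * m₀ ⁻¹
    m₀≢0 : m₀ ≢ 0#
    m₀≢0 e = 1≢0 (∷-injectiveˡ (indep (1# ∷ 0# ∷ 0# ∷ []) (φ-1 ∷ φ-0 ∷ φ-0 ∷ [])
      (combine (1# ⟪ e ⟫ done) (solve 3 (λ a b c → a :* 𝟙 :+ (b :* 𝟘 :+ (c :* 𝟘 :+ 𝟘)) := 𝟘 :+ (𝟙 :* (a :- 𝟘) :+ 𝟘)) refl m₀ m₁ m₂))))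
    dot : m₀ * z + (m₁ * - 1# + (m₂ * 0# + 0#)) ≡ 0#
    dot = combine (m₁ ⟪ *-inverseʳ m₀≢0 ⟫ done)
      (solve 4 (λ a i b c → a :* (b :* i) :+ (b :* (:- 𝟙) :+ (c :* 𝟘 :+ 𝟘)) := 𝟘 :+ (b :* (a :* i :- 𝟙) :+ 𝟘)) refl m₀ (m₀ ⁻¹) m₁ m₂)

  -- Applied to the coordinates of the line at infinity over a frame of the subplane, where
  -- independence over GF(q) says that the line is exterior, and later to a multiple of them.
  module Independent (m : Vec K 3) (indep : ∀ x → All 𝔽q x → m ∙ x ≡ 0# → x ≡ 𝟎) where

    m′ = frob m
    m″ = frob m′

    ∃trace : ∃[ x ] Tr x ≢ 0#
    ∃trace = trace-nonzero (proj₂ (𝔽q-proper m indep))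

    -- The Moore matrix of `m`; its rows are the conjugates of a single linear form.
    moore : Vec K 3 → Vec K 3
    moore y = m ∙ y ∷ m′ ∙ y ∷ m″ ∙ y ∷ []

    moore-linear : Linear moore
    moore-linear = record
      { additive = λ u v → cong₂ _∷_ (∙-+ m u v) (cong₂ _∷_ (∙-+ m′ u v) (cong₂ _∷_ (∙-+ m″ u v) refl))
      ; homogeneous = λ c v → cong₂ _∷_ (∙-· m c v) (cong₂ _∷_ (∙-· m′ c v) (cong₂ _∷_ (∙-· m″ c v) refl)) }

    m∙frob : ∀ z → m ∙ frob z ≡ φ (m″ ∙ z)
    m∙frob z = trans (cong (_∙ frob z) (sym (frob³ m))) (sym (φ-∙ m″ z))

    m∙frob² : ∀ z → m ∙ frob (frob z) ≡ φ (φ (m′ ∙ z))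
    m∙frob² z = trans (m∙frob (frob z)) (cong φ (sym (φ-∙ m′ z)))

    -- If `m`, `m′` and `m″` kill y, then `m` kills all conjugates of c y and hence its trace. That
    -- trace is a GF(q)-vector, so it is zero by independence. As this holds for every c and the
    -- trace is not identically zero, y = 0.
    moore-kernel : ∀ y → moore y ≡ 𝟎 → y ≡ 𝟎
    moore-kernel y e = trᵛ-≡𝟎 (proj₂ ∃trace) λ c → indep _ (fixed⇒All (trᵛ-fixed (c ·ᵛ y))) (begin
      m ∙ trᵛ (c ·ᵛ y)                                        ≡⟨ trans (∙-+ m _ _) (cong (m ∙ (c ·ᵛ y) +_) (∙-+ m _ _)) ⟩
      m ∙ (c ·ᵛ y) + (m ∙ frob (c ·ᵛ y) + m ∙ frob (frob (c ·ᵛ y)))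
        ≡⟨ cong₂ _+_ (vanish c m e₀) (cong₂ _+_ (trans (m∙frob _) (trans (cong φ (vanish c m″ e₂)) φ-0))
                                        (trans (m∙frob² _) (trans (cong (φ ∘ φ) (vanish c m′ e₁)) (trans (cong φ φ-0) φ-0)))) ⟩
      0# + (0# + 0#)                                          ≡⟨ trans (+-identityˡ _) (+-identityˡ _) ⟩
      0#                                                      ∎)
      where
      open ≡-Reasoning
      e₀ = ∷-injectiveˡ e
      e₁ = ∷-injectiveˡ (∷-injectiveʳ e)
      e₂ = ∷-injectiveˡ (∷-injectiveʳ (∷-injectiveʳ e))
      vanish : ∀ c w → w ∙ y ≡ 0# → w ∙ (c ·ᵛ y) ≡ 0#
      vanish c w w∙y = trans (∙-· w c y) (trans (cong (c *_) w∙y) (zeroʳ c))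

    moore-injective : ∀ {u v} → moore u ≡ moore v → u ≡ v
    moore-injective = injective moore-linear moore-kernel

    moore-surjective : ∀ z → ∃[ y ] moore y ≡ z
    moore-surjective = linear-surjective moore-linear moore-kernel

    moore-frob : ∀ y {a b c} → moore y ≡ a ∷ b ∷ c ∷ [] → moore (frob y) ≡ φ c ∷ φ a ∷ φ b ∷ []
    moore-frob y refl = cong₂ _∷_ (m∙frob y) (cong₂ _∷_ (sym (φ-∙ m y)) (cong (_∷ []) (sym (φ-∙ m′ y))))

    moore-fixed : ∀ x y → moore y ≡ x ∷ φ x ∷ φ (φ x) ∷ [] → frob y ≡ y
    moore-fixed x y e = moore-injective (begin
      moore (frob y)                          ≡⟨ moore-frob y {x} {φ x} {φ (φ x)} e ⟩
      φ (φ (φ x)) ∷ φ x ∷ φ (φ x) ∷ []        ≡⟨ cong (_∷ φ x ∷ φ (φ x) ∷ []) (φ³ x) ⟩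
      x ∷ φ x ∷ φ (φ x) ∷ []                  ≡⟨ sym e ⟩
      moore y                                 ∎)
      where open ≡-Reasoning

    -- Conjugating a vector conjugates its Moore values and shifts them cyclically, so the preimage
    -- of (x, x^q, x^(q²)) is fixed by Frobenius.
    𝔽q-coordinates : ∀ x → ∃[ y ] (All 𝔽q y × m ∙ y ≡ x)
    𝔽q-coordinates x =
      let y , e = moore-surjective (x ∷ φ x ∷ φ (φ x) ∷ [])
      in y , fixed⇒All (moore-fixed x y e) , ∷-injectiveˡ e

    private
      code : K → Fin 3
      code x with x ≟ 0# | x ≟ 1#
      ... | yes _ | _     = zero
      ... | no _  | yes _ = suc zero
      ... | no _  | no _  = suc (suc zero)

      decode : K → Fin 3 → K
      decode a zero = 0#
      decode a (suc zero) = 1#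
      decode a (suc (suc zero)) = a

      decode-code : ∀ {a x} → x ≡ 0# ⊎ x ≡ 1# ⊎ x ≡ a → decode a (code x) ≡ x
      decode-code {a} {x} h with x ≟ 0# | x ≟ 1# | h
      ... | yes z | _     | _               = sym z
      ... | no _  | yes z | _               = sym z
      ... | no nz | no _  | inj₁ z          = contradiction z nz
      ... | no _  | no nz | inj₂ (inj₁ z)   = contradiction z nz
      ... | no _  | no _  | inj₂ (inj₂ z)   = sym z

      decode-codes : ∀ {a n} {y : Vec K n} → (∀ x → 𝔽q x → x ≡ 0# ⊎ x ≡ 1# ⊎ x ≡ a) → All 𝔽q y → map (decode a) (map code y) ≡ y
      decode-codes few [] = refl
      decode-codes few (f ∷ fs) = cong₂ _∷_ (decode-code (few _ f)) (decode-codes few fs)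

      -- Three possible values for each of three coordinates would leave room for only 27 elements
      -- of K.
      not-three : ∀ a → ¬ (∀ x → 𝔽q x → x ≡ 0# ⊎ x ≡ 1# ⊎ x ≡ a)
      not-three a few = Fin.<⇒≢ (proj₁ (proj₂ (proj₂ collision))) (codes-injective (proj₂ (proj₂ (proj₂ collision))))
        where
        open ≡-Reasoning
        coords : Fin (q ℕ.^ 3) → Vec K 3
        coords i = proj₁ (𝔽q-coordinates (Inverse.from iso i))
        coords-𝔽q : ∀ i → All 𝔽q (coords i)
        coords-𝔽q i = proj₁ (proj₂ (𝔽q-coordinates (Inverse.from iso i)))
        m∙coords : ∀ i → m ∙ coords i ≡ Inverse.from iso i
        m∙coords i = proj₂ (proj₂ (𝔽q-coordinates (Inverse.from iso i)))
        codes : Fin (q ℕ.^ 3) → Fin 27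
        codes i = Inverse.to (Vec↔Fin (↔-id (Fin 3)) 3) (map code (coords i))
        codes-injective : ∀ {i j} → codes i ≡ codes j → i ≡ j
        codes-injective {i} {j} eq = from-injective iso (begin
          Inverse.from iso i                        ≡⟨ sym (m∙coords i) ⟩
          m ∙ coords i                              ≡⟨ cong (m ∙_) (sym (decode-codes few (coords-𝔽q i))) ⟩
          m ∙ map (decode a) (map code (coords i))
            ≡⟨ cong (λ c → m ∙ map (decode a) c) (to-injective (Vec↔Fin (↔-id (Fin 3)) 3) {map code (coords i)} {map code (coords j)} eq) ⟩
          m ∙ map (decode a) (map code (coords j))  ≡⟨ cong (m ∙_) (decode-codes few (coords-𝔽q j)) ⟩
          m ∙ coords j                              ≡⟨ m∙coords j ⟩
          Inverse.from iso j                        ∎)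
        -- 28 + 188 = 6³ is at most q³.
        collision = Fin.pigeonhole (ℕ.<-≤-trans (ℕ.m≤m+n 28 188) (ℕ.^-monoˡ-≤ 3 6≤q)) codes

    -- GF(q) is given only as the fixed set of `φ`, so its elements are obtained from the size of K.
    -- Besides 0 and 1, the elements a and b are parameters of points of the conic at which a
    -- polynomial will be evaluated.
    four-elements : ∃[ a ] ∃[ b ] (𝔽q a × 𝔽q b × a ≢ 0# × a ≢ 1# × b ≢ 0# × b ≢ 1# × a ≢ b)
    four-elements = case ∃? (λ a → 𝔽q? a ×-dec (¬? (a ≟ 0#) ×-dec ¬? (a ≟ 1#))) of λ where
        (no none) → contradiction (few₂ none) (not-three 0#)
        (yes (a , fa , a≢0 , a≢1)) →
          case ∃? (λ b → 𝔽q? b ×-dec (¬? (b ≟ 0#) ×-dec (¬? (b ≟ 1#) ×-dec ¬? (a ≟ b)))) of λ where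
            (yes (b , fb , b≢0 , b≢1 , a≢b)) → a , b , fa , fb , a≢0 , a≢1 , b≢0 , b≢1 , a≢b
            (no none) → contradiction (few₃ a none) (not-three a)
      where
      few₂ : ¬ (∃[ a ] (𝔽q a × a ≢ 0# × a ≢ 1#)) → ∀ x → 𝔽q x → x ≡ 0# ⊎ x ≡ 1# ⊎ x ≡ 0#
      few₂ none x fx with x ≟ 0# | x ≟ 1#
      ... | yes z | _ = inj₁ z
      ... | no _ | yes z = inj₂ (inj₁ z)
      ... | no nz | no nz′ = contradiction (x , fx , nz , nz′) none
      few₃ : ∀ a → ¬ (∃[ b ] (𝔽q b × b ≢ 0# × b ≢ 1# × a ≢ b)) → ∀ x → 𝔽q x → x ≡ 0# ⊎ x ≡ 1# ⊎ x ≡ a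
      few₃ a none x fx with x ≟ 0# | x ≟ 1# | a ≟ x
      ... | yes z | _ | _ = inj₁ z
      ... | no _ | yes z | _ = inj₂ (inj₁ z)
      ... | no _ | no _ | yes z = inj₂ (inj₂ (sym z))
      ... | no nz | no nz′ | no nz″ = contradiction (x , fx , nz , nz′ , nz″) none

-- Squares and sums of two squares in GF(q)

module Squares (q : ℕ) (q-pp : IsPrimePower q) (6≤q : 6 ℕ.≤ q)
               (𝕂 : Field) (iso : Field.Carrier 𝕂 ↔ Fin (q ℕ.^ 3)) where

  open GaloisField q q-pp 6≤q 𝕂 iso

  -- In characteristic 2 squaring is injective. Extended by the identity outside GF(q) it is an
  -- injective map of K into itself, hence onto, and a preimage of an element of GF(q) lies in
  -- GF(q).
  square-root : 1# + 1# ≡ 0# → ∀ c → 𝔽q c → ∃[ x ] (𝔽q x × x * x ≡ c)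
  square-root 2≡0 c fc = root (injective⇒surjective iso square-injective c)
    where
    square : K → K
    square x with 𝔽q? x
    ... | yes _ = x * x
    ... | no _  = x
    xx≡yy : ∀ x y → x * x ≡ y * y → x ≡ y
    xx≡yy x y e = difference⇒≡ (case (x + - y) ≟ 0# of λ where
      (yes z) → z
      (no nz) → x*y≡0⇒y≡0 nz (combine (1# ⟪ e ⟫ (y * y + - (x * y)) ⟪ 2≡0 ⟫ done)
        (solve 2 (λ x y → (x :- y) :* (x :- y) := 𝟘 :+ (𝟙 :* (x :* x :- y :* y) :+ ((y :* y :- x :* y) :* ((𝟙 :+ 𝟙) :- 𝟘) :+ 𝟘))) refl x y)))
    square-injective : ∀ {x y} → square x ≡ square y → x ≡ y
    square-injective {x} {y} e with 𝔽q? x | 𝔽q? y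
    ... | yes fx | yes fy = xx≡yy x y e
    ... | yes fx | no nfy = contradiction (subst 𝔽q e (𝔽q-* fx fx)) nfy
    ... | no nfx | yes fy = contradiction (subst 𝔽q (sym e) (𝔽q-* fy fy)) nfx
    ... | no nfx | no nfy = e
    root : ∃[ x ] square x ≡ c → ∃[ x ] (𝔽q x × x * x ≡ c)
    root (x , e) with 𝔽q? x
    ... | yes fx = x , fx , e
    ... | no nfx = contradiction (subst 𝔽q (sym e) fc) nfx

  -- Pairing each x with a bit that separates x from - x makes x ↦ a x² and x ↦ c - b x² injective;
  -- were their images disjoint, they would combine to an injection of 𝔽q × Bool into itself missing (0 , true).
  sum-of-squares : 1# + 1# ≢ 0# → ∀ a b c → 𝔽q a → 𝔽q b → 𝔽q c → a ≢ 0# → b ≢ 0# →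
    ∃[ x ] ∃[ y ] (𝔽q x × 𝔽q y × a * (x * x) + b * (y * y) ≡ c)
  sum-of-squares 2≢0 a b c fa fb fc a≢0 b≢0 =
    case ∃? (λ x → ∃? (λ y → 𝔽q? x ×-dec (𝔽q? y ×-dec (a * (x * x) + b * (y * y) ≟ c)))) of λ where
      (yes found) → found
      (no none) → ⊥-elim (impossible none (injective⇒surjective (↔-sym Fin.*↔× ↔-∘ (iso ×-↔ ↔-sym Fin.2↔Bool)) (f-injective none) (0# , true)))
    where
    -- The bit records whether x comes before - x in the enumeration of K; it is false where they
    -- coincide, in particular at 0.
    sign : K → Bool
    sign x = does (Inverse.to iso x Fin.<? Inverse.to iso (- x))
    sign-0 : sign 0# ≡ false
    sign-0 = dec-false (Inverse.to iso 0# Fin.<? Inverse.to iso (- 0#))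
      (λ lt → Fin.<-irrefl (cong (Inverse.to iso) (solve 0 (𝟘 := :- 𝟘) refl)) lt)
    neg-neg : ∀ x → - (- x) ≡ x
    neg-neg = solve 1 (λ x → :- (:- x) := x) refl
    sign-neg : ∀ x → sign x ≡ sign (- x) → x ≡ - x
    sign-neg x e with Fin.<-cmp (Inverse.to iso x) (Inverse.to iso (- x))
    ... | tri≈ _ eq _ = to-injective iso eq
    ... | tri< lt _ ngt = contradiction (trans (sym (dec-true (Inverse.to iso x Fin.<? Inverse.to iso (- x)) lt)) (trans e
            (dec-false (Inverse.to iso (- x) Fin.<? Inverse.to iso (- (- x))) (λ gt → ngt (subst (λ z → Inverse.to iso (- x) Fin′.< Inverse.to iso z) (neg-neg x) gt))))) λ ()
    ... | tri> nlt _ gt = contradiction (trans (sym (dec-false (Inverse.to iso x Fin.<? Inverse.to iso (- x)) nlt)) (trans e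
            (dec-true (Inverse.to iso (- x) Fin.<? Inverse.to iso (- (- x))) (subst (λ z → Inverse.to iso (- x) Fin′.< Inverse.to iso z) (sym (neg-neg x)) gt)))) λ ()
    square-sign : ∀ x y → x * x ≡ y * y → sign x ≡ sign y → x ≡ y
    square-sign x y e s = case (x + y) ≟ 0# of λ where
      (yes z) → let x≡-y = difference⇒≡ (trans (cong (x +_) (neg-neg y)) z)
                    y≡-y = sign-neg y (trans (sym s) (cong sign x≡-y))
                in trans x≡-y (sym y≡-y)
      (no nz) → difference⇒≡ (x*y≡0⇒y≡0 nz (combine (1# ⟪ e ⟫ done)
        (solve 2 (λ x y → (x :+ y) :* (x :- y) := 𝟘 :+ (𝟙 :* (x :* x :- y :* y) :+ 𝟘)) refl x y)))
    θ : Bool → K → K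
    θ false x = a * (x * x)
    θ true y = c + - (b * (y * y))
    θ-𝔽q : ∀ s {x} → 𝔽q x → 𝔽q (θ s x)
    θ-𝔽q false fx = 𝔽q-* fa (𝔽q-* fx fx)
    θ-𝔽q true fy = 𝔽q-+ fc (𝔽q-neg (𝔽q-* fb (𝔽q-* fy fy)))
    θ-square : ∀ s {x y} → θ s x ≡ θ s y → x * x ≡ y * y
    θ-square false e = *-cancelˡ a≢0 e
    θ-square true {x} {y} e = *-cancelˡ b≢0 (combine (- 1# ⟪ e ⟫ done)
      (solve 4 (λ b c x y → b :* (x :* x) := b :* (y :* y) :+ ((:- 𝟙) :* ((c :- b :* (x :* x)) :- (c :- b :* (y :* y))) :+ 𝟘)) refl b c x y))
    None : Set
    None = ¬ (∃[ x ] ∃[ y ] (𝔽q x × 𝔽q y × a * (x * x) + b * (y * y) ≡ c))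
    disjoint : None → ∀ {x y} → 𝔽q x → 𝔽q y → θ false x ≢ θ true y
    disjoint none {x} {y} fx fy e = none (x , y , fx , fy , combine (1# ⟪ e ⟫ done)
      (solve 3 (λ u v c → u :+ v := c :+ (𝟙 :* (u :- (c :- v)) :+ 𝟘)) refl (a * (x * x)) (b * (y * y)) c))
    θ-injective : None → ∀ s t {x y} → 𝔽q x → 𝔽q y → θ s x ≡ θ t y → sign x ≡ sign y → (x , s) ≡ (y , t)
    θ-injective none false false fx fy e σ = cong (_, false) (square-sign _ _ (θ-square false e) σ)
    θ-injective none true true fx fy e σ = cong (_, true) (square-sign _ _ (θ-square true e) σ)
    θ-injective none false true fx fy e σ = contradiction e (disjoint none fx fy)
    θ-injective none true false fx fy e σ = contradiction (sym e) (disjoint none fy fx)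
    f : K × Bool → K × Bool
    f (x , s) with 𝔽q? x
    ... | yes _ = θ s x , sign x
    ... | no _ = x , s
    f-injective : None → ∀ {u v} → f u ≡ f v → u ≡ v
    f-injective none {x , s} {y , t} e with 𝔽q? x | 𝔽q? y
    ... | yes fx | yes fy = θ-injective none s t fx fy (,-injectiveˡ e) (cong proj₂ e)
    ... | yes fx | no nfy = contradiction (subst 𝔽q (,-injectiveˡ e) (θ-𝔽q s fx)) nfy
    ... | no nfx | yes fy = contradiction (subst 𝔽q (sym (,-injectiveˡ e)) (θ-𝔽q t fy)) nfx
    ... | no _ | no _ = e
    impossible : None → ¬ (∃[ u ] f u ≡ (0# , true))
    -- The value (0, true) is never taken: `θ false x` = 0 forces x = 0, whose bit is false, and
    -- `θ true x` = 0 would solve the equation with first variable 0.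
    impossible none ((x , s) , e) with 𝔽q? x
    ... | no nfx = nfx (subst 𝔽q (sym (cong proj₁ e)) φ-0)
    impossible none ((x , true) , e) | yes fx = disjoint none φ-0 fx (trans (trans (cong (a *_) (zeroˡ 0#)) (zeroʳ a)) (sym (cong proj₁ e)))
    impossible none ((x , false) , e) | yes fx = contradiction (trans (sym (cong proj₂ e)) (trans (cong sign x≡0) sign-0)) λ ()
      where
      xx≡0 : x * x ≡ 0#
      xx≡0 = x*y≡0⇒y≡0 a≢0 (cong proj₁ e)
      x≡0 : x ≡ 0#
      x≡0 = case x ≟ 0# of λ where
        (yes z) → z
        (no nz) → x*y≡0⇒y≡0 nz xx≡0

-- Quadratic forms and isotropic vectors over GF(q)

module Forms (q : ℕ) (q-pp : IsPrimePower q) (6≤q : 6 ℕ.≤ q)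
             (𝕂 : Field) (iso : Field.Carrier 𝕂 ↔ Fin (q ℕ.^ 3)) where

  open GaloisField q q-pp 6≤q 𝕂 iso
  open Squares q q-pp 6≤q 𝕂 iso

  _∙ᵐ_ : ∀ {m n} → Vec (Vec K n) m → Vec K n → Vec K m
  A ∙ᵐ v = map (_∙ v) A

  ∙ᵐ-+ : ∀ {m n} (A : Vec (Vec K n) m) u v → A ∙ᵐ (u +ᵛ v) ≡ A ∙ᵐ u +ᵛ A ∙ᵐ v
  ∙ᵐ-+ [] u v = refl
  ∙ᵐ-+ (a ∷ A) u v = cong₂ _∷_ (∙-+ a u v) (∙ᵐ-+ A u v)
  ∙ᵐ-· : ∀ {m n} (A : Vec (Vec K n) m) c v → A ∙ᵐ (c ·ᵛ v) ≡ c ·ᵛ (A ∙ᵐ v)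
  ∙ᵐ-· [] c v = refl
  ∙ᵐ-· (a ∷ A) c v = cong₂ _∷_ (∙-· a c v) (∙ᵐ-· A c v)

  ∙-+ˡ : ∀ {n} (u v w : Vec K n) → (u +ᵛ v) ∙ w ≡ u ∙ w + v ∙ w
  ∙-+ˡ u v w = trans (∙-comm _ w) (trans (∙-+ w u v) (cong₂ _+_ (∙-comm w u) (∙-comm w v)))
  ∙-·ˡ : ∀ {n} c (v w : Vec K n) → (c ·ᵛ v) ∙ w ≡ c * (v ∙ w)
  ∙-·ˡ c v w = trans (∙-comm _ w) (trans (∙-· w c v) (cong (c *_) (∙-comm w v)))

  polar : ∀ {n} → Form n → Vec K n → Vec K n → K
  polar A u v = u ∙ A ∙ᵐ v + v ∙ A ∙ᵐ u

  polar-sym : ∀ {n} (A : Form n) u v → polar A u v ≡ polar A v u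
  polar-sym A u v = +-comm _ _

  eval-+ : ∀ {n} (A : Form n) u v → eval A (u +ᵛ v) ≡ eval A u + eval A v + polar A u v
  eval-+ A u v = begin
    (u +ᵛ v) ∙ A ∙ᵐ (u +ᵛ v)                              ≡⟨ cong ((u +ᵛ v) ∙_) (∙ᵐ-+ A u v) ⟩
    (u +ᵛ v) ∙ (A ∙ᵐ u +ᵛ A ∙ᵐ v)                         ≡⟨ ∙-+ˡ u v _ ⟩
    u ∙ (A ∙ᵐ u +ᵛ A ∙ᵐ v) + v ∙ (A ∙ᵐ u +ᵛ A ∙ᵐ v)       ≡⟨ cong₂ _+_ (∙-+ u _ _) (∙-+ v _ _) ⟩
    (u ∙ A ∙ᵐ u + u ∙ A ∙ᵐ v) + (v ∙ A ∙ᵐ u + v ∙ A ∙ᵐ v)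
      ≡⟨ solve 4 (λ a b c d → (a :+ b) :+ (c :+ d) := a :+ d :+ (b :+ c)) refl (u ∙ A ∙ᵐ u) (u ∙ A ∙ᵐ v) (v ∙ A ∙ᵐ u) (v ∙ A ∙ᵐ v) ⟩
    eval A u + eval A v + polar A u v                     ∎
    where open ≡-Reasoning

  eval-· : ∀ {n} (A : Form n) c v → eval A (c ·ᵛ v) ≡ c * c * eval A v
  eval-· A c v = trans (cong ((c ·ᵛ v) ∙_) (∙ᵐ-· A c v)) (trans (∙-·ˡ c v _) (trans (cong (c *_) (∙-· v c _)) (sym (*-assoc c c _))))

  polar-+ : ∀ {n} (A : Form n) u v w → polar A u (v +ᵛ w) ≡ polar A u v + polar A u w
  polar-+ A u v w = trans (cong₂ _+_ (trans (cong (u ∙_) (∙ᵐ-+ A v w)) (∙-+ u _ _)) (∙-+ˡ v w _))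
    (solve 4 (λ a b c d → (a :+ b) :+ (c :+ d) := (a :+ c) :+ (b :+ d)) refl (u ∙ A ∙ᵐ v) (u ∙ A ∙ᵐ w) (v ∙ A ∙ᵐ u) (w ∙ A ∙ᵐ u))

  polar-· : ∀ {n} (A : Form n) u c v → polar A u (c ·ᵛ v) ≡ c * polar A u v
  polar-· A u c v = trans (cong₂ _+_ (trans (cong (u ∙_) (∙ᵐ-· A c v)) (∙-· u c _)) (∙-·ˡ c v _))
    (solve 3 (λ c a b → c :* a :+ c :* b := c :* (a :+ b)) refl c (u ∙ A ∙ᵐ v) (v ∙ A ∙ᵐ u))

  polar-·ˡ : ∀ {n} (A : Form n) c u v → polar A (c ·ᵛ u) v ≡ c * polar A u v
  polar-·ˡ A c u v = trans (polar-sym A (c ·ᵛ u) v) (trans (polar-· A v c u) (cong (c *_) (polar-sym A v u)))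

  polar-𝟎 : ∀ {n} (A : Form n) u → polar A u 𝟎 ≡ 0#
  polar-𝟎 A u = trans (cong (polar A u) (sym (·ᵛ-zeroˡ 𝟎))) (trans (polar-· A u 0# 𝟎) (zeroˡ _))

  polar-comb : ∀ {n} (A : Form n) u c v d w → polar A u (c ·ᵛ v +ᵛ d ·ᵛ w) ≡ c * polar A u v + d * polar A u w
  polar-comb A u c v d w = trans (polar-+ A u (c ·ᵛ v) (d ·ᵛ w)) (cong₂ _+_ (polar-· A u c v) (polar-· A u d w))

  polar-comb₃ : ∀ {n} (A : Form n) u a b c p₀ p₁ p₂ → polar A u (lincomb (a ∷ b ∷ c ∷ []) (p₀ ∷ p₁ ∷ p₂ ∷ []))
    ≡ a * polar A u p₀ + (b * polar A u p₁ + c * polar A u p₂)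
  polar-comb₃ A u a b c p₀ p₁ p₂ = trans (polar-+ A u (a ·ᵛ p₀) (b ·ᵛ p₁ +ᵛ (c ·ᵛ p₂ +ᵛ 𝟎))) (cong₂ _+_ (polar-· A u a p₀) (trans (polar-+ A u (b ·ᵛ p₁) (c ·ᵛ p₂ +ᵛ 𝟎))
    (cong₂ _+_ (polar-· A u b p₁) (trans (cong (polar A u) (+ᵛ-identityʳ (c ·ᵛ p₂))) (polar-· A u c p₂)))))

  eval-comb : ∀ {n} (A : Form n) c v d w → eval A (c ·ᵛ v +ᵛ d ·ᵛ w) ≡ c * c * eval A v + d * d * eval A w + c * d * polar A v w
  eval-comb A c v d w = trans (eval-+ A (c ·ᵛ v) (d ·ᵛ w)) (cong₂ _+_ (cong₂ _+_ (eval-· A c v) (eval-· A d w))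
    (trans (polar-· A (c ·ᵛ v) d w) (trans (cong (d *_) (polar-·ˡ A c v w))
      (solve 3 (λ c d p → d :* (c :* p) := c :* d :* p) refl c d (polar A v w)))))

  eval-comb₃ : ∀ {n} (A : Form n) a b c p₀ p₁ p₂ → eval A (lincomb (a ∷ b ∷ c ∷ []) (p₀ ∷ p₁ ∷ p₂ ∷ []))
    ≡ a * a * eval A p₀ + b * b * eval A p₁ + c * c * eval A p₂
      + a * b * polar A p₀ p₁ + a * c * polar A p₀ p₂ + b * c * polar A p₁ p₂
  eval-comb₃ A a b c p₀ p₁ p₂ = begin
    eval A (a ·ᵛ p₀ +ᵛ (b ·ᵛ p₁ +ᵛ (c ·ᵛ p₂ +ᵛ 𝟎)))
      ≡⟨ cong (λ z → eval A (a ·ᵛ p₀ +ᵛ (b ·ᵛ p₁ +ᵛ z))) (+ᵛ-identityʳ (c ·ᵛ p₂)) ⟩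
    eval A (a ·ᵛ p₀ +ᵛ (b ·ᵛ p₁ +ᵛ c ·ᵛ p₂))
      ≡⟨ eval-+ A (a ·ᵛ p₀) (b ·ᵛ p₁ +ᵛ c ·ᵛ p₂) ⟩
    eval A (a ·ᵛ p₀) + eval A (b ·ᵛ p₁ +ᵛ c ·ᵛ p₂) + polar A (a ·ᵛ p₀) (b ·ᵛ p₁ +ᵛ c ·ᵛ p₂)
      ≡⟨ cong₂ _+_ (cong₂ _+_ (eval-· A a p₀) (eval-comb A b p₁ c p₂))
         (trans (polar-comb A (a ·ᵛ p₀) b p₁ c p₂) (cong₂ (λ x y → b * x + c * y) (polar-·ˡ A a p₀ p₁) (polar-·ˡ A a p₀ p₂))) ⟩
    a * a * eval A p₀ + (b * b * eval A p₁ + c * c * eval A p₂ + b * c * polar A p₁ p₂)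
      + (b * (a * polar A p₀ p₁) + c * (a * polar A p₀ p₂))
      ≡⟨ solve 9 (λ a b c e₀ e₁ e₂ p q r → a :* a :* e₀ :+ (b :* b :* e₁ :+ c :* c :* e₂ :+ b :* c :* r) :+ (b :* (a :* p) :+ c :* (a :* q))
           := a :* a :* e₀ :+ b :* b :* e₁ :+ c :* c :* e₂ :+ a :* b :* p :+ a :* c :* q :+ b :* c :* r) refl
         a b c (eval A p₀) (eval A p₁) (eval A p₂) (polar A p₀ p₁) (polar A p₀ p₂) (polar A p₁ p₂) ⟩
    _ ∎
    where
    open ≡-Reasoning

  ∙-𝔽q : ∀ {n} {u v : Vec K n} → All 𝔽q u → All 𝔽q v → 𝔽q (u ∙ v)
  ∙-𝔽q {u = u} {v} fu fv = trans (φ-∙ u v) (cong₂ _∙_ (frob-fixed fu) (frob-fixed fv))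
  ∙ᵐ-𝔽q : ∀ {m n} {A : Vec (Vec K n) m} {v} → All (All 𝔽q) A → All 𝔽q v → All 𝔽q (A ∙ᵐ v)
  ∙ᵐ-𝔽q [] fv = []
  ∙ᵐ-𝔽q (fa ∷ fA) fv = ∙-𝔽q fa fv ∷ ∙ᵐ-𝔽q fA fv
  eval-𝔽q : ∀ {n} {A : Form n} {v} → FormOver 𝔽q A → All 𝔽q v → 𝔽q (eval A v)
  eval-𝔽q fA fv = ∙-𝔽q fv (∙ᵐ-𝔽q fA fv)
  polar-𝔽q : ∀ {n} {A : Form n} {u v} → FormOver 𝔽q A → All 𝔽q u → All 𝔽q v → 𝔽q (polar A u v)
  polar-𝔽q fA fu fv = 𝔽q-+ (∙-𝔽q fu (∙ᵐ-𝔽q fA fv)) (∙-𝔽q fv (∙ᵐ-𝔽q fA fu))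
  ·ᵛ-𝔽q : ∀ {n c} {v : Vec K n} → 𝔽q c → All 𝔽q v → All 𝔽q (c ·ᵛ v)
  ·ᵛ-𝔽q fc [] = []
  ·ᵛ-𝔽q fc (fx ∷ fv) = 𝔽q-* fc fx ∷ ·ᵛ-𝔽q fc fv
  +ᵛ-𝔽q : ∀ {n} {u v : Vec K n} → All 𝔽q u → All 𝔽q v → All 𝔽q (u +ᵛ v)
  +ᵛ-𝔽q [] [] = []
  +ᵛ-𝔽q (fx ∷ fu) (fy ∷ fv) = 𝔽q-+ fx fy ∷ +ᵛ-𝔽q fu fv

  e₀ e₁ e₂ : Vec K 3
  e₀ = 1# ∷ 0# ∷ 0# ∷ []
  e₁ = 0# ∷ 1# ∷ 0# ∷ []
  e₂ = 0# ∷ 0# ∷ 1# ∷ []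

  e₀-𝔽q : All 𝔽q e₀
  e₀-𝔽q = φ-1 ∷ φ-0 ∷ φ-0 ∷ []
  e₁-𝔽q : All 𝔽q e₁
  e₁-𝔽q = φ-0 ∷ φ-1 ∷ φ-0 ∷ []
  e₂-𝔽q : All 𝔽q e₂
  e₂-𝔽q = φ-0 ∷ φ-0 ∷ φ-1 ∷ []

  module Ternary (A : Form 3) (fA : FormOver 𝔽q A) where

    Isotropic : Set
    Isotropic = ∃[ x ] (All 𝔽q x × x ≢ 𝟎 × eval A x ≡ 0#)

    -- If A(e₀) ≠ 0 and v is orthogonal to e₀, then A(x e₀ + v) = x² A(e₀) + A(v), and a square root
    -- makes this zero. A suitable v outside the span of e₀ is e₁, or else b₀₂ e₁ - b₀₁ e₂.
    isotropic-even : 1# + 1# ≡ 0# → Isotropic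
    isotropic-even 2≡0 = case eval A e₀ ≟ 0# of λ where
        (yes z) → e₀ , e₀-𝔽q , (1≢0 ∘ ∷-injectiveˡ) , z
        (no a≢0) → case polar A e₀ e₁ ≟ 0# of λ where
          (yes z) → solution a≢0 e₁ e₁-𝔽q z (λ e → 1≢0 (∷-injectiveˡ e))
          (no nz) → solution a≢0 (b₀₂ ·ᵛ e₁ +ᵛ (- b₀₁) ·ᵛ e₂) (+ᵛ-𝔽q (·ᵛ-𝔽q (polar-𝔽q {A = A} fA e₀-𝔽q e₂-𝔽q) e₁-𝔽q) (·ᵛ-𝔽q (𝔽q-neg (polar-𝔽q {A = A} fA e₀-𝔽q e₁-𝔽q)) e₂-𝔽q))
             (trans (polar-comb A e₀ b₀₂ e₁ (- b₀₁) e₂) (solve 2 (λ a b → a :* b :+ (:- b) :* a := 𝟘) refl b₀₂ b₀₁))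
             (λ e → nz (trans (third b₀₁ b₀₂) (trans (cong -_ (∷-injectiveˡ (∷-injectiveʳ e))) (solve 0 (:- 𝟘 := 𝟘) refl))))
      where
      b₀₁ = polar A e₀ e₁
      b₀₂ = polar A e₀ e₂
      third : ∀ x y → x ≡ - (y * 0# + - x * 1#)
      third = solve 2 (λ x y → x := :- (y :* 𝟘 :+ (:- x) :* 𝟙)) refl
      solution : eval A e₀ ≢ 0# → ∀ v → All 𝔽q v → polar A e₀ v ≡ 0# → Data.Vec.Base.tail v ≢ 𝟎 → Isotropic
      solution a≢0 v@(v₀ ∷ v₁ ∷ v₂ ∷ []) fv p nz = x ·ᵛ e₀ +ᵛ 1# ·ᵛ v , +ᵛ-𝔽q (·ᵛ-𝔽q (proj₁ (proj₂ root)) e₀-𝔽q) (·ᵛ-𝔽q φ-1 fv) ,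
          (λ e → nz (cong₂ _∷_ (trans (drop x v₁) (∷-injectiveˡ (∷-injectiveʳ e))) (cong (_∷ []) (trans (drop x v₂) (∷-injectiveˡ (∷-injectiveʳ (∷-injectiveʳ e))))))) ,
          trans (eval-comb A x e₀ 1# v) (vanish x (eval A e₀) (eval A e₀ ⁻¹) (eval A v) (polar A e₀ v) (proj₂ (proj₂ root)) (*-inverseʳ a≢0) p)
        where
        root = square-root 2≡0 (- (eval A v * eval A e₀ ⁻¹)) (𝔽q-neg (𝔽q-* (eval-𝔽q {A = A} fA fv) (𝔽q-⁻¹ a≢0 (eval-𝔽q {A = A} fA e₀-𝔽q))))
        x = proj₁ root
        drop : ∀ x w → w ≡ x * 0# + 1# * w
        drop = solve 2 (λ x w → w := x :* 𝟘 :+ 𝟙 :* w) refl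
        vanish : ∀ x a i w p → x * x ≡ - (w * i) → a * i ≡ 1# → p ≡ 0# → x * x * a + 1# * 1# * w + x * 1# * p ≡ 0#
        vanish x a i w p e₁ e₂ e₃ = combine (a ⟪ e₁ ⟫ - w ⟪ e₂ ⟫ x ⟪ e₃ ⟫ done)
          (solve 5 (λ x a i w p → x :* x :* a :+ 𝟙 :* 𝟙 :* w :+ x :* 𝟙 :* p
            := 𝟘 :+ (a :* (x :* x :- :- (w :* i)) :+ ((:- w) :* (a :* i :- 𝟙) :+ (x :* (p :- 𝟘) :+ 𝟘)))) refl x a i w p)

    -- Gram-Schmidt turns e₀, e₁, e₂ into an orthogonal basis e₀, v, w, unless e₀ or v is isotropic
    -- already; then A(e₀) x² + A(v) y² = -A(w) has a solution as a sum of squares.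
    isotropic-odd : 1# + 1# ≢ 0# → Isotropic
    isotropic-odd 2≢0 = case eval A e₀ ≟ 0# of λ where
        (yes z) → e₀ , e₀-𝔽q , (1≢0 ∘ ∷-injectiveˡ) , z
        (no a₁≢0) → from-anisotropic-vector a₁≢0
      where
      2≢0* : ∀ {x} → x ≢ 0# → x + x ≢ 0#
      2≢0* {x} nz e = *-≢0 2≢0 nz (trans (solve 1 (λ x → (𝟙 :+ 𝟙) :* x := x :+ x) refl x) e)
      module _ (a₁≢0 : eval A e₀ ≢ 0#) where
        -- The Gram-Schmidt coefficient: the polar form of e₀ with itself is 2 A(e₀), which is
        -- invertible here.
        c = - (polar A e₀ e₁ * (eval A e₀ + eval A e₀) ⁻¹)
        fc : 𝔽q c
        fc = 𝔽q-neg (𝔽q-* (polar-𝔽q {A = A} fA e₀-𝔽q e₁-𝔽q) (𝔽q-⁻¹ (2≢0* a₁≢0) (𝔽q-+ (eval-𝔽q {A = A} fA e₀-𝔽q) (eval-𝔽q {A = A} fA e₀-𝔽q))))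
        v = 1# ·ᵛ e₁ +ᵛ c ·ᵛ e₀
        fv : All 𝔽q v
        fv = +ᵛ-𝔽q (·ᵛ-𝔽q φ-1 e₁-𝔽q) (·ᵛ-𝔽q fc e₀-𝔽q)
        project : ∀ b a i → a * i ≡ 1# → 1# * b + - (b * i) * a ≡ 0#
        project b a i e = combine (- b ⟪ e ⟫ done) (solve 3 (λ b a i → 𝟙 :* b :+ (:- (b :* i)) :* a := 𝟘 :+ ((:- b) :* (a :* i :- 𝟙) :+ 𝟘)) refl b a i)
        e₀⊥v : polar A e₀ v ≡ 0#
        e₀⊥v = trans (polar-comb A e₀ 1# e₁ c e₀) (project (polar A e₀ e₁) (eval A e₀ + eval A e₀) _ (*-inverseʳ (2≢0* a₁≢0)))
        module _ (a₂≢0 : eval A v ≢ 0#) where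
          d = - (polar A e₀ e₂ * (eval A e₀ + eval A e₀) ⁻¹)
          f = - (polar A v e₂ * (eval A v + eval A v) ⁻¹)
          w = 1# ·ᵛ (1# ·ᵛ e₂ +ᵛ d ·ᵛ e₀) +ᵛ f ·ᵛ v
          fw : All 𝔽q w
          fw = +ᵛ-𝔽q (·ᵛ-𝔽q φ-1 (+ᵛ-𝔽q (·ᵛ-𝔽q φ-1 e₂-𝔽q) (·ᵛ-𝔽q (𝔽q-neg (𝔽q-* (polar-𝔽q {A = A} fA e₀-𝔽q e₂-𝔽q) (𝔽q-⁻¹ (2≢0* a₁≢0) (𝔽q-+ (eval-𝔽q {A = A} fA e₀-𝔽q) (eval-𝔽q {A = A} fA e₀-𝔽q))))) e₀-𝔽q)))
            (·ᵛ-𝔽q (𝔽q-neg (𝔽q-* (polar-𝔽q {A = A} fA fv e₂-𝔽q) (𝔽q-⁻¹ (2≢0* a₂≢0) (𝔽q-+ (eval-𝔽q {A = A} fA fv) (eval-𝔽q {A = A} fA fv))))) fv)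
          e₀⊥w : polar A e₀ w ≡ 0#
          e₀⊥w = trans (polar-comb A e₀ 1# (1# ·ᵛ e₂ +ᵛ d ·ᵛ e₀) f v)
            (zeros (trans (polar-comb A e₀ 1# e₂ d e₀) (project (polar A e₀ e₂) (eval A e₀ + eval A e₀) _ (*-inverseʳ (2≢0* a₁≢0)))) e₀⊥v)
            where
            zeros : ∀ {x y} → x ≡ 0# → y ≡ 0# → 1# * x + f * y ≡ 0#
            zeros refl refl = trans (cong₂ _+_ (zeroʳ 1#) (zeroʳ f)) (+-identityˡ 0#)
          v⊥w : polar A v w ≡ 0#
          v⊥w = trans (polar-comb A v 1# (1# ·ᵛ e₂ +ᵛ d ·ᵛ e₀) f v)
            (trans (cong (λ z → 1# * z + f * (eval A v + eval A v)) (trans (polar-comb A v 1# e₂ d e₀)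
               (trans (cong (λ z → 1# * polar A v e₂ + d * z) (trans (polar-sym A v e₀) e₀⊥v)) (drop (polar A v e₂) d))))
             (project (polar A v e₂) (eval A v + eval A v) _ (*-inverseʳ (2≢0* a₂≢0))))
            where
            drop : ∀ b d → 1# * b + d * 0# ≡ b
            drop = solve 2 (λ b d → 𝟙 :* b :+ d :* 𝟘 := b) refl
          xy = sum-of-squares 2≢0 (eval A e₀) (eval A v) (- eval A w) (eval-𝔽q {A = A} fA e₀-𝔽q) (eval-𝔽q {A = A} fA fv) (𝔽q-neg (eval-𝔽q {A = A} fA fw)) a₁≢0 a₂≢0
          x = proj₁ xy
          y = proj₁ (proj₂ xy)
          isotropic : Isotropic
          isotropic = lincomb (x ∷ y ∷ 1# ∷ []) (e₀ ∷ v ∷ w ∷ []) ,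
              +ᵛ-𝔽q (·ᵛ-𝔽q (proj₁ (proj₂ (proj₂ xy))) e₀-𝔽q) (+ᵛ-𝔽q (·ᵛ-𝔽q (proj₁ (proj₂ (proj₂ (proj₂ xy)))) fv) (+ᵛ-𝔽q (·ᵛ-𝔽q φ-1 fw) (φ-0 ∷ φ-0 ∷ φ-0 ∷ []))) ,
              (λ e → 1≢0 (trans (third x y c d f) (∷-injectiveˡ (∷-injectiveʳ (∷-injectiveʳ e))))) ,
              trans (eval-comb₃ A x y 1# e₀ v w)
                (vanish x y (eval A e₀) (eval A v) (eval A w) _ _ _ (proj₂ (proj₂ (proj₂ (proj₂ xy)))) e₀⊥v e₀⊥w v⊥w)
            where
            third : ∀ x y c d f → 1# ≡ x * 0# + (y * (1# * 0# + c * 0#) + (1# * (1# * (1# * 1# + d * 0#) + f * (1# * 0# + c * 0#)) + 0#))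
            third = solve 5 (λ x y c d f → 𝟙 := x :* 𝟘 :+ (y :* (𝟙 :* 𝟘 :+ c :* 𝟘) :+ (𝟙 :* (𝟙 :* (𝟙 :* 𝟙 :+ d :* 𝟘) :+ f :* (𝟙 :* 𝟘 :+ c :* 𝟘)) :+ 𝟘))) refl
            vanish : ∀ x y a b c r s t → a * (x * x) + b * (y * y) ≡ - c → r ≡ 0# → s ≡ 0# → t ≡ 0# →
              x * x * a + y * y * b + 1# * 1# * c + x * y * r + x * 1# * s + y * 1# * t ≡ 0#
            vanish x y a b c _ _ _ e refl refl refl = combine (1# ⟪ e ⟫ done)
              (solve 5 (λ x y a b c → x :* x :* a :+ y :* y :* b :+ 𝟙 :* 𝟙 :* c :+ x :* y :* 𝟘 :+ x :* 𝟙 :* 𝟘 :+ y :* 𝟙 :* 𝟘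
                := 𝟘 :+ (𝟙 :* (a :* (x :* x) :+ b :* (y :* y) :- :- c) :+ 𝟘)) refl x y a b c)
        from-anisotropic-vector : Isotropic
        from-anisotropic-vector = case eval A v ≟ 0# of λ where
            (yes z) → v , fv , (λ e → 1≢0 (trans (second c) (∷-injectiveˡ (∷-injectiveʳ e)))) , z
            (no a₂≢0) → isotropic a₂≢0
          where
          second : ∀ c → 1# ≡ 1# * 1# + c * 0#
          second = solve 1 (λ c → 𝟙 := 𝟙 :* 𝟙 :+ c :* 𝟘) refl

    abstract

      isotropic : Isotropic
      isotropic = case (1# + 1#) ≟ 0# of λ where
        (yes e) → isotropic-even e
        (no ne) → isotropic-odd ne

-- Normal form of a conic of the subplane

module Conics (q : ℕ) (q-pp : IsPrimePower q) (6≤q : 6 ℕ.≤ q)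
              (𝕂 : Field) (iso : Field.Carrier 𝕂 ↔ Fin (q ℕ.^ 3)) where

  open GaloisField q q-pp 6≤q 𝕂 iso
  open Forms q q-pp 6≤q 𝕂 iso

  cross : Vec K 3 → Vec K 3 → Vec K 3
  cross (a₀ ∷ a₁ ∷ a₂ ∷ []) (b₀ ∷ b₁ ∷ b₂ ∷ []) =
    a₁ * b₂ + - (a₂ * b₁) ∷ a₂ * b₀ + - (a₀ * b₂) ∷ a₀ * b₁ + - (a₁ * b₀) ∷ []

  cross-⊥ˡ : ∀ a b → a ∙ cross a b ≡ 0#
  cross-⊥ˡ (a₀ ∷ a₁ ∷ a₂ ∷ []) (b₀ ∷ b₁ ∷ b₂ ∷ []) = solve 6 (λ a₀ a₁ a₂ b₀ b₁ b₂ →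
    a₀ :* (a₁ :* b₂ :- a₂ :* b₁) :+ (a₁ :* (a₂ :* b₀ :- a₀ :* b₂) :+ (a₂ :* (a₀ :* b₁ :- a₁ :* b₀) :+ 𝟘)) := 𝟘) refl a₀ a₁ a₂ b₀ b₁ b₂

  cross-⊥ʳ : ∀ a b → b ∙ cross a b ≡ 0#
  cross-⊥ʳ (a₀ ∷ a₁ ∷ a₂ ∷ []) (b₀ ∷ b₁ ∷ b₂ ∷ []) = solve 6 (λ a₀ a₁ a₂ b₀ b₁ b₂ →
    b₀ :* (a₁ :* b₂ :- a₂ :* b₁) :+ (b₁ :* (a₂ :* b₀ :- a₀ :* b₂) :+ (b₂ :* (a₀ :* b₁ :- a₁ :* b₀) :+ 𝟘)) := 𝟘) refl a₀ a₁ a₂ b₀ b₁ b₂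

  -- The Binet-Cauchy identity.
  cross-cross : ∀ a b c d → cross a b ∙ cross c d ≡ (a ∙ c) * (b ∙ d) + - ((a ∙ d) * (b ∙ c))
  cross-cross (a₀ ∷ a₁ ∷ a₂ ∷ []) (b₀ ∷ b₁ ∷ b₂ ∷ []) (c₀ ∷ c₁ ∷ c₂ ∷ []) (d₀ ∷ d₁ ∷ d₂ ∷ []) =
    solve 12 (λ a₀ a₁ a₂ b₀ b₁ b₂ c₀ c₁ c₂ d₀ d₁ d₂ →
      (a₁ :* b₂ :- a₂ :* b₁) :* (c₁ :* d₂ :- c₂ :* d₁) :+ ((a₂ :* b₀ :- a₀ :* b₂) :* (c₂ :* d₀ :- c₀ :* d₂) :+ ((a₀ :* b₁ :- a₁ :* b₀) :* (c₀ :* d₁ :- c₁ :* d₀) :+ 𝟘))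
      := (a₀ :* c₀ :+ (a₁ :* c₁ :+ (a₂ :* c₂ :+ 𝟘))) :* (b₀ :* d₀ :+ (b₁ :* d₁ :+ (b₂ :* d₂ :+ 𝟘)))
         :- (a₀ :* d₀ :+ (a₁ :* d₁ :+ (a₂ :* d₂ :+ 𝟘))) :* (b₀ :* c₀ :+ (b₁ :* c₁ :+ (b₂ :* c₂ :+ 𝟘))))
      refl a₀ a₁ a₂ b₀ b₁ b₂ c₀ c₁ c₂ d₀ d₁ d₂

  cross-𝔽q : ∀ {a b} → All 𝔽q a → All 𝔽q b → All 𝔽q (cross a b)
  cross-𝔽q (fa₀ ∷ fa₁ ∷ fa₂ ∷ []) (fb₀ ∷ fb₁ ∷ fb₂ ∷ []) =
    minor fa₁ fb₂ fa₂ fb₁ ∷ minor fa₂ fb₀ fa₀ fb₂ ∷ minor fa₀ fb₁ fa₁ fb₀ ∷ []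
    where
    minor : ∀ {a b c d} → 𝔽q a → 𝔽q b → 𝔽q c → 𝔽q d → 𝔽q (a * b + - (c * d))
    minor fa fb fc fd = 𝔽q-+ (𝔽q-* fa fb) (𝔽q-neg (𝔽q-* fc fd))

  standard-basis : ∀ v → lincomb v (e₀ ∷ e₁ ∷ e₂ ∷ []) ≡ v
  standard-basis (a ∷ b ∷ c ∷ []) = cong₂ _∷_ (first a b c) (cong₂ _∷_ (second a b c) (cong (_∷ []) (third a b c)))
    where
    first : ∀ a b c → a * 1# + (b * 0# + (c * 0# + 0#)) ≡ a
    first = solve 3 (λ a b c → a :* 𝟙 :+ (b :* 𝟘 :+ (c :* 𝟘 :+ 𝟘)) := a) refl
    second : ∀ a b c → a * 0# + (b * 1# + (c * 0# + 0#)) ≡ b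
    second = solve 3 (λ a b c → a :* 𝟘 :+ (b :* 𝟙 :+ (c :* 𝟘 :+ 𝟘)) := b) refl
    third : ∀ a b c → a * 0# + (b * 0# + (c * 1# + 0#)) ≡ c
    third = solve 3 (λ a b c → a :* 𝟘 :+ (b :* 𝟘 :+ (c :* 𝟙 :+ 𝟘)) := c) refl

  ∃unit : ∀ (h : Vec K 3) → All 𝔽q h → h ≢ 𝟎 → ∃[ v ] (All 𝔽q v × h ∙ v ≡ 1#)
  ∃unit (a ∷ b ∷ c ∷ []) (fa ∷ fb ∷ fc ∷ []) h≢𝟎 = case a ≟ 0# of λ where
      (no nz) → a ⁻¹ ∷ 0# ∷ 0# ∷ [] , 𝔽q-⁻¹ nz fa ∷ φ-0 ∷ φ-0 ∷ [] , trans (first a (a ⁻¹) b c) (*-inverseʳ nz)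
      (yes a≡0) → case b ≟ 0# of λ where
        (no nz) → 0# ∷ b ⁻¹ ∷ 0# ∷ [] , φ-0 ∷ 𝔽q-⁻¹ nz fb ∷ φ-0 ∷ [] , trans (second b (b ⁻¹) a c) (*-inverseʳ nz)
        (yes b≡0) → case c ≟ 0# of λ where
          (no nz) → 0# ∷ 0# ∷ c ⁻¹ ∷ [] , φ-0 ∷ φ-0 ∷ 𝔽q-⁻¹ nz fc ∷ [] , trans (third c (c ⁻¹) a b) (*-inverseʳ nz)
          (yes c≡0) → contradiction (cong₂ _∷_ a≡0 (cong₂ _∷_ b≡0 (cong (_∷ []) c≡0))) h≢𝟎
    where
    first : ∀ a i b c → a * i + (b * 0# + (c * 0# + 0#)) ≡ a * i
    first = solve 4 (λ a i b c → a :* i :+ (b :* 𝟘 :+ (c :* 𝟘 :+ 𝟘)) := a :* i) refl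
    second : ∀ b i a c → a * 0# + (b * i + (c * 0# + 0#)) ≡ b * i
    second = solve 4 (λ b i a c → a :* 𝟘 :+ (b :* i :+ (c :* 𝟘 :+ 𝟘)) := b :* i) refl
    third : ∀ c i a b → a * 0# + (b * 0# + (c * i + 0#)) ≡ c * i
    third = solve 4 (λ c i a b → a :* 𝟘 :+ (b :* 𝟘 :+ (c :* i :+ 𝟘)) := c :* i) refl

  LinIndep⇒kernel : ∀ {m n} {vs : Vec (Vec K n) m} → LinIndep 𝔽q³ vs → ∀ cs → lincomb cs vs ≡ 𝟎 → cs ≡ 𝟎
  LinIndep⇒kernel ind cs = ind cs (all-U cs)

  LinIndep-surjective : ∀ {n} {vs : Vec (Vec K n) n} → LinIndep 𝔽q³ vs → ∀ v → ∃[ cs ] lincomb cs vs ≡ v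
  LinIndep-surjective {vs = vs} ind = linear-surjective (lincomb-linear vs) (LinIndep⇒kernel {vs = vs} ind)

  map-frob-𝔽q : ∀ {m n} {vs : Vec (Vec K n) m} → All (All 𝔽q) vs → map frob vs ≡ vs
  map-frob-𝔽q [] = refl
  map-frob-𝔽q (f ∷ fs) = cong₂ _∷_ (frob-fixed f) (map-frob-𝔽q fs)

  -- The conjugate coefficients represent the same rational vector, and coefficients are unique.
  LinIndep-𝔽q : ∀ {m n} {vs : Vec (Vec K n) m} → LinIndep 𝔽q³ vs → All (All 𝔽q) vs → ∀ {cs} → All 𝔽q (lincomb cs vs) → All 𝔽q cs
  LinIndep-𝔽q {vs = vs} ind fvs {cs} fv = fixed⇒All (injective (lincomb-linear vs) (LinIndep⇒kernel {vs = vs} ind) (begin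
    lincomb (frob cs) vs              ≡⟨ cong (lincomb (frob cs)) (sym (map-frob-𝔽q fvs)) ⟩
    lincomb (frob cs) (map frob vs)   ≡⟨ sym (frob-lincomb cs vs) ⟩
    frob (lincomb cs vs)              ≡⟨ frob-fixed fv ⟩
    lincomb cs vs                     ∎))
    where
    open ≡-Reasoning

  lincomb-𝔽q : ∀ {m n} {cs} {vs : Vec (Vec K n) m} → All 𝔽q cs → All (All 𝔽q) vs → All 𝔽q (lincomb cs vs)
  lincomb-𝔽q [] [] = all-zero
    where
    all-zero : ∀ {n} → All 𝔽q (𝟎 {n})
    all-zero {zero} = []
    all-zero {suc n} = φ-0 ∷ all-zero
  lincomb-𝔽q (fc ∷ fcs) (fv ∷ fvs) = +ᵛ-𝔽q (·ᵛ-𝔽q fc fv) (lincomb-𝔽q fcs fvs)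

  reorder : ∀ {n} (v w x : Vec K n) k a b c → lincomb (a ∷ b ∷ c ∷ []) (v ∷ w ∷ k ·ᵛ x ∷ []) ≡ lincomb (c * k ∷ a ∷ b ∷ []) (x ∷ v ∷ w ∷ [])
  reorder v w x k a b c = begin
    a ·ᵛ v +ᵛ (b ·ᵛ w +ᵛ (c ·ᵛ (k ·ᵛ x) +ᵛ 𝟎))
      ≡⟨ cong (λ z → a ·ᵛ v +ᵛ (b ·ᵛ w +ᵛ z)) (trans (+ᵛ-identityʳ _) (·ᵛ-assoc c k x)) ⟩
    a ·ᵛ v +ᵛ (b ·ᵛ w +ᵛ (c * k) ·ᵛ x)      ≡⟨ sym (+ᵛ-assoc (a ·ᵛ v) (b ·ᵛ w) ((c * k) ·ᵛ x)) ⟩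
    (a ·ᵛ v +ᵛ b ·ᵛ w) +ᵛ (c * k) ·ᵛ x      ≡⟨ +ᵛ-comm (a ·ᵛ v +ᵛ b ·ᵛ w) ((c * k) ·ᵛ x) ⟩
    (c * k) ·ᵛ x +ᵛ (a ·ᵛ v +ᵛ b ·ᵛ w)      ≡⟨ cong (λ z → (c * k) ·ᵛ x +ᵛ (a ·ᵛ v +ᵛ z)) (sym (+ᵛ-identityʳ (b ·ᵛ w))) ⟩
    lincomb (c * k ∷ a ∷ b ∷ []) (x ∷ v ∷ w ∷ [])  ∎
    where open ≡-Reasoning

  module Polarity (A : Form 3) where

    grad : Vec K 3 → Vec K 3
    grad u = polar A u e₀ ∷ polar A u e₁ ∷ polar A u e₂ ∷ []

    grad-∙ : ∀ u v → polar A u v ≡ grad u ∙ v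
    grad-∙ u (a ∷ b ∷ c ∷ []) = begin
      polar A u (a ∷ b ∷ c ∷ [])      ≡⟨ cong (polar A u) (sym (standard-basis (a ∷ b ∷ c ∷ []))) ⟩
      polar A u (lincomb (a ∷ b ∷ c ∷ []) (e₀ ∷ e₁ ∷ e₂ ∷ []))   ≡⟨ polar-comb₃ A u a b c e₀ e₁ e₂ ⟩
      a * p₀ + (b * p₁ + c * p₂)
        ≡⟨ solve 6 (λ a b c p₀ p₁ p₂ → a :* p₀ :+ (b :* p₁ :+ c :* p₂) := p₀ :* a :+ (p₁ :* b :+ (p₂ :* c :+ 𝟘))) refl a b c p₀ p₁ p₂ ⟩
      grad u ∙ (a ∷ b ∷ c ∷ [])       ∎
      where
      open ≡-Reasoning
      p₀ = polar A u e₀ ; p₁ = polar A u e₁ ; p₂ = polar A u e₂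

  module NormalForm (A : Form 3) (fA : FormOver 𝔽q A) (nondegenerate : NonDegenerate 𝔽q A) where

    open Ternary A fA
    open Polarity A

    singular⇒𝟎 : ∀ {v} → All 𝔽q v → eval A v ≡ 0# → (∀ w → All 𝔽q w → polar A v w ≡ 0#) → v ≡ 𝟎
    singular⇒𝟎 {v} fv e p = nondegenerate v fv e (λ w fw → trans (eval-+ A v w) (trans (cong (eval A v + eval A w +_) (p w fw)) (+-identityʳ _)))

    x₀ : Vec K 3
    x₀ = proj₁ isotropic
    fx₀ : All 𝔽q x₀
    fx₀ = proj₁ (proj₂ isotropic)
    x₀≢𝟎 : x₀ ≢ 𝟎
    x₀≢𝟎 = proj₁ (proj₂ (proj₂ isotropic))
    Ax₀ : eval A x₀ ≡ 0#
    Ax₀ = proj₂ (proj₂ (proj₂ isotropic))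

    grad-𝔽q : ∀ {u} → All 𝔽q u → All 𝔽q (grad u)
    grad-𝔽q fu = polar-𝔽q {A = A} fA fu e₀-𝔽q ∷ polar-𝔽q {A = A} fA fu e₁-𝔽q ∷ polar-𝔽q {A = A} fA fu e₂-𝔽q ∷ []

    -- Nondegeneracy excludes only those radical vectors that are zeros of A, so it matters that x₀
    -- is one: in characteristic 2 the radical itself is not zero.
    grad-x₀≢𝟎 : grad x₀ ≢ 𝟎
    grad-x₀≢𝟎 e = x₀≢𝟎 (singular⇒𝟎 {x₀} fx₀ Ax₀ λ w fw → trans (grad-∙ x₀ w) (trans (cong (_∙ w) e) (trans (∙-comm 𝟎 w) (∙-𝟎 w))))

    unit : ∃[ y ] (All 𝔽q y × grad x₀ ∙ y ≡ 1#)
    unit = ∃unit (grad x₀) (grad-𝔽q {x₀} fx₀) grad-x₀≢𝟎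
    u : Vec K 3
    u = proj₁ unit
    fu : All 𝔽q u
    fu = proj₁ (proj₂ unit)
    x₀∙u : polar A x₀ u ≡ 1#
    x₀∙u = trans (grad-∙ x₀ u) (proj₂ (proj₂ unit))

    -- Subtracting A(u) x₀ makes u isotropic and keeps its product 1 with x₀, so x₀ and v are a
    -- hyperbolic pair.
    v : Vec K 3
    v = 1# ·ᵛ u +ᵛ (- eval A u) ·ᵛ x₀
    fv : All 𝔽q v
    fv = +ᵛ-𝔽q (·ᵛ-𝔽q φ-1 fu) (·ᵛ-𝔽q (𝔽q-neg (eval-𝔽q {A = A} fA fu)) fx₀)
    x₀∙x₀ : polar A x₀ x₀ ≡ 0#
    x₀∙x₀ = trans (cong₂ _+_ Ax₀ Ax₀) (+-identityˡ 0#)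
    x₀∙v : polar A x₀ v ≡ 1#
    x₀∙v = trans (polar-comb A x₀ 1# u (- eval A u) x₀) (lemma (eval A u) _ _ x₀∙u x₀∙x₀)
      where
      lemma : ∀ a p r → p ≡ 1# → r ≡ 0# → 1# * p + - a * r ≡ 1#
      lemma a _ _ refl refl = solve 1 (λ a → 𝟙 :* 𝟙 :+ (:- a) :* 𝟘 := 𝟙) refl a
    Av : eval A v ≡ 0#
    Av = trans (eval-comb A 1# u (- eval A u) x₀) (lemma (eval A u) _ _ Ax₀ (trans (polar-sym A u x₀) x₀∙u))
      where
      lemma : ∀ a r p → r ≡ 0# → p ≡ 1# → 1# * 1# * a + - a * - a * r + 1# * - a * p ≡ 0#
      lemma a _ _ refl refl = solve 1 (λ a → 𝟙 :* 𝟙 :* a :+ (:- a) :* (:- a) :* 𝟘 :+ 𝟙 :* (:- a) :* 𝟙 := 𝟘) refl a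
    v∙v : polar A v v ≡ 0#
    v∙v = trans (cong₂ _+_ Av Av) (+-identityˡ 0#)

    w : Vec K 3
    w = cross (grad x₀) (grad v)
    fw : All 𝔽q w
    fw = cross-𝔽q (grad-𝔽q {x₀} fx₀) (grad-𝔽q {v} fv)
    x₀∙w : polar A x₀ w ≡ 0#
    x₀∙w = trans (grad-∙ x₀ w) (cross-⊥ˡ (grad x₀) (grad v))
    v∙w : polar A v w ≡ 0#
    v∙w = trans (grad-∙ v w) (cross-⊥ʳ (grad x₀) (grad v))
    -- By Binet-Cauchy, w ∙ (v × x₀) = 1·1 - 0·0.
    w≢𝟎 : w ≢ 𝟎
    w≢𝟎 w≡𝟎 = 1≢0 (begin
      1#                                          ≡⟨ solve 0 (𝟙 := 𝟙 :* 𝟙 :- 𝟘 :* 𝟘) refl ⟩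
      1# * 1# + - (0# * 0#)
        ≡⟨ cong₂ (λ a b → a + - b) (cong₂ _*_ (sym (trans (sym (grad-∙ x₀ v)) x₀∙v)) (sym (trans (sym (grad-∙ v x₀)) (trans (polar-sym A v x₀) x₀∙v))))
                                   (cong₂ _*_ (sym (trans (sym (grad-∙ x₀ x₀)) x₀∙x₀)) (sym (trans (sym (grad-∙ v v)) v∙v))) ⟩
      (grad x₀ ∙ v) * (grad v ∙ x₀) + - ((grad x₀ ∙ x₀) * (grad v ∙ v))
                                                  ≡⟨ sym (cross-cross (grad x₀) (grad v) v x₀) ⟩
      w ∙ cross v x₀                              ≡⟨ cong (_∙ cross v x₀) w≡𝟎 ⟩
      𝟎 ∙ cross v x₀                              ≡⟨ trans (∙-comm 𝟎 (cross v x₀)) (∙-𝟎 (cross v x₀)) ⟩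
      0#                                          ∎)
      where open ≡-Reasoning

    κ : K
    κ = eval A w
    hyperbolic : Vec (Vec K 3) 3
    hyperbolic = x₀ ∷ v ∷ w ∷ []

    -- Pairing with x₀ and v reads off b and a. Pairing with w would give 2 κ c, which says nothing
    -- in characteristic 2, so c is settled by w ≠ 0 instead.
    hyperbolic-independent : LinIndep 𝔽q³ hyperbolic
    hyperbolic-independent (a ∷ b ∷ c ∷ []) _ e = cong₂ _∷_ a≡0 (cong₂ _∷_ b≡0 (cong (_∷ []) c≡0))
      where
      pairing : ∀ u → a * polar A u x₀ + (b * polar A u v + c * polar A u w) ≡ 0#
      pairing u = trans (sym (polar-comb₃ A u a b c x₀ v w)) (trans (cong (polar A u) e) (polar-𝟎 A u))
      b≡0 : b ≡ 0#
      b≡0 = lemma a b c _ _ _ x₀∙x₀ x₀∙v x₀∙w (pairing x₀)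
        where
        lemma : ∀ a b c p r s → p ≡ 0# → r ≡ 1# → s ≡ 0# → a * p + (b * r + c * s) ≡ 0# → b ≡ 0#
        lemma a b c _ _ _ refl refl refl e = trans (solve 3 (λ a b c → b := a :* 𝟘 :+ (b :* 𝟙 :+ c :* 𝟘)) refl a b c) e
      a≡0 : a ≡ 0#
      a≡0 = lemma a b c _ _ _ (trans (polar-sym A v x₀) x₀∙v) v∙v v∙w (pairing v)
        where
        lemma : ∀ a b c p r s → p ≡ 1# → r ≡ 0# → s ≡ 0# → a * p + (b * r + c * s) ≡ 0# → a ≡ 0#
        lemma a b c _ _ _ refl refl refl e = trans (solve 3 (λ a b c → a := a :* 𝟙 :+ (b :* 𝟘 :+ c :* 𝟘)) refl a b c) e
      c≡0 : c ≡ 0#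
      c≡0 = case c ≟ 0# of λ where
          (yes z) → z
          (no nz) → contradiction (·ᵛ-≡𝟎 nz (trans (sym (drop a≡0 b≡0)) e)) w≢𝟎
        where
        drop : ∀ {a b} → a ≡ 0# → b ≡ 0# → lincomb (a ∷ b ∷ c ∷ []) hyperbolic ≡ c ·ᵛ w
        drop refl refl = trans (cong₂ _+ᵛ_ (·ᵛ-zeroˡ x₀) (cong₂ _+ᵛ_ (·ᵛ-zeroˡ v) (+ᵛ-identityʳ (c ·ᵛ w))))
          (trans (+ᵛ-identityˡ (𝟎 +ᵛ c ·ᵛ w)) (+ᵛ-identityˡ (c ·ᵛ w)))

    -- An isotropic w would be orthogonal to the whole basis, itself included, and hence singular.
    κ≢0 : κ ≢ 0#
    κ≢0 κ≡0 = w≢𝟎 (singular⇒𝟎 {w} fw κ≡0 λ y _ → orthogonal y (LinIndep-surjective {vs = hyperbolic} hyperbolic-independent y))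
      where
      orthogonal : ∀ y → ∃[ cs ] lincomb cs hyperbolic ≡ y → polar A w y ≡ 0#
      orthogonal _ (a ∷ b ∷ c ∷ [] , refl) = trans (polar-comb₃ A w a b c x₀ v w)
        (lemma a b c (trans (polar-sym A w x₀) x₀∙w) (trans (polar-sym A w v) v∙w) (trans (cong₂ _+_ κ≡0 κ≡0) (+-identityˡ 0#)))
        where
        lemma : ∀ a b c {p r s} → p ≡ 0# → r ≡ 0# → s ≡ 0# → a * p + (b * r + c * s) ≡ 0#
        lemma a b c refl refl refl = solve 3 (λ a b c → a :* 𝟘 :+ (b :* 𝟘 :+ c :* 𝟘) := 𝟘) refl a b c

    -- The factor -κ matches the hyperbolic term with the square term, so that the form becomes κ
    -- (b² - a c).
    parabolic : Vec (Vec K 3) 3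
    parabolic = v ∷ w ∷ (- κ) ·ᵛ x₀ ∷ []

    parabolic-𝔽q : All (All 𝔽q) parabolic
    parabolic-𝔽q = fv ∷ fw ∷ ·ᵛ-𝔽q (𝔽q-neg (eval-𝔽q {A = A} fA fw)) fx₀ ∷ []

    parabolic-independent : LinIndep 𝔽q³ parabolic
    parabolic-independent (a ∷ b ∷ c ∷ []) _ e = conclude (LinIndep⇒kernel {vs = hyperbolic} hyperbolic-independent _ (trans (sym (reorder v w x₀ (- κ) a b c)) e))
      where
      neg-κ≢0 : - κ ≢ 0#
      neg-κ≢0 e = κ≢0 (trans (solve 1 (λ k → k := :- :- k) refl κ) (trans (cong -_ e) (solve 0 (:- 𝟘 := 𝟘) refl)))
      conclude : c * - κ ∷ a ∷ b ∷ [] ≡ 𝟎 → a ∷ b ∷ c ∷ [] ≡ 𝟎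
      conclude e = cong₂ _∷_ (∷-injectiveˡ (∷-injectiveʳ e)) (cong₂ _∷_ (∷-injectiveˡ (∷-injectiveʳ (∷-injectiveʳ e)))
        (cong (_∷ []) (x*y≡0⇒y≡0 neg-κ≢0 (trans (*-comm (- κ) c) (∷-injectiveˡ e)))))

    parabolic-equation : ∀ a b c → eval A (lincomb (a ∷ b ∷ c ∷ []) parabolic) ≡ κ * (b * b + - (a * c))
    parabolic-equation a b c = begin
      eval A (lincomb (a ∷ b ∷ c ∷ []) parabolic)                    ≡⟨ cong (eval A) (reorder v w x₀ (- κ) a b c) ⟩
      eval A (lincomb (c * - κ ∷ a ∷ b ∷ []) hyperbolic)             ≡⟨ eval-comb₃ A (c * - κ) a b x₀ v w ⟩
      _ ≡⟨ lemma a b c κ Ax₀ Av x₀∙v x₀∙w v∙w ⟩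
      κ * (b * b + - (a * c)) ∎
      where
      open ≡-Reasoning
      lemma : ∀ a b c k {x y p r s} → x ≡ 0# → y ≡ 0# → p ≡ 1# → r ≡ 0# → s ≡ 0# →
        c * - k * (c * - k) * x + a * a * y + b * b * k + c * - k * a * p + c * - k * b * r + a * b * s ≡ k * (b * b + - (a * c))
      lemma a b c k refl refl refl refl refl = solve 4 (λ a b c k →
        c :* (:- k) :* (c :* (:- k)) :* 𝟘 :+ a :* a :* 𝟘 :+ b :* b :* k :+ c :* (:- k) :* a :* 𝟙 :+ c :* (:- k) :* b :* 𝟘 :+ a :* b :* 𝟘
        := k :* (b :* b :- a :* c)) refl a b c k

-- Parametrisation of the conic and of its extension to K

module ConicParametrisation (q : ℕ) (q-pp : IsPrimePower q) (6≤q : 6 ℕ.≤ q)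
                            (𝕂 : Field) (iso : Field.Carrier 𝕂 ↔ Fin (q ℕ.^ 3)) where

  open GaloisField q q-pp 6≤q 𝕂 iso
  open Forms q q-pp 6≤q 𝕂 iso
  open Conics q q-pp 6≤q 𝕂 iso

  ∼-scale : ∀ {n} {u v w : Vec K n} {c} → u ∼ v → c ≢ 0# → v ≡ c ·ᵛ w → u ∼ w
  ∼-scale {w = w} {c} (d , d≢0 , u≡) c≢0 v≡ = d * c , *-≢0 d≢0 c≢0 , trans u≡ (trans (cong (d ·ᵛ_) v≡) (·ᵛ-assoc d c w))

  ∼-reflexive : ∀ {n} {u v : Vec K n} → u ≡ v → u ∼ v
  ∼-reflexive {v = v} e = 1# , 1≢0 , trans e (sym (·ᵛ-identity v))

  ∼-≡ : ∀ {n} {u v w : Vec K n} → u ∼ v → v ≡ w → u ∼ w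
  ∼-≡ u∼v refl = u∼v

  pt : K → Vec K 3
  pt θ = 1# ∷ θ ∷ θ * θ ∷ []

  powers : ∀ θ → tabulate {n = 3} (λ i → θ ^ toℕ i) ≡ pt θ
  powers θ = cong₂ (λ x y → 1# ∷ x ∷ y ∷ []) (*-identityʳ θ) (cong (θ *_) (*-identityʳ θ))

  -- The zero vector falls under `infinite 0#`; where the vector represents a projective point, this
  -- value is excluded.
  data OnParabola : Vec K 3 → Set where
    finite   : ∀ {a} θ → a ≢ 0# → OnParabola (a ·ᵛ pt θ)
    infinite : ∀ c → OnParabola (c ·ᵛ e₂)

  pt-rational : ∀ {a θ} → a ≢ 0# → All 𝔽q (a ·ᵛ pt θ) → 𝔽q θ
  pt-rational {a} {θ} a≢0 (fa ∷ faθ ∷ _) = subst 𝔽q (cancel a θ ((a * 1#) ⁻¹) (*-inverseʳ a*1≢0)) (𝔽q-* (𝔽q-⁻¹ a*1≢0 fa) faθ)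
    where
    a*1≢0 : a * 1# ≢ 0#
    a*1≢0 = *-≢0 a≢0 1≢0
    cancel : ∀ a θ i → a * 1# * i ≡ 1# → i * (a * θ) ≡ θ
    cancel a θ i h = combine (θ ⟪ h ⟫ done) (solve 3 (λ a θ i → i :* (a :* θ) := θ :+ (θ :* (a :* 𝟙 :* i :- 𝟙) :+ 𝟘)) refl a θ i)

  on-parabola : ∀ a b c → b * b ≡ a * c → OnParabola (a ∷ b ∷ c ∷ [])
  on-parabola a b c e = case a ≟ 0# of λ where
      (yes a≡0) → subst OnParabola (at-infinity a≡0) (infinite c)
      (no a≢0) → subst OnParabola (affine a≢0) (finite (b * a ⁻¹) a≢0)
    where
    at-infinity : a ≡ 0# → c ·ᵛ e₂ ≡ a ∷ b ∷ c ∷ []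
    at-infinity a≡0 = cong₂ _∷_ (trans (zeroʳ c) (sym a≡0)) (cong₂ _∷_ (trans (zeroʳ c) (sym b≡0)) (cong (_∷ []) (*-identityʳ c)))
      where
      bb≡0 : b * b ≡ 0#
      bb≡0 = trans e (trans (cong (_* c) a≡0) (zeroˡ c))
      b≡0 : b ≡ 0#
      b≡0 = case b ≟ 0# of λ where
        (yes z) → z
        (no nz) → x*y≡0⇒y≡0 nz bb≡0
    affine : a ≢ 0# → a ·ᵛ pt (b * a ⁻¹) ≡ a ∷ b ∷ c ∷ []
    affine a≢0 = cong₂ _∷_ (*-identityʳ a) (cong₂ _∷_ (second (a ⁻¹) (*-inverseʳ a≢0)) (cong (_∷ []) (third (a ⁻¹) (*-inverseʳ a≢0))))
      where
      second : ∀ i → a * i ≡ 1# → a * (b * i) ≡ b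
      second i h = combine (b ⟪ h ⟫ done) (solve 3 (λ a b i → a :* (b :* i) := b :+ (b :* (a :* i :- 𝟙) :+ 𝟘)) refl a b i)
      third : ∀ i → a * i ≡ 1# → a * (b * i * (b * i)) ≡ c
      third i h = combine ((a * i * i) ⟪ e ⟫ (c * (a * i) + c) ⟪ h ⟫ done)
        (solve 4 (λ a b c i → a :* (b :* i :* (b :* i)) := c :+ (a :* i :* i :* (b :* b :- a :* c) :+ ((c :* (a :* i) :+ c) :* (a :* i :- 𝟙) :+ 𝟘))) refl a b c i)

  module _ (M : Vec (Vec K 3) 3) where

    curve-finite : ∀ {k} {P : Point 3} θ → k θ → vec P ∼ lincomb (pt θ) M → P ∈ curve k 2 M
    curve-finite {P = P} θ kθ e = inj₁ (θ , kθ , subst (λ x → vec P ∼ lincomb x M) (sym (powers θ)) e)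

    on-curve : ∀ {k} {P : Point 3} {y} → OnParabola y → (∀ {a θ} → a ≢ 0# → y ≡ a ·ᵛ pt θ → k θ) →
      vec P ∼ lincomb y M → P ∈ curve k 2 M
    on-curve {P = P} (finite {a} θ a≢0) kθ e = curve-finite {P = P} θ (kθ a≢0 refl) (∼-scale e a≢0 (lincomb-· a (pt θ) M))
    on-curve {P = P} (infinite c) kθ (d , d≢0 , e) = inj₂ (∼-scale (d , d≢0 , e) c≢0 (lincomb-· c e₂ M))
      where
      c≢0 : c ≢ 0#
      c≢0 refl = nonzero P (trans e (trans (cong (d ·ᵛ_) (trans (lincomb-· 0# e₂ M) (·ᵛ-zeroˡ _))) (·ᵛ-zeroʳ d)))

    curve-points : ∀ {k} {P : Point 3} → P ∈ curve k 2 M → (∃[ θ ] (k θ × vec P ∼ lincomb (pt θ) M)) ⊎ vec P ∼ lincomb e₂ M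
    curve-points {P = P} (inj₁ (θ , kθ , e)) = inj₁ (θ , kθ , subst (λ x → vec P ∼ lincomb x M) (powers θ) e)
    curve-points (inj₂ e) = inj₂ e

  Parametrised : PointSet 3 → PointSet 3 → Vec (Vec K 3) 3 → Set
  Parametrised π C M = LinIndep 𝔽q³ M × π ≐ SpanOver 𝔽q M × C ≐ curve 𝔽q 2 M

  -- The frame `M` is replaced by the images of the parabolic vectors. These are a basis with
  -- entries in GF(q), so the GF(q)-span, and with it the subplane, stays the same.
  parametrise : ∀ {π C} → IsConicOf π C → ∃[ M ] Parametrised π C M
  parametrise {π} {C} (M , M-ind , (π⊆ , π⊇) , A , fA , nd , C⊆ , C⊇) = M′ , M′-ind , (π⊆′ , π⊇′) , (C⊆′ , C⊇′)
    where
    open NormalForm A fA nd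
    M′ : Vec (Vec K 3) 3
    M′ = map (λ p → lincomb p M) parabolic
    M′≡ : ∀ y → lincomb y M′ ≡ lincomb (lincomb y parabolic) M
    M′≡ y = sym (lincomb-lincomb y parabolic M)
    M′-ind : LinIndep 𝔽q³ M′
    M′-ind y _ e = LinIndep⇒kernel {vs = parabolic} parabolic-independent y (LinIndep⇒kernel {vs = M} M-ind _ (trans (sym (M′≡ y)) e))
    coordinates : ∀ x → All 𝔽q x → ∃[ y ] (All 𝔽q y × lincomb y parabolic ≡ x)
    coordinates x fx =
      let y , e = LinIndep-surjective {vs = parabolic} parabolic-independent x
      in y , LinIndep-𝔽q {vs = parabolic} parabolic-independent parabolic-𝔽q (subst (All 𝔽q) (sym e) fx) , e
    π⊆′ : π ⊆ SpanOver 𝔽q M′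
    π⊆′ P∈π =
      let x , fx , P∼ = π⊆ P∈π
          y , fy , e = coordinates x fx
      in y , fy , ∼-≡ P∼ (trans (cong (λ z → lincomb z M) (sym e)) (sym (M′≡ y)))
    π⊇′ : SpanOver 𝔽q M′ ⊆ π
    π⊇′ (y , fy , P∼) = π⊇ (lincomb y parabolic , lincomb-𝔽q fy parabolic-𝔽q , ∼-≡ P∼ (M′≡ y))
    equation : ∀ {y} → eval A (lincomb y parabolic) ≡ 0# → OnParabola y
    equation {a ∷ b ∷ c ∷ []} e = on-parabola a b c (difference⇒≡ (x*y≡0⇒y≡0 κ≢0 (trans (sym (parabolic-equation a b c)) e)))
    C⊆′ : C ⊆ curve 𝔽q 2 M′
    C⊆′ {P} P∈C =
      let x , fx , Ax≡0 , P∼ = C⊆ P∈C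
          y , fy , e = coordinates x fx
      in on-curve M′ {P = P} (equation (trans (cong (eval A) e) Ax≡0)) (λ a≢0 y≡ → pt-rational a≢0 (subst (All 𝔽q) y≡ fy))
           (∼-≡ P∼ (trans (cong (λ z → lincomb z M) (sym e)) (sym (M′≡ y))))
    C⊇′ : curve 𝔽q 2 M′ ⊆ C
    C⊇′ {P} P∈ = case curve-points M′ {P = P} P∈ of λ where
        (inj₁ (θ , fθ , P∼)) → C⊇ (lincomb (pt θ) parabolic , lincomb-𝔽q (φ-1 ∷ fθ ∷ 𝔽q-* fθ fθ ∷ []) parabolic-𝔽q ,
          trans (parabolic-equation 1# θ (θ * θ)) (on-pt κ θ) , ∼-≡ P∼ (M′≡ (pt θ)))
        (inj₂ P∼) → C⊇ (lincomb e₂ parabolic , lincomb-𝔽q (φ-0 ∷ φ-0 ∷ φ-1 ∷ []) parabolic-𝔽q ,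
          trans (parabolic-equation 0# 0# 1#) (on-e₂ κ) , ∼-≡ P∼ (M′≡ e₂))
      where
      on-pt : ∀ k θ → k * (θ * θ + - (1# * (θ * θ))) ≡ 0#
      on-pt = solve 2 (λ k θ → k :* (θ :* θ :- 𝟙 :* (θ :* θ)) := 𝟘) refl
      on-e₂ : ∀ k → k * (0# * 0# + - (0# * 1#)) ≡ 0#
      on-e₂ = solve 1 (λ k → k :* (𝟘 :* 𝟘 :- 𝟘 :* 𝟙) := 𝟘) refl

  -- Divided differences at 1, a and b, as for a Vandermonde system: each subtraction removes one
  -- coefficient.
  three-zeros : ∀ {a b} X Y Z → a ≢ 1# → b ≢ 1# → a ≢ b →
    X + 1# * Y + 1# * 1# * Z ≡ 0# → X + a * Y + a * a * Z ≡ 0# → X + b * Y + b * b * Z ≡ 0# → X ≡ 0# × Y ≡ 0# × Z ≡ 0#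
  three-zeros {a} {b} X Y Z a≢1 b≢1 a≢b e₁ e₂ e₃ = X≡0 , Y≡0 , Z≡0
    where
    chord : ∀ {a} → a ≢ 1# → X + a * Y + a * a * Z ≡ 0# → Y + (a + 1#) * Z ≡ 0#
    chord {a} a≢1 e = x*y≡0⇒y≡0 {x = a + - 1#} (a≢1 ∘ difference⇒≡) (combine (1# ⟪ e ⟫ - 1# ⟪ e₁ ⟫ done)
      (solve 4 (λ a X Y Z → (a :- 𝟙) :* (Y :+ (a :+ 𝟙) :* Z) := 𝟘 :+ (𝟙 :* ((X :+ a :* Y :+ a :* a :* Z) :- 𝟘) :+ ((:- 𝟙) :* ((X :+ 𝟙 :* Y :+ 𝟙 :* 𝟙 :* Z) :- 𝟘) :+ 𝟘))) refl a X Y Z))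
    Z≡0 : Z ≡ 0#
    Z≡0 = x*y≡0⇒y≡0 {x = a + - b} (a≢b ∘ difference⇒≡) (combine (1# ⟪ chord a≢1 e₂ ⟫ - 1# ⟪ chord b≢1 e₃ ⟫ done)
      (solve 4 (λ a b Y Z → (a :- b) :* Z := 𝟘 :+ (𝟙 :* ((Y :+ (a :+ 𝟙) :* Z) :- 𝟘) :+ ((:- 𝟙) :* ((Y :+ (b :+ 𝟙) :* Z) :- 𝟘) :+ 𝟘))) refl a b Y Z))
    Y≡0 : Y ≡ 0#
    Y≡0 = combine (1# ⟪ chord a≢1 e₂ ⟫ - (a + 1#) ⟪ Z≡0 ⟫ done)
      (solve 3 (λ a Y Z → Y := 𝟘 :+ (𝟙 :* ((Y :+ (a :+ 𝟙) :* Z) :- 𝟘) :+ ((:- (a :+ 𝟙)) :* (Z :- 𝟘) :+ 𝟘))) refl a Y Z)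
    X≡0 : X ≡ 0#
    X≡0 = combine (1# ⟪ e₁ ⟫ - 1# ⟪ Y≡0 ⟫ - 1# ⟪ Z≡0 ⟫ done)
      (solve 3 (λ X Y Z → X := 𝟘 :+ (𝟙 :* ((X :+ 𝟙 :* Y :+ 𝟙 :* 𝟙 :* Z) :- 𝟘) :+ ((:- 𝟙) :* (Y :- 𝟘) :+ ((:- 𝟙) :* (Z :- 𝟘) :+ 𝟘)))) refl X Y Z)

  FourElements : Set
  FourElements = ∃[ a ] ∃[ b ] (𝔽q a × 𝔽q b × a ≢ 0# × a ≢ 1# × b ≢ 0# × b ≢ 1# × a ≢ b)

  -- On the F_q-points of the parabola A restricts to a quartic in θ without leading term, which vanishes at 0, 1, a, b.
  extended-equation : FourElements → ∀ (A : Form 3) {p₀ p₁ p₂ : Vec K 3} →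
    (∀ θ → 𝔽q θ → eval A (lincomb (pt θ) (p₀ ∷ p₁ ∷ p₂ ∷ [])) ≡ 0#) → eval A (lincomb e₂ (p₀ ∷ p₁ ∷ p₂ ∷ [])) ≡ 0# →
    ∀ x y z → eval A (lincomb (x ∷ y ∷ z ∷ []) (p₀ ∷ p₁ ∷ p₂ ∷ [])) ≡ eval A p₁ * (y * y + - (x * z))
  extended-equation (a , b , fa , fb , a≢0 , a≢1 , b≢0 , b≢1 , a≢b) A {p₀} {p₁} {p₂} on-pt on-e₂ x y z =
    trans (eval-comb₃ A x y z p₀ p₁ p₂)
      (conclude x y z (eval A p₀) (eval A p₁) (eval A p₂) (polar A p₀ p₁) (polar A p₀ p₂) (polar A p₁ p₂) E₀≡0 E₂≡0
        (proj₁ zeros) (proj₁ (proj₂ zeros)) (proj₂ (proj₂ zeros)))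
    where
    E₀ = eval A p₀ ; E₁ = eval A p₁ ; E₂ = eval A p₂
    B₀₁ = polar A p₀ p₁ ; B₀₂ = polar A p₀ p₂ ; B₁₂ = polar A p₁ p₂
    quartic : ∀ θ → 𝔽q θ → 1# * 1# * E₀ + θ * θ * E₁ + θ * θ * (θ * θ) * E₂ + 1# * θ * B₀₁ + 1# * (θ * θ) * B₀₂ + θ * (θ * θ) * B₁₂ ≡ 0#
    quartic θ fθ = trans (sym (eval-comb₃ A 1# θ (θ * θ) p₀ p₁ p₂)) (on-pt θ fθ)
    E₂≡0 : E₂ ≡ 0#
    E₂≡0 = trans (sym (reduce E₀ E₁ E₂ B₀₁ B₀₂ B₁₂)) (trans (sym (eval-comb₃ A 0# 0# 1# p₀ p₁ p₂)) on-e₂)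
      where
      reduce : ∀ e₀ e₁ e₂ p q r → 0# * 0# * e₀ + 0# * 0# * e₁ + 1# * 1# * e₂ + 0# * 0# * p + 0# * 1# * q + 0# * 1# * r ≡ e₂
      reduce = solve 6 (λ e₀ e₁ e₂ p q r → 𝟘 :* 𝟘 :* e₀ :+ 𝟘 :* 𝟘 :* e₁ :+ 𝟙 :* 𝟙 :* e₂ :+ 𝟘 :* 𝟘 :* p :+ 𝟘 :* 𝟙 :* q :+ 𝟘 :* 𝟙 :* r := e₂) refl
    E₀≡0 : E₀ ≡ 0#
    E₀≡0 = trans (sym (reduce E₀ E₁ E₂ B₀₁ B₀₂ B₁₂)) (quartic 0# φ-0)
      where
      reduce : ∀ e₀ e₁ e₂ p q r → 1# * 1# * e₀ + 0# * 0# * e₁ + 0# * 0# * (0# * 0#) * e₂ + 1# * 0# * p + 1# * (0# * 0#) * q + 0# * (0# * 0#) * r ≡ e₀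
      reduce = solve 6 (λ e₀ e₁ e₂ p q r → 𝟙 :* 𝟙 :* e₀ :+ 𝟘 :* 𝟘 :* e₁ :+ 𝟘 :* 𝟘 :* (𝟘 :* 𝟘) :* e₂ :+ 𝟙 :* 𝟘 :* p :+ 𝟙 :* (𝟘 :* 𝟘) :* q :+ 𝟘 :* (𝟘 :* 𝟘) :* r := e₀) refl
    -- With constant and leading coefficient gone, a factor θ cancels, and the remaining quadratic
    -- has the roots 1, a and b.
    quadratic : ∀ θ → 𝔽q θ → θ ≢ 0# → B₀₁ + θ * (E₁ + B₀₂) + θ * θ * B₁₂ ≡ 0#
    quadratic θ fθ θ≢0 = x*y≡0⇒y≡0 θ≢0 (reduce θ E₀ E₁ E₂ B₀₁ B₀₂ B₁₂ E₀≡0 E₂≡0 (quartic θ fθ))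
      where
      reduce : ∀ θ e₀ e₁ e₂ p q r → e₀ ≡ 0# → e₂ ≡ 0# →
        1# * 1# * e₀ + θ * θ * e₁ + θ * θ * (θ * θ) * e₂ + 1# * θ * p + 1# * (θ * θ) * q + θ * (θ * θ) * r ≡ 0# →
        θ * (p + θ * (e₁ + q) + θ * θ * r) ≡ 0#
      reduce θ _ e₁ _ p q r refl refl e = combine (1# ⟪ e ⟫ done) (solve 5 (λ θ e₁ p q r → θ :* (p :+ θ :* (e₁ :+ q) :+ θ :* θ :* r)
        := 𝟘 :+ (𝟙 :* ((𝟙 :* 𝟙 :* 𝟘 :+ θ :* θ :* e₁ :+ θ :* θ :* (θ :* θ) :* 𝟘 :+ 𝟙 :* θ :* p :+ 𝟙 :* (θ :* θ) :* q :+ θ :* (θ :* θ) :* r) :- 𝟘) :+ 𝟘)) refl θ e₁ p q r)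
    zeros = three-zeros B₀₁ (E₁ + B₀₂) B₁₂ a≢1 b≢1 a≢b (quadratic 1# φ-1 1≢0) (quadratic a fa a≢0) (quadratic b fb b≢0)
    conclude : ∀ x y z e₀ e₁ e₂ p q r → e₀ ≡ 0# → e₂ ≡ 0# → p ≡ 0# → e₁ + q ≡ 0# → r ≡ 0# →
      x * x * e₀ + y * y * e₁ + z * z * e₂ + x * y * p + x * z * q + y * z * r ≡ e₁ * (y * y + - (x * z))
    conclude x y z _ e₁ _ _ q _ refl refl refl e refl = combine ((x * z) ⟪ e ⟫ done) (solve 5 (λ x y z e₁ q →
      x :* x :* 𝟘 :+ y :* y :* e₁ :+ z :* z :* 𝟘 :+ x :* y :* 𝟘 :+ x :* z :* q :+ y :* z :* 𝟘
      := e₁ :* (y :* y :- x :* z) :+ (x :* z :* (e₁ :+ q :- 𝟘) :+ 𝟘)) refl x y z e₁ q)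

  -- Over `M`, every conic through C has an equation E₁ (y² - x z) = 0. With E₁ = 0 the form would
  -- vanish identically and be degenerate.
  extend : FourElements → ∀ {π C C⁺ M} → Parametrised π C M → IsConic C⁺ → C ⊆ C⁺ → C⁺ ≐ curve 𝔽q³ 2 M
  extend four {π} {C} {C⁺} {M@(p₀ ∷ p₁ ∷ p₂ ∷ [])} (M-ind , _ , _ , C⊇) (A , nd , C⁺⊆ , C⁺⊇) C⊆C⁺ = (λ {P} → ⊆′ {P}) , (λ {P} → ⊇′ {P})
    where
    nonzero-at : ∀ {y} → y ≢ 𝟎 → lincomb y M ≢ 𝟎
    nonzero-at {y} y≢𝟎 = y≢𝟎 ∘ LinIndep⇒kernel {vs = M} M-ind y
    pt≢𝟎 : ∀ θ → pt θ ≢ 𝟎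
    pt≢𝟎 θ = 1≢0 ∘ ∷-injectiveˡ
    e₂≢𝟎 : e₂ ≢ 𝟎
    e₂≢𝟎 = 1≢0 ∘ ∷-injectiveˡ ∘ ∷-injectiveʳ ∘ ∷-injectiveʳ
    vanish : ∀ {P} → P ∈ C → eval A (vec P) ≡ 0#
    vanish P∈C with C⁺⊆ (C⊆C⁺ P∈C)
    ... | e ∷ [] = e
    equation : ∀ x y z → eval A (lincomb (x ∷ y ∷ z ∷ []) M) ≡ eval A p₁ * (y * y + - (x * z))
    equation = extended-equation four A {p₀} {p₁} {p₂}
      (λ θ fθ → vanish {point (lincomb (pt θ) M) (nonzero-at (pt≢𝟎 θ))} (C⊇ (curve-finite M {P = point (lincomb (pt θ) M) (nonzero-at (pt≢𝟎 θ))} θ fθ (∼-reflexive refl))))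
      (vanish {point (lincomb e₂ M) (nonzero-at e₂≢𝟎)} (C⊇ (inj₂ (∼-reflexive refl))))
    span : ∀ v → ∃[ y ] lincomb y M ≡ v
    span = LinIndep-surjective {vs = M} M-ind
    E₁≢0 : eval A p₁ ≢ 0#
    E₁≢0 E₁≡0 = nonzero-at {e₀} (1≢0 ∘ ∷-injectiveˡ) (nd (lincomb e₀ M) (all-U _) (all-zero (lincomb e₀ M)) λ w _ →
      trans (all-zero (lincomb e₀ M +ᵛ w)) (sym (trans (cong₂ _+_ (all-zero (lincomb e₀ M)) (all-zero w)) (+-identityˡ 0#))))
      where
      zero-at : ∀ y → eval A (lincomb y M) ≡ 0#
      zero-at (x ∷ y ∷ z ∷ []) = trans (equation x y z) (trans (cong (_* (y * y + - (x * z))) E₁≡0) (zeroˡ _))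
      all-zero : ∀ v → eval A v ≡ 0#
      all-zero v = trans (cong (eval A) (sym (proj₂ (span v)))) (zero-at (proj₁ (span v)))
    on-parabola′ : ∀ y → eval A (lincomb y M) ≡ 0# → OnParabola y
    on-parabola′ (x ∷ y ∷ z ∷ []) e = on-parabola x y z (difference⇒≡ (x*y≡0⇒y≡0 E₁≢0 (trans (sym (equation x y z)) e)))
    ⊆′ : C⁺ ⊆ curve 𝔽q³ 2 M
    ⊆′ {P} P∈C⁺ with C⁺⊆ P∈C⁺
    ... | e ∷ [] = on-curve M {P = P} (on-parabola′ (proj₁ (span (vec P))) (trans (cong (eval A) (proj₂ (span (vec P)))) e)) (λ _ _ → _) (∼-reflexive (sym (proj₂ (span (vec P)))))
    eval-∼ : ∀ {u v} → u ∼ v → eval A v ≡ 0# → eval A u ≡ 0#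
    eval-∼ {v = v} (c , _ , refl) e = trans (eval-· A c v) (trans (cong (c * c *_) e) (zeroʳ _))
    ⊇′ : curve 𝔽q³ 2 M ⊆ C⁺
    ⊇′ {P} P∈ = case curve-points M {P = P} P∈ of λ where
        (inj₁ (θ , _ , P∼)) → C⁺⊇ (eval-∼ {vec P} {lincomb (pt θ) M} P∼ (trans (equation 1# θ (θ * θ)) (on-pt (eval A p₁) θ)) ∷ [])
        (inj₂ P∼) → C⁺⊇ (eval-∼ {vec P} {lincomb e₂ M} P∼ (trans (equation 0# 0# 1#) (on-e₂ (eval A p₁))) ∷ [])
      where
      on-pt : ∀ k θ → k * (θ * θ + - (1# * (θ * θ))) ≡ 0#
      on-pt = solve 2 (λ k θ → k :* (θ :* θ :- 𝟙 :* (θ :* θ)) := 𝟘) refl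
      on-e₂ : ∀ k → k * (0# * 0# + - (0# * 1#)) ≡ 0#
      on-e₂ = solve 1 (λ k → k :* (𝟘 :* 𝟘 :- 𝟘 :* 𝟙) := 𝟘) refl

-- Coordinates of PG(8,q³) adapted to Γ and its conjugates

module BoseCoordinates (q : ℕ) (q-pp : IsPrimePower q) (6≤q : 6 ℕ.≤ q)
                       (𝕂 : Field) (iso : Field.Carrier 𝕂 ↔ Fin (q ℕ.^ 3)) where

  open GaloisField q q-pp 6≤q 𝕂 iso
  open Forms q q-pp 6≤q 𝕂 iso
  open Conics q q-pp 6≤q 𝕂 iso
  open ConicParametrisation q q-pp 6≤q 𝕂 iso

  semilinear-· : ∀ B c v → semilinear B (c ·ᵛ v) ≡ φ c ·ᵛ semilinear B v
  semilinear-· B c v = trans (cong (λ z → lincomb z B) (frob-· c v)) (lincomb-· (φ c) (frob v) B)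

  semilinear-+ : ∀ B u v → semilinear B (u +ᵛ v) ≡ semilinear B u +ᵛ semilinear B v
  semilinear-+ B u v = trans (cong (λ z → lincomb z B) (frob-+ u v)) (lincomb-+ (frob u) (frob v) B)

  semilinear-lincomb : ∀ B {m} (cs : Vec K m) vs → semilinear B (lincomb cs vs) ≡ lincomb (frob cs) (map (semilinear B) vs)
  semilinear-lincomb B [] [] = trans (cong (λ z → lincomb z B) frob-𝟎) (lincomb-𝟎 B)
  semilinear-lincomb B (c ∷ cs) (v ∷ vs) = trans (semilinear-+ B (c ·ᵛ v) (lincomb cs vs)) (cong₂ _+ᵛ_ (semilinear-· B c v) (semilinear-lincomb B cs vs))

  -- A semilinear map that fixes every point of the subplane has a single eigenvalue on the columns of M,
  -- because it also fixes the sums of columns.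
  eigenvalue : ∀ {π : PointSet 3} {B M : Vec (Vec K 3) 3} → IsConjugacy π B → LinIndep 𝔽q³ M → SpanOver 𝔽q M ⊆ π →
    ∃[ μ ] (μ ≢ 0# × ∀ y → semilinear B (lincomb y M) ≡ μ ·ᵛ lincomb (frob y) M)
  eigenvalue {π} {B} {M@(m₀ ∷ m₁ ∷ m₂ ∷ [])} conjugacy M-ind ⊆π = μ₀ , proj₁ (proj₂ on-m₀) , λ y → begin
      semilinear B (lincomb y M)                     ≡⟨ semilinear-lincomb B y M ⟩
      lincomb (frob y) (map (semilinear B) M)        ≡⟨ cong (lincomb (frob y)) columns ⟩
      lincomb (frob y) (map (μ₀ ·ᵛ_) M)              ≡⟨ sym (lincomb-↦ scaling (frob y) M) ⟩
      μ₀ ·ᵛ lincomb (frob y) M                       ∎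
    where
    open ≡-Reasoning
    open IsConjugacy conjugacy
    scaling : ∀ {μ} → Linear (μ ·ᵛ_)
    scaling {μ} = record { additive = ·ᵛ-distribˡ μ ; homogeneous = λ c v → trans (·ᵛ-assoc μ c v) (trans (cong (_·ᵛ v) (*-comm μ c)) (sym (·ᵛ-assoc c μ v))) }
    fixed : ∀ y → All 𝔽q y → y ≢ 𝟎 → semilinear B (lincomb y M) ∼ lincomb y M
    fixed y fy y≢𝟎 = fixesS (point (lincomb y M) (y≢𝟎 ∘ LinIndep⇒kernel {vs = M} M-ind y)) (⊆π (y , fy , ∼-reflexive refl))
    e₀≢𝟎 : e₀ ≢ 𝟎
    e₀≢𝟎 = 1≢0 ∘ ∷-injectiveˡ
    on-m₀ = fixed e₀ e₀-𝔽q e₀≢𝟎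
    on-m₁ = fixed e₁ e₁-𝔽q (1≢0 ∘ ∷-injectiveˡ ∘ ∷-injectiveʳ)
    on-m₂ = fixed e₂ e₂-𝔽q (1≢0 ∘ ∷-injectiveˡ ∘ ∷-injectiveʳ ∘ ∷-injectiveʳ)
    μ₀ = proj₁ on-m₀
    μ₁ = proj₁ on-m₁
    μ₂ = proj₁ on-m₂
    m₀≡ : lincomb e₀ M ≡ m₀
    m₀≡ = trans (cong₂ _+ᵛ_ (·ᵛ-identity m₀) (lincomb-𝟎 (m₁ ∷ m₂ ∷ []))) (+ᵛ-identityʳ m₀)
    m₁≡ : lincomb e₁ M ≡ m₁
    m₁≡ = trans (cong₂ _+ᵛ_ (·ᵛ-zeroˡ m₀) (trans (cong₂ _+ᵛ_ (·ᵛ-identity m₁) (lincomb-𝟎 (m₂ ∷ []))) (+ᵛ-identityʳ m₁))) (+ᵛ-identityˡ m₁)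
    m₂≡ : lincomb e₂ M ≡ m₂
    m₂≡ = trans (cong₂ _+ᵛ_ (·ᵛ-zeroˡ m₀) (trans (cong₂ _+ᵛ_ (·ᵛ-zeroˡ m₁) (trans (+ᵛ-identityʳ (1# ·ᵛ m₂)) (·ᵛ-identity m₂))) (+ᵛ-identityˡ m₂))) (+ᵛ-identityˡ m₂)
    -- Additivity compares the eigenvalues at u and v with the one at u + v, and independence of `M`
    -- moves the comparison to coordinates.
    same : ∀ {u v a b c} → semilinear B (lincomb u M) ≡ a ·ᵛ lincomb u M → semilinear B (lincomb v M) ≡ b ·ᵛ lincomb v M →
      semilinear B (lincomb (u +ᵛ v) M) ≡ c ·ᵛ lincomb (u +ᵛ v) M → (a ·ᵛ u +ᵛ b ·ᵛ v) ≡ c ·ᵛ (u +ᵛ v)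
    same {u} {v} {a} {b} {c} e₁ e₂ e₃ = injective (lincomb-linear M) (LinIndep⇒kernel {vs = M} M-ind) (begin
      lincomb (a ·ᵛ u +ᵛ b ·ᵛ v) M                               ≡⟨ trans (lincomb-+ (a ·ᵛ u) (b ·ᵛ v) M) (cong₂ _+ᵛ_ (lincomb-· a u M) (lincomb-· b v M)) ⟩
      a ·ᵛ lincomb u M +ᵛ b ·ᵛ lincomb v M                       ≡⟨ cong₂ _+ᵛ_ (sym e₁) (sym e₂) ⟩
      semilinear B (lincomb u M) +ᵛ semilinear B (lincomb v M)   ≡⟨ sym (semilinear-+ B (lincomb u M) (lincomb v M)) ⟩
      semilinear B (lincomb u M +ᵛ lincomb v M)                  ≡⟨ cong (semilinear B) (sym (lincomb-+ u v M)) ⟩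
      semilinear B (lincomb (u +ᵛ v) M)                          ≡⟨ e₃ ⟩
      c ·ᵛ lincomb (u +ᵛ v) M                                    ≡⟨ sym (lincomb-· c (u +ᵛ v) M) ⟩
      lincomb (c ·ᵛ (u +ᵛ v)) M                                  ∎)
    eq-at : ∀ a b c → a * 1# + b * 0# ≡ c * (1# + 0#) → a * 0# + b * 1# ≡ c * (0# + 1#) → b ≡ a
    eq-at a b c h₁ h₂ = combine (1# ⟪ h₂ ⟫ - 1# ⟪ h₁ ⟫ done)
      (solve 3 (λ a b c → b := a :+ (𝟙 :* (a :* 𝟘 :+ b :* 𝟙 :- c :* (𝟘 :+ 𝟙)) :+ ((:- 𝟙) :* (a :* 𝟙 :+ b :* 𝟘 :- c :* (𝟙 :+ 𝟘)) :+ 𝟘))) refl a b c)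
    sum≢𝟎 : ∀ {x y} → (1# + 0#) ∷ x ∷ y ∷ [] ≢ 𝟎
    sum≢𝟎 e = 1≢0 (trans (sym (+-identityʳ 1#)) (∷-injectiveˡ e))
    on-01 = fixed (e₀ +ᵛ e₁) (+ᵛ-𝔽q e₀-𝔽q e₁-𝔽q) sum≢𝟎
    on-02 = fixed (e₀ +ᵛ e₂) (+ᵛ-𝔽q e₀-𝔽q e₂-𝔽q) sum≢𝟎
    01-eq : μ₀ ·ᵛ e₀ +ᵛ μ₁ ·ᵛ e₁ ≡ proj₁ on-01 ·ᵛ (e₀ +ᵛ e₁)
    01-eq = same {e₀} {e₁} (proj₂ (proj₂ on-m₀)) (proj₂ (proj₂ on-m₁)) (proj₂ (proj₂ on-01))
    02-eq : μ₀ ·ᵛ e₀ +ᵛ μ₂ ·ᵛ e₂ ≡ proj₁ on-02 ·ᵛ (e₀ +ᵛ e₂)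
    02-eq = same {e₀} {e₂} (proj₂ (proj₂ on-m₀)) (proj₂ (proj₂ on-m₂)) (proj₂ (proj₂ on-02))
    μ₁≡μ₀ : μ₁ ≡ μ₀
    μ₁≡μ₀ = eq-at μ₀ μ₁ (proj₁ on-01) (∷-injectiveˡ 01-eq) (∷-injectiveˡ (∷-injectiveʳ 01-eq))
    μ₂≡μ₀ : μ₂ ≡ μ₀
    μ₂≡μ₀ = eq-at μ₀ μ₂ (proj₁ on-02) (∷-injectiveˡ 02-eq) (∷-injectiveˡ (∷-injectiveʳ (∷-injectiveʳ 02-eq)))
    column : ∀ {e m μ} → lincomb e M ≡ m → semilinear B (lincomb e M) ≡ μ ·ᵛ lincomb e M → μ ≡ μ₀ → semilinear B m ≡ μ₀ ·ᵛ m
    column refl h refl = h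
    columns : map (semilinear B) M ≡ map (μ₀ ·ᵛ_) M
    columns = cong₂ _∷_ (column {e₀} m₀≡ (proj₂ (proj₂ on-m₀)) refl) (cong₂ _∷_ (column {e₁} m₁≡ (proj₂ (proj₂ on-m₁)) μ₁≡μ₀)
      (cong (_∷ []) (column {e₂} m₂≡ (proj₂ (proj₂ on-m₂)) μ₂≡μ₀)))

  module Coordinates (bose : Bose) (M : Vec (Vec K 3) 3) (M-ind : LinIndep 𝔽q³ M) where

    open Bose bose

    H H′ H″ : Vec (Vec K 9) 3
    H = map γ M
    H′ = map frob H
    H″ = map frob H′

    -- Coordinates for the decomposition of K⁹ into the three conjugate planes. The bases are images
    -- of `M`, so that points of the subplane get coordinates in GF(q).
    E : Vec K 3 → Vec K 3 → Vec K 3 → Vec K 9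
    E a b c = lincomb a H +ᵛ (lincomb b H′ +ᵛ lincomb c H″)

    E-+ : ∀ a b c a′ b′ c′ → E a b c +ᵛ E a′ b′ c′ ≡ E (a +ᵛ a′) (b +ᵛ b′) (c +ᵛ c′)
    E-+ a b c a′ b′ c′ = trans (+ᵛ-interchange (lincomb a H) (lincomb b H′ +ᵛ lincomb c H″) (lincomb a′ H) (lincomb b′ H′ +ᵛ lincomb c′ H″))
      (cong₂ _+ᵛ_ (sym (lincomb-+ a a′ H))
        (trans (+ᵛ-interchange (lincomb b H′) (lincomb c H″) (lincomb b′ H′) (lincomb c′ H″)) (cong₂ _+ᵛ_ (sym (lincomb-+ b b′ H′)) (sym (lincomb-+ c c′ H″)))))

    E-cong : ∀ {a b c a′ b′ c′} → a ≡ a′ → b ≡ b′ → c ≡ c′ → E a b c ≡ E a′ b′ c′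
    E-cong refl refl refl = refl

    E-· : ∀ s a b c → s ·ᵛ E a b c ≡ E (s ·ᵛ a) (s ·ᵛ b) (s ·ᵛ c)
    E-· s a b c = trans (·ᵛ-distribˡ s (lincomb a H) (lincomb b H′ +ᵛ lincomb c H″))
      (cong₂ _+ᵛ_ (sym (lincomb-· s a H)) (trans (·ᵛ-distribˡ s (lincomb b H′) (lincomb c H″)) (cong₂ _+ᵛ_ (sym (lincomb-· s b H′)) (sym (lincomb-· s c H″)))))

    γ-M : ∀ y → γ (lincomb y M) ≡ lincomb y H
    γ-M y = lincomb-lincomb y M G

    frob-H″ : map frob H″ ≡ H
    frob-H″ = frob³-map H
      where
      frob³-map : ∀ {m} (vs : Vec (Vec K 9) m) → map frob (map frob (map frob vs)) ≡ vs
      frob³-map [] = refl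
      frob³-map (v ∷ vs) = cong₂ _∷_ (frob³ v) (frob³-map vs)

    frob-E : ∀ a b c → frob (E a b c) ≡ E (frob c) (frob a) (frob b)
    frob-E a b c = begin
      frob (lincomb a H +ᵛ (lincomb b H′ +ᵛ lincomb c H″))
        ≡⟨ trans (frob-+ (lincomb a H) (lincomb b H′ +ᵛ lincomb c H″)) (cong (frob (lincomb a H) +ᵛ_) (frob-+ (lincomb b H′) (lincomb c H″))) ⟩
      frob (lincomb a H) +ᵛ (frob (lincomb b H′) +ᵛ frob (lincomb c H″))
        ≡⟨ cong₂ _+ᵛ_ (frob-lincomb a H) (cong₂ _+ᵛ_ (frob-lincomb b H′) (trans (frob-lincomb c H″) (cong (lincomb (frob c)) frob-H″))) ⟩
      lincomb (frob a) H′ +ᵛ (lincomb (frob b) H″ +ᵛ lincomb (frob c) H)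
        ≡⟨ sym (+ᵛ-assoc (lincomb (frob a) H′) (lincomb (frob b) H″) (lincomb (frob c) H)) ⟩
      (lincomb (frob a) H′ +ᵛ lincomb (frob b) H″) +ᵛ lincomb (frob c) H
        ≡⟨ +ᵛ-comm (lincomb (frob a) H′ +ᵛ lincomb (frob b) H″) (lincomb (frob c) H) ⟩
      E (frob c) (frob a) (frob b) ∎
      where open ≡-Reasoning

    γ-surjective : ∀ a → ∃[ a′ ] lincomb a′ H ≡ lincomb a G
    γ-surjective a = let a′ , e = LinIndep-surjective {vs = M} M-ind a in a′ , trans (sym (γ-M a′)) (cong (λ z → lincomb z G) e)

    private
      split : ∀ (cs : Vec K 9) → Σ[ a ∈ Vec K 3 ] Σ[ b ∈ Vec K 3 ] Σ[ c ∈ Vec K 3 ] cs ≡ a ++ (b ++ c)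
      split (a₀ ∷ a₁ ∷ a₂ ∷ b₀ ∷ b₁ ∷ b₂ ∷ c₀ ∷ c₁ ∷ c₂ ∷ []) = a₀ ∷ a₁ ∷ a₂ ∷ [] , b₀ ∷ b₁ ∷ b₂ ∷ [] , c₀ ∷ c₁ ∷ c₂ ∷ [] , refl

      E₉ : Vec K 9 → Vec K 9
      E₉ (a₀ ∷ a₁ ∷ a₂ ∷ b₀ ∷ b₁ ∷ b₂ ∷ c₀ ∷ c₁ ∷ c₂ ∷ []) = E (a₀ ∷ a₁ ∷ a₂ ∷ []) (b₀ ∷ b₁ ∷ b₂ ∷ []) (c₀ ∷ c₁ ∷ c₂ ∷ [])

      E₉-++ : ∀ a b c → E₉ (a ++ (b ++ c)) ≡ E a b c
      E₉-++ (_ ∷ _ ∷ _ ∷ []) (_ ∷ _ ∷ _ ∷ []) (_ ∷ _ ∷ _ ∷ []) = refl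

    -- The coefficients given by `spanning` refer to `G` and its conjugates. On Γ^q and Γ^(q²) they
    -- are conjugated back to Γ, rewritten over `M` and conjugated forward again. The zero vector is
    -- no point and is treated apart.
    E-surjective : ∀ v → ∃[ a ] ∃[ b ] ∃[ c ] E a b c ≡ v
    E-surjective v = case 𝟎? v of λ where
        (yes e) → 𝟎 , 𝟎 , 𝟎 , trans (cong₂ _+ᵛ_ (lincomb-𝟎 H) (cong₂ _+ᵛ_ (lincomb-𝟎 H′) (lincomb-𝟎 H″)))
                    (trans (trans (+ᵛ-identityˡ (𝟎 +ᵛ 𝟎)) (+ᵛ-identityˡ 𝟎)) (sym e))
        (no v≢𝟎) →
          let cs , _ , d , _ , e = spanning (point v v≢𝟎)
              a , b , c , split-cs = split (d ·ᵛ cs)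
              a′ , ea = γ-surjective a
              b′ , eb = γ-surjective (frob (frob b))
              c′ , ec = γ-surjective (frob c)
          in a′ , frob b′ , frob (frob c′) , trans (cong₂ _+ᵛ_ ea (cong₂ _+ᵛ_ (once b b′ eb) (twice c c′ ec)))
               (trans (sym (trans (lincomb-++ a (b ++ c) G _) (cong (lincomb a G +ᵛ_) (lincomb-++ b c (map frob G) _))))
                 (trans (cong (λ z → lincomb z _) (sym split-cs)) (trans (lincomb-· d cs _) (sym e))))
      where
      once : ∀ b b′ → lincomb b′ H ≡ lincomb (frob (frob b)) G → lincomb (frob b′) H′ ≡ lincomb b (map frob G)
      once b b′ e = trans (sym (frob-lincomb b′ H)) (trans (cong frob e)
        (trans (frob-lincomb (frob (frob b)) G) (cong (λ z → lincomb z (map frob G)) (frob³ b))))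
      twice : ∀ c c′ → lincomb c′ H ≡ lincomb (frob c) G → lincomb (frob (frob c′)) H″ ≡ lincomb c (map (λ v → frob (frob v)) G)
      twice c c′ e = trans (sym (trans (cong frob (frob-lincomb c′ H)) (frob-lincomb (frob c′) H′))) (trans (cong (frob ∘ frob) e)
        (trans (trans (cong frob (frob-lincomb (frob c) G)) (frob-lincomb (frob (frob c)) (map frob G)))
          (cong₂ lincomb (frob³ c) (sym (map-∘ frob frob G)))))

    abstract

      -- A map of the finite set K⁹ onto itself is injective.
      E-injective : ∀ {a b c a′ b′ c′} → E a b c ≡ E a′ b′ c′ → a ≡ a′ × b ≡ b′ × c ≡ c′
      E-injective {a} {b} {c} {a′} {b′} {c′} e = unglue a b c a′ b′ c′ (linear-injective E₉-surjective
          (trans (E₉-++ a b c) (trans e (sym (E₉-++ a′ b′ c′)))))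
        where
        E₉-surjective : ∀ v → ∃[ x ] E₉ x ≡ v
        E₉-surjective v = let a , b , c , e = E-surjective v in a ++ (b ++ c) , trans (E₉-++ a b c) e
        unglue : ∀ (a b c a′ b′ c′ : Vec K 3) → a ++ (b ++ c) ≡ a′ ++ (b′ ++ c′) → a ≡ a′ × b ≡ b′ × c ≡ c′
        unglue (_ ∷ _ ∷ _ ∷ []) (_ ∷ _ ∷ _ ∷ []) (_ ∷ _ ∷ _ ∷ []) (_ ∷ _ ∷ _ ∷ []) (_ ∷ _ ∷ _ ∷ []) (_ ∷ _ ∷ _ ∷ []) refl = refl , refl , refl

    E-𝟎 : E 𝟎 𝟎 𝟎 ≡ 𝟎
    E-𝟎 = trans (cong₂ _+ᵛ_ (lincomb-𝟎 H) (cong₂ _+ᵛ_ (lincomb-𝟎 H′) (lincomb-𝟎 H″))) (trans (+ᵛ-identityˡ (𝟎 +ᵛ 𝟎)) (+ᵛ-identityˡ 𝟎))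

    E-kernel : ∀ {a b c} → E a b c ≡ 𝟎 → a ≡ 𝟎 × b ≡ 𝟎 × c ≡ 𝟎
    E-kernel {a} {b} {c} e = E-injective {a} {b} {c} {𝟎} {𝟎} {𝟎} (trans e (sym E-𝟎))

    E-₁ : ∀ a → E a 𝟎 𝟎 ≡ lincomb a H
    E-₁ a = trans (cong (lincomb a H +ᵛ_) (trans (cong₂ _+ᵛ_ (lincomb-𝟎 H′) (lincomb-𝟎 H″)) (+ᵛ-identityˡ 𝟎))) (+ᵛ-identityʳ (lincomb a H))

    -- The GF(q)-vectors of K⁹ are exactly these: Frobenius shifts the three components cyclically,
    -- so the first component of a fixed vector determines the others.
    T : Vec K 3 → Vec K 9
    T a = E a (frob a) (frob (frob a))

    frob-T : ∀ a → frob (T a) ≡ T a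
    frob-T a = trans (frob-E a (frob a) (frob (frob a))) (cong (λ z → E z (frob a) (frob (frob a))) (frob³ a))

    T-𝔽q : ∀ a → All 𝔽q (T a)
    T-𝔽q a = fixed⇒All (frob-T a)

    E-fixed : ∀ {a b c} → frob (E a b c) ≡ E a b c → b ≡ frob a × c ≡ frob (frob a)
    E-fixed {a} {b} {c} e =
      let _ , fa≡b , fb≡c = E-injective {frob c} {frob a} {frob b} {a} {b} {c} (trans (sym (frob-E a b c)) e)
      in sym fa≡b , trans (sym fb≡c) (cong frob (sym fa≡b))

    fixed⇒T : ∀ v → All 𝔽q v → ∃[ a ] T a ≡ v
    fixed⇒T v fv =
      let a , b , c , e = E-surjective v
          b≡ , c≡ = E-fixed {a} {b} {c} (trans (cong frob e) (trans (frob-fixed fv) (sym e)))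
      in a , trans (cong₂ (E a) (sym b≡) (sym c≡)) e

    T-+ : ∀ a b → T (a +ᵛ b) ≡ T a +ᵛ T b
    T-+ a b = trans (cong₂ (E (a +ᵛ b)) (frob-+ a b) (trans (cong frob (frob-+ a b)) (frob-+ (frob a) (frob b))))
      (sym (E-+ a (frob a) (frob (frob a)) b (frob b) (frob (frob b))))

    T-· : ∀ {c} a → 𝔽q c → T (c ·ᵛ a) ≡ c ·ᵛ T a
    T-· {c} a fc = trans (cong₂ (E (c ·ᵛ a)) (scale c a fc) (trans (cong frob (scale c a fc)) (scale c (frob a) fc)))
      (sym (E-· c a (frob a) (frob (frob a))))
      where
      scale : ∀ c (a : Vec K 3) → 𝔽q c → frob (c ·ᵛ a) ≡ c ·ᵛ frob a
      scale c a fc = trans (frob-· c a) (cong (_·ᵛ frob a) fc)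

    span₃ : ∀ s t u y z w → lincomb (s ∷ t ∷ u ∷ []) (E y 𝟎 𝟎 ∷ E 𝟎 z 𝟎 ∷ E 𝟎 𝟎 w ∷ []) ≡ E (s ·ᵛ y) (t ·ᵛ z) (u ·ᵛ w)
    span₃ s t u y z w = begin
      s ·ᵛ E y 𝟎 𝟎 +ᵛ (t ·ᵛ E 𝟎 z 𝟎 +ᵛ (u ·ᵛ E 𝟎 𝟎 w +ᵛ 𝟎))
        ≡⟨ cong₂ _+ᵛ_ (scaled s y 𝟎 𝟎 refl (·ᵛ-zeroʳ s) (·ᵛ-zeroʳ s))
            (cong₂ _+ᵛ_ (scaled t 𝟎 z 𝟎 (·ᵛ-zeroʳ t) refl (·ᵛ-zeroʳ t)) (trans (+ᵛ-identityʳ (u ·ᵛ E 𝟎 𝟎 w)) (scaled u 𝟎 𝟎 w (·ᵛ-zeroʳ u) (·ᵛ-zeroʳ u) refl))) ⟩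
      E (s ·ᵛ y) 𝟎 𝟎 +ᵛ (E 𝟎 (t ·ᵛ z) 𝟎 +ᵛ E 𝟎 𝟎 (u ·ᵛ w))
        ≡⟨ cong (E (s ·ᵛ y) 𝟎 𝟎 +ᵛ_) (E-+ 𝟎 (t ·ᵛ z) 𝟎 𝟎 𝟎 (u ·ᵛ w)) ⟩
      E (s ·ᵛ y) 𝟎 𝟎 +ᵛ E (𝟎 +ᵛ 𝟎) (t ·ᵛ z +ᵛ 𝟎) (𝟎 +ᵛ u ·ᵛ w)
        ≡⟨ E-+ (s ·ᵛ y) 𝟎 𝟎 (𝟎 +ᵛ 𝟎) (t ·ᵛ z +ᵛ 𝟎) (𝟎 +ᵛ u ·ᵛ w) ⟩
      E (s ·ᵛ y +ᵛ (𝟎 +ᵛ 𝟎)) (𝟎 +ᵛ (t ·ᵛ z +ᵛ 𝟎)) (𝟎 +ᵛ (𝟎 +ᵛ u ·ᵛ w))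
        ≡⟨ E-cong (trans (cong (s ·ᵛ y +ᵛ_) (+ᵛ-identityˡ 𝟎)) (+ᵛ-identityʳ (s ·ᵛ y)))
                  (trans (+ᵛ-identityˡ (t ·ᵛ z +ᵛ 𝟎)) (+ᵛ-identityʳ (t ·ᵛ z)))
                  (trans (+ᵛ-identityˡ (𝟎 +ᵛ u ·ᵛ w)) (+ᵛ-identityˡ (u ·ᵛ w))) ⟩
      E (s ·ᵛ y) (t ·ᵛ z) (u ·ᵛ w) ∎
      where
      open ≡-Reasoning
      scaled : ∀ s a b c {a′ b′ c′} → s ·ᵛ a ≡ a′ → s ·ᵛ b ≡ b′ → s ·ᵛ c ≡ c′ → s ·ᵛ E a b c ≡ E a′ b′ c′
      scaled s a b c refl refl refl = E-· s a b c

    frob-₁ : ∀ a → frob (E a 𝟎 𝟎) ≡ E 𝟎 (frob a) 𝟎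
    frob-₁ a = trans (frob-E a 𝟎 𝟎) (cong₂ (λ x y → E x (frob a) y) frob-𝟎 frob-𝟎)
    frob-₂ : ∀ b → frob (E 𝟎 b 𝟎) ≡ E 𝟎 𝟎 (frob b)
    frob-₂ b = trans (frob-E 𝟎 b 𝟎) (cong₂ (λ x y → E x y (frob b)) frob-𝟎 frob-𝟎)

    γ-scaled : ∀ {x d y} → x ≡ d ·ᵛ lincomb y M → γ x ≡ E (d ·ᵛ y) 𝟎 𝟎
    γ-scaled {x} {d} {y} refl = trans (lincomb-· d (lincomb y M) G) (trans (cong (d ·ᵛ_) (γ-M y)) (trans (sym (lincomb-· d y H)) (sym (E-₁ (d ·ᵛ y)))))

    spread-vectors : ∀ s t u {x d y} → x ≡ d ·ᵛ lincomb y M →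
      lincomb (s ∷ t ∷ u ∷ []) (γ x ∷ frob (γ x) ∷ frob (frob (γ x)) ∷ []) ≡ E (s ·ᵛ (d ·ᵛ y)) (t ·ᵛ frob (d ·ᵛ y)) (u ·ᵛ frob (frob (d ·ᵛ y)))
    spread-vectors s t u {x} {d} {y} x≡ = trans (cong (lincomb (s ∷ t ∷ u ∷ [])) (cong₂ _∷_ γx (cong₂ _∷_ γx′ (cong (_∷ []) (trans (cong frob γx′) (frob-₂ (frob (d ·ᵛ y))))))))
      (span₃ s t u (d ·ᵛ y) (frob (d ·ᵛ y)) (frob (frob (d ·ᵛ y))))
      where
      γx : γ x ≡ E (d ·ᵛ y) 𝟎 𝟎
      γx = γ-scaled {x} {d} {y} x≡
      γx′ : frob (γ x) ≡ E 𝟎 (frob (d ·ᵛ y)) 𝟎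
      γx′ = trans (cong frob γx) (frob-₁ (d ·ᵛ y))

    -- A rational point is some `T a`, and its first component, a multiple of y, already determines
    -- a.
    spread-point : ∀ {P y x} → x ∼ lincomb y M → P ∈ ⟦ x ⟧ → ∃[ s ] vec P ∼ T (s ·ᵛ y)
    spread-point {P} {y} {x} (d , d≢0 , x≡) ((s ∷ t ∷ u ∷ [] , _ , c , c≢0 , P≡) , v , fv , c′ , c′≢0 , P≡v) =
      c′ ⁻¹ * (c * (s * d)) , ∼-≡ (c′ , c′≢0 , P≡v) (trans (sym Ta≡v) (cong T (begin
        a                                       ≡⟨ sym (·ᵛ-inverse a c′≢0) ⟩
        c′ ⁻¹ ·ᵛ (c′ ·ᵛ a)                      ≡⟨ cong (c′ ⁻¹ ·ᵛ_) (proj₁ components) ⟩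
        c′ ⁻¹ ·ᵛ (c ·ᵛ (s ·ᵛ (d ·ᵛ y)))
          ≡⟨ trans (cong (λ z → c′ ⁻¹ ·ᵛ (c ·ᵛ z)) (·ᵛ-assoc s d y)) (trans (cong (c′ ⁻¹ ·ᵛ_) (·ᵛ-assoc c (s * d) y)) (·ᵛ-assoc (c′ ⁻¹) (c * (s * d)) y)) ⟩
        (c′ ⁻¹ * (c * (s * d))) ·ᵛ y            ∎)))
      where
      open ≡-Reasoning
      a : Vec K 3
      a = proj₁ (fixed⇒T v fv)
      Ta≡v : T a ≡ v
      Ta≡v = proj₂ (fixed⇒T v fv)
      y₁ y₂ y₃ : Vec K 3
      y₁ = s ·ᵛ (d ·ᵛ y)
      y₂ = t ·ᵛ frob (d ·ᵛ y)
      y₃ = u ·ᵛ frob (frob (d ·ᵛ y))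
      components = E-injective {c′ ·ᵛ a} {c′ ·ᵛ frob a} {c′ ·ᵛ frob (frob a)} {c ·ᵛ y₁} {c ·ᵛ y₂} {c ·ᵛ y₃} (begin
        E (c′ ·ᵛ a) (c′ ·ᵛ frob a) (c′ ·ᵛ frob (frob a))   ≡⟨ sym (E-· c′ a (frob a) (frob (frob a))) ⟩
        c′ ·ᵛ T a                                          ≡⟨ trans (cong (c′ ·ᵛ_) Ta≡v) (sym P≡v) ⟩
        vec P                                              ≡⟨ trans P≡ (cong (c ·ᵛ_) (spread-vectors s t u {x} {d} {y} x≡)) ⟩
        c ·ᵛ E y₁ y₂ y₃                                    ≡⟨ E-· c y₁ y₂ y₃ ⟩
        E (c ·ᵛ y₁) (c ·ᵛ y₂) (c ·ᵛ y₃)                    ∎)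

    point-on-spread : ∀ {P} s y → vec P ∼ T (s ·ᵛ y) → P ∈ ⟦ lincomb y M ⟧
    point-on-spread {P} s y P∼ = (s ∷ φ s ∷ φ (φ s) ∷ [] , all-U _ , ∼-≡ P∼ (begin
        T (s ·ᵛ y)                                                  ≡⟨ cong₂ (E (s ·ᵛ y)) (frob-· s y) (trans (cong frob (frob-· s y)) (frob-· (φ s) (frob y))) ⟩
        E (s ·ᵛ y) (φ s ·ᵛ frob y) (φ (φ s) ·ᵛ frob (frob y))       ≡⟨ cong (λ z → E (s ·ᵛ z) (φ s ·ᵛ frob z) (φ (φ s) ·ᵛ frob (frob z))) (sym (·ᵛ-identity y)) ⟩
        _                                                           ≡⟨ sym (spread-vectors s (φ s) (φ (φ s)) {lincomb y M} {1#} {y} (sym (·ᵛ-identity _))) ⟩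
        _                                                           ∎)) ,
      T (s ·ᵛ y) , T-𝔽q (s ·ᵛ y) , P∼
      where open ≡-Reasoning

    module _ {B μ} (μ≢0 : μ ≢ 0#) (semilinear-M : ∀ y → semilinear B (lincomb y M) ≡ μ ·ᵛ lincomb (frob y) M) where

      private
        c₁ : ∀ {x d y} → x ≡ d ·ᵛ lincomb y M → semilinear B x ≡ (φ d * μ) ·ᵛ lincomb (frob y) M
        c₁ {x} {d} {y} refl = trans (semilinear-· B d (lincomb y M)) (trans (cong (φ d ·ᵛ_) (semilinear-M y)) (·ᵛ-assoc (φ d) μ (lincomb (frob y) M)))

      -- The conjugacy acts on coordinates over `M` as Frobenius up to a scalar. Applied twice
      -- before one Frobenius map, or once before two, it brings the coordinate vector back to y, so
      -- all three generators have y as coordinates up to nonzero scalars.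
      scroll-vectors : ∀ {x d y} → x ≡ d ·ᵛ lincomb y M → d ≢ 0# → ∃[ d₁ ] ∃[ d₂ ] (d₁ ≢ 0# × d₂ ≢ 0# × ∀ s t u →
        lincomb (s ∷ t ∷ u ∷ []) (γ x ∷ frob (γ (semilinear B (semilinear B x))) ∷ frob (frob (γ (semilinear B x))) ∷ [])
          ≡ E ((s * d) ·ᵛ y) ((t * d₂) ·ᵛ y) ((u * d₁) ·ᵛ y))
      scroll-vectors {x} {d} {y} x≡ d≢0 = φ (φ d₁) , φ d₂ , φ-≢0 (φ-≢0 d₁≢0) , φ-≢0 d₂≢0 , λ s t u → begin
          lincomb (s ∷ t ∷ u ∷ []) (γ x ∷ frob (γ (semilinear B (semilinear B x))) ∷ frob (frob (γ (semilinear B x))) ∷ [])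
            ≡⟨ cong (lincomb (s ∷ t ∷ u ∷ [])) (cong₂ _∷_ (γ-scaled {x} {d} {y} x≡) (cong₂ _∷_ second (cong (_∷ []) third))) ⟩
          lincomb (s ∷ t ∷ u ∷ []) (E (d ·ᵛ y) 𝟎 𝟎 ∷ E 𝟎 (φ d₂ ·ᵛ y) 𝟎 ∷ E 𝟎 𝟎 (φ (φ d₁) ·ᵛ y) ∷ [])
            ≡⟨ span₃ s t u (d ·ᵛ y) (φ d₂ ·ᵛ y) (φ (φ d₁) ·ᵛ y) ⟩
          E (s ·ᵛ (d ·ᵛ y)) (t ·ᵛ (φ d₂ ·ᵛ y)) (u ·ᵛ (φ (φ d₁) ·ᵛ y))
            ≡⟨ E-cong (·ᵛ-assoc s d y) (·ᵛ-assoc t (φ d₂) y) (·ᵛ-assoc u (φ (φ d₁)) y) ⟩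
          _ ∎
        where
        open ≡-Reasoning
        d₁ d₂ : K
        d₁ = φ d * μ
        d₂ = φ d₁ * μ
        d₁≢0 : d₁ ≢ 0#
        d₁≢0 = *-≢0 (φ-≢0 d≢0) μ≢0
        d₂≢0 : d₂ ≢ 0#
        d₂≢0 = *-≢0 (φ-≢0 d₁≢0) μ≢0
        cx : semilinear B x ≡ d₁ ·ᵛ lincomb (frob y) M
        cx = c₁ {x} {d} {y} x≡
        ccx : semilinear B (semilinear B x) ≡ d₂ ·ᵛ lincomb (frob (frob y)) M
        ccx = c₁ {semilinear B x} {d₁} {frob y} cx
        second : frob (γ (semilinear B (semilinear B x))) ≡ E 𝟎 (φ d₂ ·ᵛ y) 𝟎
        second = trans (cong frob (γ-scaled {semilinear B (semilinear B x)} {d₂} {frob (frob y)} ccx))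
          (trans (frob-₁ (d₂ ·ᵛ frob (frob y))) (cong (λ z → E 𝟎 z 𝟎) (trans (frob-· d₂ (frob (frob y))) (cong (φ d₂ ·ᵛ_) (frob³ y)))))
        third : frob (frob (γ (semilinear B x))) ≡ E 𝟎 𝟎 (φ (φ d₁) ·ᵛ y)
        third = trans (cong (frob ∘ frob) (γ-scaled {semilinear B x} {d₁} {frob y} cx))
          (trans (trans (cong frob (frob-₁ (d₁ ·ᵛ frob y))) (frob-₂ (frob (d₁ ·ᵛ frob y))))
            (cong (E 𝟎 𝟎) (trans (cong frob (frob-· d₁ (frob y))) (trans (frob-· (φ d₁) (frob (frob y))) (cong (φ (φ d₁) ·ᵛ_) (frob³ y))))))

      scroll-point : ∀ {P y x} → x ∼ lincomb y M → P ∈ scrollPlane B x → ∃[ s ] ∃[ t ] ∃[ u ] vec P ≡ E (s ·ᵛ y) (t ·ᵛ y) (u ·ᵛ y)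
      scroll-point {P} {y} {x} (d , d≢0 , x≡) (s ∷ t ∷ u ∷ [] , _ , c , c≢0 , P≡) =
        let d₁ , d₂ , _ , _ , e = scroll-vectors {x} {d} {y} x≡ d≢0
        in c * (s * d) , c * (t * d₂) , c * (u * d₁) ,
           trans P≡ (trans (cong (c ·ᵛ_) (e s t u)) (trans (E-· c ((s * d) ·ᵛ y) ((t * d₂) ·ᵛ y) ((u * d₁) ·ᵛ y))
             (trans (cong (λ z → E z (c ·ᵛ ((t * d₂) ·ᵛ y)) (c ·ᵛ ((u * d₁) ·ᵛ y))) (·ᵛ-assoc c (s * d) y))
               (cong₂ (E ((c * (s * d)) ·ᵛ y)) (·ᵛ-assoc c (t * d₂) y) (·ᵛ-assoc c (u * d₁) y)))))

      point-on-scroll : ∀ {P} s t u y → vec P ≡ E (s ·ᵛ y) (t ·ᵛ y) (u ·ᵛ y) → P ∈ scrollPlane B (lincomb y M)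
      point-on-scroll {P} s t u y P≡ =
        let d₁ , d₂ , d₁≢0 , d₂≢0 , e = scroll-vectors {lincomb y M} {1#} {y} (sym (·ᵛ-identity _)) 1≢0
        in s ∷ t * d₂ ⁻¹ ∷ u * d₁ ⁻¹ ∷ [] , all-U _ , ∼-reflexive (trans P≡ (sym (trans (e s (t * d₂ ⁻¹) (u * d₁ ⁻¹))
             (trans (cong (λ z → E (z ·ᵛ y) ((t * d₂ ⁻¹ * d₂) ·ᵛ y) ((u * d₁ ⁻¹ * d₁) ·ᵛ y)) (*-identityʳ s))
               (cong₂ (λ z w → E (s ·ᵛ y) (z ·ᵛ y) (w ·ᵛ y)) (cancel t d₂≢0) (cancel u d₁≢0))))))
        where
        cancel : ∀ t {d} → d ≢ 0# → t * d ⁻¹ * d ≡ t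
        cancel t {d} d≢0 = trans (*-assoc t (d ⁻¹) d) (trans (cong (t *_) (*-inverseˡ d≢0)) (*-identityʳ t))

-- Equations of the 6-space

module SixSpaceCoordinates (q : ℕ) (q-pp : IsPrimePower q) (6≤q : 6 ℕ.≤ q)
                           (𝕂 : Field) (iso : Field.Carrier 𝕂 ↔ Fin (q ℕ.^ 3)) where

  open GaloisField q q-pp 6≤q 𝕂 iso
  open Moore q q-pp 6≤q 𝕂 iso
  open Forms q q-pp 6≤q 𝕂 iso
  open Conics q q-pp 6≤q 𝕂 iso
  open ConicParametrisation q q-pp 6≤q 𝕂 iso
  open BoseCoordinates q q-pp 6≤q 𝕂 iso

  ∙-unit : ∀ {k} (cs : Vec K k) i → cs ∙ (𝟎 [ i ]≔ 1#) ≡ lookup cs i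
  ∙-unit (c ∷ cs) zero = trans (cong (c * 1# +_) (∙-𝟎 cs)) (trans (+-identityʳ (c * 1#)) (*-identityʳ c))
  ∙-unit (c ∷ cs) (suc i) = trans (cong₂ _+_ (zeroʳ c) (∙-unit cs i)) (+-identityˡ (lookup cs i))

  members : ∀ {m n} (vs : Vec (Vec K n) m) → All (λ v → ∃[ cs ] lincomb cs vs ≡ v) vs
  members [] = []
  members (v ∷ vs) = (1# ∷ 𝟎 , trans (cong₂ _+ᵛ_ (·ᵛ-identity v) (lincomb-𝟎 vs)) (+ᵛ-identityʳ v))
    ∷ All.map (λ (cs , e) → 0# ∷ cs , trans (cong₂ _+ᵛ_ (·ᵛ-zeroˡ v) e) (+ᵛ-identityˡ _)) (members vs)

  -- Frobenius carries a relation among rational vectors to another one, so the traces of all its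
  -- multiples are relations over GF(q) and vanish.
  independent-over-K : ∀ {t} → Tr t ≢ 0# → ∀ {m n} {vs : Vec (Vec K n) m} → All (All 𝔽q) vs → LinIndep 𝔽q vs → LinIndep 𝔽q³ vs
  independent-over-K t≢0 {vs = vs} fvs ind cs _ e = trᵛ-≡𝟎 t≢0 λ c → ind (trᵛ (c ·ᵛ cs)) (fixed⇒All (trᵛ-fixed (c ·ᵛ cs))) (begin
      lincomb (trᵛ (c ·ᵛ cs)) vs
        ≡⟨ trans (lincomb-+ (c ·ᵛ cs) _ vs) (cong (lincomb (c ·ᵛ cs) vs +ᵛ_) (lincomb-+ (frob (c ·ᵛ cs)) (frob (frob (c ·ᵛ cs))) vs)) ⟩
      lincomb (c ·ᵛ cs) vs +ᵛ (lincomb (frob (c ·ᵛ cs)) vs +ᵛ lincomb (frob (frob (c ·ᵛ cs))) vs)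
        ≡⟨ cong₂ _+ᵛ_ (scaled c) (cong₂ _+ᵛ_ (conjugate (c ·ᵛ cs) (scaled c)) (conjugate (frob (c ·ᵛ cs)) (conjugate (c ·ᵛ cs) (scaled c)))) ⟩
      𝟎 +ᵛ (𝟎 +ᵛ 𝟎)                ≡⟨ trans (+ᵛ-identityˡ (𝟎 +ᵛ 𝟎)) (+ᵛ-identityˡ 𝟎) ⟩
      𝟎                            ∎)
    where
    open ≡-Reasoning
    scaled : ∀ c → lincomb (c ·ᵛ cs) vs ≡ 𝟎
    scaled c = trans (lincomb-· c cs vs) (trans (cong (c ·ᵛ_) e) (·ᵛ-zeroʳ c))
    conjugate : ∀ ds → lincomb ds vs ≡ 𝟎 → lincomb (frob ds) vs ≡ 𝟎
    conjugate ds h = trans (cong (lincomb (frob ds)) (sym (map-frob-𝔽q fvs))) (trans (sym (frob-lincomb ds vs)) (trans (cong frob h) frob-𝟎))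

  module InSixSpace (bose : Bose) (M : Vec (Vec K 3) 3) (M-ind : LinIndep 𝔽q³ M) (ℓ∞ : Point 3)
                    (exterior : ∀ x → All 𝔽q x → map (vec ℓ∞ ∙_) M ∙ x ≡ 0# → x ≡ 𝟎) where

    open Bose bose
    open AtInfinity ℓ∞
    open Coordinates bose M M-ind

    m : Vec K 3
    m = map (vec ℓ∞ ∙_) M

    open Independent m exterior

    m∙ : ∀ a → vec ℓ∞ ∙ lincomb a M ≡ m ∙ a
    m∙ a = trans (∙-lincomb (vec ℓ∞) a M) (∙-comm a m)

    E₁-nonzero : ∀ {a} → a ≢ 𝟎 → E a 𝟎 𝟎 ≢ 𝟎
    E₁-nonzero {a} a≢𝟎 e = a≢𝟎 (proj₁ (E-kernel {a} {𝟎} {𝟎} e))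
    E₂-nonzero : ∀ {b} → b ≢ 𝟎 → E 𝟎 b 𝟎 ≢ 𝟎
    E₂-nonzero {b} b≢𝟎 e = b≢𝟎 (proj₁ (proj₂ (E-kernel {𝟎} {b} {𝟎} e)))
    E₃-nonzero : ∀ {c} → c ≢ 𝟎 → E 𝟎 𝟎 c ≢ 𝟎
    E₃-nonzero {c} c≢𝟎 e = c≢𝟎 (proj₂ (proj₂ (E-kernel {𝟎} {𝟎} {c} e)))

    frob-nonzero : ∀ {n} {a : Vec K n} → a ≢ 𝟎 → frob a ≢ 𝟎
    frob-nonzero a≢𝟎 = a≢𝟎 ∘ frob-≡𝟎

    on-g : ∀ {P a} → a ≢ 𝟎 → m ∙ a ≡ 0# → vec P ≡ E a 𝟎 𝟎 → P ∈ g
    on-g {P} {a} a≢𝟎 e P≡ = point (lincomb a M) (a≢𝟎 ∘ LinIndep⇒kernel {vs = M} M-ind a) , trans (m∙ a) e ,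
      ∼-reflexive (trans P≡ (trans (E-₁ a) (sym (γ-M a))))

    on-g′ : ∀ {P b} → b ≢ 𝟎 → m′ ∙ b ≡ 0# → vec P ≡ E 𝟎 b 𝟎 → P ∈ conj g
    on-g′ {P} {b} b≢𝟎 e P≡ = point (E a 𝟎 𝟎) (E₁-nonzero a≢𝟎) ,
      on-g {point (E a 𝟎 𝟎) (E₁-nonzero a≢𝟎)} {a} a≢𝟎 (trans (m∙frob² b) (trans (cong (φ ∘ φ) e) (trans (cong φ φ-0) φ-0))) refl ,
      ∼-reflexive (trans P≡ (trans (cong (λ z → E 𝟎 z 𝟎) (sym (frob³ b))) (sym (frob-₁ a))))
      where
      a : Vec K 3
      a = frob (frob b)
      a≢𝟎 : a ≢ 𝟎
      a≢𝟎 = frob-nonzero (frob-nonzero b≢𝟎)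

    on-g″ : ∀ {P c} → c ≢ 𝟎 → m″ ∙ c ≡ 0# → vec P ≡ E 𝟎 𝟎 c → P ∈ conj (conj g)
    on-g″ {P} {c} c≢𝟎 e P≡ = point (E 𝟎 b 𝟎) (E₂-nonzero b≢𝟎) ,
      on-g′ {point (E 𝟎 b 𝟎) (E₂-nonzero b≢𝟎)} {b} b≢𝟎 (trans (sym (φ-∙ m (frob c))) (trans (cong φ (trans (m∙frob c) (trans (cong φ e) φ-0))) φ-0)) refl ,
      ∼-reflexive (trans P≡ (trans (cong (E 𝟎 𝟎) (sym (frob³ c))) (sym (frob-₂ b))))
      where
      b : Vec K 3
      b = frob (frob c)
      b≢𝟎 : b ≢ 𝟎
      b≢𝟎 = frob-nonzero (frob-nonzero c≢𝟎)

    span-three : ∀ a b c → lincomb (1# ∷ 1# ∷ 1# ∷ []) (E a 𝟎 𝟎 ∷ E 𝟎 b 𝟎 ∷ E 𝟎 𝟎 c ∷ []) ≡ E a b c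
    span-three a b c = trans (span₃ 1# 1# 1# a b c) (trans (cong (λ z → E z (1# ·ᵛ b) (1# ·ᵛ c)) (·ᵛ-identity a)) (cong₂ (E a) (·ᵛ-identity b) (·ᵛ-identity c)))

    T-nonzero : ∀ {a} → a ≢ 𝟎 → T a ≢ 𝟎
    T-nonzero {a} a≢𝟎 e = a≢𝟎 (proj₁ (E-kernel {a} {frob a} {frob (frob a)} e))

    T-at-infinity : ∀ {a} (a≢𝟎 : a ≢ 𝟎) → m ∙ a ≡ 0# → point (T a) (T-nonzero a≢𝟎) ∈ Σ∞
    T-at-infinity {a} a≢𝟎 e = (3 , P₁ ∷ P₂ ∷ P₃ ∷ [] , 1# ∷ 1# ∷ 1# ∷ [] ,
        inj₁ (on-g {P₁} {a} a≢𝟎 e refl) ∷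
        inj₂ (inj₁ (on-g′ {P₂} {frob a} (frob-nonzero a≢𝟎) e′ refl)) ∷
        inj₂ (inj₂ (on-g″ {P₃} {frob (frob a)} (frob-nonzero (frob-nonzero a≢𝟎)) (trans (sym (φ-∙ m′ (frob a))) (trans (cong φ e′) φ-0)) refl)) ∷ [] ,
        sym (span-three a (frob a) (frob (frob a)))) ,
      T a , T-𝔽q a , ∼-reflexive refl
      where
      e′ : m′ ∙ frob a ≡ 0#
      e′ = trans (sym (φ-∙ m a)) (trans (cong φ e) φ-0)
      P₁ P₂ P₃ : Point 9
      P₁ = point (E a 𝟎 𝟎) (E₁-nonzero a≢𝟎)
      P₂ = point (E 𝟎 (frob a) 𝟎) (E₂-nonzero (frob-nonzero a≢𝟎))
      P₃ = point (E 𝟎 𝟎 (frob (frob a))) (E₃-nonzero (frob-nonzero (frob-nonzero a≢𝟎)))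

    module Affine (Σ₆,q : SixSpace) where

      open SixSpace Σ₆,q

      -- The vector space under `Σ₆⋆`, zero vector included.
      V : Vec K 9 → Set
      V v = ∃[ cs ] lincomb cs basis ≡ v

      V-+ : ∀ {u v} → V u → V v → V (u +ᵛ v)
      V-+ (cs , e) (ds , e′) = cs +ᵛ ds , trans (lincomb-+ cs ds basis) (cong₂ _+ᵛ_ e e′)
      V-· : ∀ c {v} → V v → V (c ·ᵛ v)
      V-· c (cs , e) = c ·ᵛ cs , trans (lincomb-· c cs basis) (cong (c ·ᵛ_) e)
      V-𝟎 : V 𝟎
      V-𝟎 = 𝟎 , lincomb-𝟎 basis

      basis-independent : LinIndep 𝔽q³ basis
      basis-independent = independent-over-K (proj₂ ∃trace) basisOver𝔽q independent

      V-T : ∀ a → m ∙ a ≡ 0# → V (T a)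
      V-T a e = case 𝟎? a of λ where
        (yes a≡𝟎) → subst V (sym (trans (cong T a≡𝟎) (trans (cong₂ (E 𝟎) frob-𝟎 (trans (cong frob frob-𝟎) frob-𝟎)) E-𝟎))) V-𝟎
        (no a≢𝟎) → let cs , _ , d , _ , e′ = containsΣ∞ {point (T a) (T-nonzero a≢𝟎)} (T-at-infinity a≢𝟎 e)
                   in d ·ᵛ cs , trans (lincomb-· d cs basis) (sym e′)

      zipE : ∀ {k} → Vec (Vec K 3) k → Vec (Vec K 3) k → Vec (Vec K 3) k → Vec (Vec K 9) k
      zipE [] [] [] = []
      zipE (a ∷ as) (b ∷ bs) (c ∷ cs) = E a b c ∷ zipE as bs cs

      lincomb-zipE : ∀ {k} (ds : Vec K k) as bs cs → lincomb ds (zipE as bs cs) ≡ E (lincomb ds as) (lincomb ds bs) (lincomb ds cs)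
      lincomb-zipE [] [] [] [] = sym E-𝟎
      lincomb-zipE (d ∷ ds) (a ∷ as) (b ∷ bs) (c ∷ cs) =
        trans (cong₂ _+ᵛ_ (E-· d a b c) (lincomb-zipE ds as bs cs)) (E-+ (d ·ᵛ a) (d ·ᵛ b) (d ·ᵛ c) _ _ _)

      zipE-T : ∀ {k} (as : Vec (Vec K 3) k) → map T as ≡ zipE as (map frob as) (map (frob ∘ frob) as)
      zipE-T [] = refl
      zipE-T (a ∷ as) = cong (T a ∷_) (zipE-T as)

      lincomb-T : ∀ {k} (cs : Vec K k) as → lincomb cs (map T as) ≡ E (lincomb cs as) (lincomb cs (map frob as)) (lincomb cs (map (frob ∘ frob) as))
      lincomb-T cs as = trans (cong (lincomb cs) (zipE-T as)) (lincomb-zipE cs as (map frob as) (map (frob ∘ frob) as))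

      functional : ∀ {k} (cs : Vec K k) (w : Vec K 3) vs {vals} → lincomb cs vs ≡ 𝟎 → map (w ∙_) vs ≡ vals → cs ∙ vals ≡ 0#
      functional cs w vs e refl = trans (sym (∙-lincomb w cs vs)) (trans (cong (w ∙_) e) (∙-𝟎 w))

      abstract

        -- The weights λ of the combination Σ λⱼ T (mⱼ a) can be prescribed through the Moore matrix of m.
        V-twisted : ∀ {a} → m ∙ a ≡ 0# → ∀ α β γ → V (E (α ·ᵛ a) (β ·ᵛ frob a) (γ ·ᵛ frob (frob a)))
        V-twisted {a} e α β γ = subst V combination (V-lincomb λs (map (_·ᵛ a) m) (All-map m))
          where
          λs : Vec K 3
          λs = proj₁ (moore-surjective (α ∷ β ∷ γ ∷ []))
          moore-λs : moore λs ≡ α ∷ β ∷ γ ∷ []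
          moore-λs = proj₂ (moore-surjective (α ∷ β ∷ γ ∷ []))
          V-lincomb : ∀ {k} (cs : Vec K k) as → All (λ a → m ∙ a ≡ 0#) as → V (lincomb cs (map T as))
          V-lincomb [] [] _ = V-𝟎
          V-lincomb (c ∷ cs) (a ∷ as) (e ∷ es) = V-+ (V-· c (V-T a e)) (V-lincomb cs as es)
          All-map : ∀ {k} (xs : Vec K k) → All (λ a → m ∙ a ≡ 0#) (map (_·ᵛ a) xs)
          All-map [] = []
          All-map (x ∷ xs) = trans (∙-· m x a) (trans (cong (x *_) e) (zeroʳ x)) ∷ All-map xs
          collect : ∀ {k} (cs xs : Vec K k) (w : Vec K 3) → lincomb cs (map (_·ᵛ w) xs) ≡ (xs ∙ cs) ·ᵛ w
          collect [] [] w = sym (·ᵛ-zeroˡ w)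
          collect (c ∷ cs) (x ∷ xs) w = trans (cong₂ _+ᵛ_ (trans (·ᵛ-assoc c x w) (cong (_·ᵛ w) (*-comm c x))) (collect cs xs w)) (sym (·ᵛ-distribʳ (x * c) (xs ∙ cs) w))
          map-frob-· : ∀ {k} (xs : Vec K k) (w : Vec K 3) → map frob (map (_·ᵛ w) xs) ≡ map (_·ᵛ frob w) (frob xs)
          map-frob-· [] w = refl
          map-frob-· (x ∷ xs) w = cong₂ _∷_ (frob-· x w) (map-frob-· xs w)
          once : map frob (map (_·ᵛ a) m) ≡ map (_·ᵛ frob a) m′
          once = map-frob-· m a
          twice : map (frob ∘ frob) (map (_·ᵛ a) m) ≡ map (_·ᵛ frob (frob a)) m″
          twice = trans (map-∘ frob frob (map (_·ᵛ a) m)) (trans (cong (map frob) once) (map-frob-· m′ (frob a)))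
          combination : lincomb λs (map T (map (_·ᵛ a) m)) ≡ E (α ·ᵛ a) (β ·ᵛ frob a) (γ ·ᵛ frob (frob a))
          combination = trans (lincomb-T λs (map (_·ᵛ a) m)) (E-cong
            (trans (collect λs m a) (cong (_·ᵛ a) (∷-injectiveˡ moore-λs)))
            (trans (cong (lincomb λs) once) (trans (collect λs m′ (frob a)) (cong (_·ᵛ frob a) (∷-injectiveˡ (∷-injectiveʳ moore-λs)))))
            (trans (cong (lincomb λs) twice) (trans (collect λs m″ (frob (frob a))) (cong (_·ᵛ frob (frob a)) (∷-injectiveˡ (∷-injectiveʳ (∷-injectiveʳ moore-λs)))))))

        -- The weights (1,0,0), (0,1,0) and (0,0,1) put each transversal line into V separately. For
        -- the second and third, the vector that is twisted is the one whose conjugate is b or c.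
        V-kernel : ∀ {a b c} → m ∙ a ≡ 0# → m′ ∙ b ≡ 0# → m″ ∙ c ≡ 0# → V (E a b c)
        V-kernel {a} {b} {c} ea eb ec = subst V (span-three a b c) (V-+ (V-· 1# V₁) (V-+ (V-· 1# V₂) (V-+ (V-· 1# V₃) V-𝟎)))
          where
          V₁ : V (E a 𝟎 𝟎)
          V₁ = subst V (trans (cong (λ z → E z (0# ·ᵛ frob a) (0# ·ᵛ frob (frob a))) (·ᵛ-identity a)) (cong₂ (E a) (·ᵛ-zeroˡ (frob a)) (·ᵛ-zeroˡ (frob (frob a)))))
            (V-twisted {a} ea 1# 0# 0#)
          V₂ : V (E 𝟎 b 𝟎)
          V₂ = subst V (trans (cong (λ z → E (0# ·ᵛ frob (frob b)) (1# ·ᵛ z) (0# ·ᵛ frob z)) (frob³ b))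
              (trans (cong (λ z → E z (1# ·ᵛ b) (0# ·ᵛ frob b)) (·ᵛ-zeroˡ (frob (frob b)))) (cong₂ (E 𝟎) (·ᵛ-identity b) (·ᵛ-zeroˡ (frob b)))))
            (V-twisted {frob (frob b)} (trans (m∙frob² b) (trans (cong (φ ∘ φ) eb) (trans (cong φ φ-0) φ-0))) 0# 1# 0#)
          V₃ : V (E 𝟎 𝟎 c)
          V₃ = subst V (trans (cong₂ (λ z w → E z w (1# ·ᵛ frob (frob (frob c)))) (·ᵛ-zeroˡ (frob c)) (·ᵛ-zeroˡ (frob (frob c))))
              (cong (E 𝟎 𝟎) (trans (·ᵛ-identity _) (frob³ c))))
            (V-twisted {frob c} (trans (m∙frob c) (trans (cong φ ec) φ-0)) 0# 0# 1#)

      -- The basis dual to `m`, `m′`, `m″`: any two of these vectors span the kernel of the form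
      -- belonging to the third.
      n₀ n₁ n₂ : Vec K 3
      n₀ = proj₁ (moore-surjective (1# ∷ 0# ∷ 0# ∷ []))
      n₁ = proj₁ (moore-surjective (0# ∷ 1# ∷ 0# ∷ []))
      n₂ = proj₁ (moore-surjective (0# ∷ 0# ∷ 1# ∷ []))

      moore-n₀ : moore n₀ ≡ 1# ∷ 0# ∷ 0# ∷ []
      moore-n₀ = proj₂ (moore-surjective (1# ∷ 0# ∷ 0# ∷ []))
      moore-n₁ : moore n₁ ≡ 0# ∷ 1# ∷ 0# ∷ []
      moore-n₁ = proj₂ (moore-surjective (0# ∷ 1# ∷ 0# ∷ []))
      moore-n₂ : moore n₂ ≡ 0# ∷ 0# ∷ 1# ∷ []
      moore-n₂ = proj₂ (moore-surjective (0# ∷ 0# ∷ 1# ∷ []))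

      at₀ : ∀ {v x y z} → moore v ≡ x ∷ y ∷ z ∷ [] → m ∙ v ≡ x
      at₀ = ∷-injectiveˡ
      at₁ : ∀ {v x y z} → moore v ≡ x ∷ y ∷ z ∷ [] → m′ ∙ v ≡ y
      at₁ e = ∷-injectiveˡ (∷-injectiveʳ e)
      at₂ : ∀ {v x y z} → moore v ≡ x ∷ y ∷ z ∷ [] → m″ ∙ v ≡ z
      at₂ e = ∷-injectiveˡ (∷-injectiveʳ (∷-injectiveʳ e))

      -- The components of eight vectors: `T a`, `T b` and a basis of each of the three transversal
      -- lines.
      firsts seconds thirds : Vec K 3 → Vec K 3 → Vec (Vec K 3) 8
      firsts a b  = a ∷ b ∷ n₁ ∷ n₂ ∷ 𝟎 ∷ 𝟎 ∷ 𝟎 ∷ 𝟎 ∷ []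
      seconds a b = frob a ∷ frob b ∷ 𝟎 ∷ 𝟎 ∷ n₀ ∷ n₂ ∷ 𝟎 ∷ 𝟎 ∷ []
      thirds a b  = frob (frob a) ∷ frob (frob b) ∷ 𝟎 ∷ 𝟎 ∷ 𝟎 ∷ 𝟎 ∷ n₀ ∷ n₁ ∷ []

      module Relation a b (mb≢0 : m ∙ b ≢ 0#) x y c₁ c₂ c₃ c₄ c₅ c₆
        (relation : lincomb (x ∷ y ∷ c₁ ∷ c₂ ∷ c₃ ∷ c₄ ∷ c₅ ∷ c₆ ∷ []) (zipE (firsts a b) (seconds a b) (thirds a b)) ≡ 𝟎) where

        cs : Vec K 6
        cs = c₁ ∷ c₂ ∷ c₃ ∷ c₄ ∷ c₅ ∷ c₆ ∷ []

        ds : Vec K 8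
        ds = x ∷ y ∷ cs

        components : lincomb ds (firsts a b) ≡ 𝟎 × lincomb ds (seconds a b) ≡ 𝟎 × lincomb ds (thirds a b) ≡ 𝟎
        components = E-kernel {lincomb ds (firsts a b)} {lincomb ds (seconds a b)} {lincomb ds (thirds a b)}
          (trans (sym (lincomb-zipE ds (firsts a b) (seconds a b) (thirds a b))) relation)

        private
          o₀ : m ∙ 𝟎 ≡ 0#
          o₀ = ∙-𝟎 m
          o₁ : m′ ∙ 𝟎 ≡ 0#
          o₁ = ∙-𝟎 m′
          o₂ : m″ ∙ 𝟎 ≡ 0#
          o₂ = ∙-𝟎 m″

          tail-values : ∀ {u v x₁ x₂ x₃ x₄ x₅ x₆ y₁ y₂ y₃ y₄ y₅ y₆ : K} → x₁ ≡ y₁ → x₂ ≡ y₂ → x₃ ≡ y₃ → x₄ ≡ y₄ → x₅ ≡ y₅ → x₆ ≡ y₆ →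
            _≡_ {A = Vec K 8} (u ∷ v ∷ x₁ ∷ x₂ ∷ x₃ ∷ x₄ ∷ x₅ ∷ x₆ ∷ []) (u ∷ v ∷ y₁ ∷ y₂ ∷ y₃ ∷ y₄ ∷ y₅ ∷ y₆ ∷ [])
          tail-values refl refl refl refl refl refl = refl

        zero-tail : ∀ u v → ds ∙ (u ∷ v ∷ 𝟎) ≡ x * u + y * v
        zero-tail u v = trans (cong (λ z → x * u + (y * v + z)) (∙-𝟎 cs)) (cong (x * u +_) (+-identityʳ (y * v)))

        relation₀ : x * (m ∙ a) + y * (m ∙ b) ≡ 0#
        relation₀ = trans (sym (zero-tail (m ∙ a) (m ∙ b))) (functional ds m (firsts a b) {m ∙ a ∷ m ∙ b ∷ 𝟎} (proj₁ components)
          (tail-values (at₀ moore-n₁) (at₀ moore-n₂) o₀ o₀ o₀ o₀))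

        relation₁ : x * φ (m ∙ a) + y * φ (m ∙ b) ≡ 0#
        relation₁ = trans (cong₂ (λ u v → x * u + y * v) (φ-∙ m a) (φ-∙ m b)) (trans (sym (zero-tail (m′ ∙ frob a) (m′ ∙ frob b)))
          (functional ds m′ (seconds a b) {m′ ∙ frob a ∷ m′ ∙ frob b ∷ 𝟎} (proj₁ (proj₂ components)) (tail-values o₁ o₁ (at₁ moore-n₀) (at₁ moore-n₂) o₁ o₁)))

        ratio : ∀ x i y u v → x * i ≡ 1# → x * u + y * v ≡ 0# → u ≡ - (y * i) * v
        ratio x i y u v h e = combine (i ⟪ e ⟫ - u ⟪ h ⟫ done)
          (solve 5 (λ x i y u v → u := (:- (y :* i)) :* v :+ (i :* (x :* u :+ y :* v :- 𝟘) :+ ((:- u) :* (x :* i :- 𝟙) :+ 𝟘))) refl x i y u v)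

        -- `m` on first components and `m′` on second components kill the six kernel vectors. They
        -- give the same ratio -y/x for the values at a and b and for the conjugates of these
        -- values, so `φ` fixes the ratio.
        multiple : x ≢ 0# → ∃[ k ] (𝔽q k × m ∙ a ≡ k * (m ∙ b))
        multiple x≢0 = k , *-cancelˡ (φ-≢0 mb≢0) φk≡k , value
          where
          k : K
          k = - (y * x ⁻¹)
          value : m ∙ a ≡ k * (m ∙ b)
          value = ratio x (x ⁻¹) y (m ∙ a) (m ∙ b) (*-inverseʳ x≢0) relation₀
          φk≡k : φ (m ∙ b) * φ k ≡ φ (m ∙ b) * k
          φk≡k = begin
            φ (m ∙ b) * φ k      ≡⟨ *-comm (φ (m ∙ b)) (φ k) ⟩
            φ k * φ (m ∙ b)      ≡⟨ sym (φ-* k (m ∙ b)) ⟩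
            φ (k * (m ∙ b))      ≡⟨ cong φ (sym value) ⟩
            φ (m ∙ a)            ≡⟨ ratio x (x ⁻¹) y (φ (m ∙ a)) (φ (m ∙ b)) (*-inverseʳ x≢0) relation₁ ⟩
            k * φ (m ∙ b)        ≡⟨ *-comm k (φ (m ∙ b)) ⟩
            φ (m ∙ b) * k        ∎
            where open ≡-Reasoning

        -- Once x = 0, the value of `m` at b forces y = 0, and the dual forms read off the other
        -- coefficients one at a time.
        trivial : x ≡ 0# → ds ≡ 𝟎
        trivial x≡0 = zeros x≡0 y≡0 c₁≡0 c₂≡0 c₃≡0 c₄≡0 c₅≡0 c₆≡0
          where
          zeros : ∀ {x y c₁ c₂ c₃ c₄ c₅ c₆ : K} → x ≡ 0# → y ≡ 0# → c₁ ≡ 0# → c₂ ≡ 0# → c₃ ≡ 0# → c₄ ≡ 0# → c₅ ≡ 0# → c₆ ≡ 0# →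
            x ∷ y ∷ c₁ ∷ c₂ ∷ c₃ ∷ c₄ ∷ c₅ ∷ c₆ ∷ [] ≡ 𝟎
          zeros refl refl refl refl refl refl refl refl = refl
          tail : ∀ {x y r} u v → x ≡ 0# → y ≡ 0# → x * u + (y * v + r) ≡ 0# → r ≡ 0#
          tail {r = r} u v refl refl e = trans (solve 3 (λ u v r → r := 𝟘 :* u :+ (𝟘 :* v :+ r)) refl u v r) e
          y≡0 : y ≡ 0#
          y≡0 = x*y≡0⇒y≡0 mb≢0 (trans (*-comm (m ∙ b) y) (trans (reduce (m ∙ a) (y * (m ∙ b)) x≡0) relation₀))
            where
            reduce : ∀ u v {x} → x ≡ 0# → v ≡ x * u + v
            reduce u v refl = solve 2 (λ u v → v := 𝟘 :* u :+ v) refl u v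
          coefficient : ∀ (w : Vec K 3) i u v vs → lincomb ds (u ∷ v ∷ vs) ≡ 𝟎 → map (w ∙_) (u ∷ v ∷ vs) ≡ w ∙ u ∷ w ∙ v ∷ 𝟎 [ i ]≔ 1# → lookup cs i ≡ 0#
          coefficient w i u v vs e h = trans (sym (∙-unit cs i)) (tail (w ∙ u) (w ∙ v) x≡0 y≡0 (functional ds w (u ∷ v ∷ vs) e h))
          c₁≡0 : c₁ ≡ 0#
          c₁≡0 = coefficient m′ zero a b (n₁ ∷ n₂ ∷ 𝟎 ∷ 𝟎 ∷ 𝟎 ∷ 𝟎 ∷ []) (proj₁ components) (tail-values (at₁ moore-n₁) (at₁ moore-n₂) o₁ o₁ o₁ o₁)
          c₂≡0 : c₂ ≡ 0#
          c₂≡0 = coefficient m″ (suc zero) a b (n₁ ∷ n₂ ∷ 𝟎 ∷ 𝟎 ∷ 𝟎 ∷ 𝟎 ∷ []) (proj₁ components) (tail-values (at₂ moore-n₁) (at₂ moore-n₂) o₂ o₂ o₂ o₂)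
          c₃≡0 : c₃ ≡ 0#
          c₃≡0 = coefficient m (suc (suc zero)) (frob a) (frob b) (𝟎 ∷ 𝟎 ∷ n₀ ∷ n₂ ∷ 𝟎 ∷ 𝟎 ∷ []) (proj₁ (proj₂ components)) (tail-values o₀ o₀ (at₀ moore-n₀) (at₀ moore-n₂) o₀ o₀)
          c₄≡0 : c₄ ≡ 0#
          c₄≡0 = coefficient m″ (suc (suc (suc zero))) (frob a) (frob b) (𝟎 ∷ 𝟎 ∷ n₀ ∷ n₂ ∷ 𝟎 ∷ 𝟎 ∷ []) (proj₁ (proj₂ components)) (tail-values o₂ o₂ (at₂ moore-n₀) (at₂ moore-n₂) o₂ o₂)
          c₅≡0 : c₅ ≡ 0#
          c₅≡0 = coefficient m (suc (suc (suc (suc zero)))) (frob (frob a)) (frob (frob b)) (𝟎 ∷ 𝟎 ∷ 𝟎 ∷ 𝟎 ∷ n₀ ∷ n₁ ∷ []) (proj₂ (proj₂ components)) (tail-values o₀ o₀ o₀ o₀ (at₀ moore-n₀) (at₀ moore-n₁))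
          c₆≡0 : c₆ ≡ 0#
          c₆≡0 = coefficient m′ (suc (suc (suc (suc (suc zero))))) (frob (frob a)) (frob (frob b)) (𝟎 ∷ 𝟎 ∷ 𝟎 ∷ 𝟎 ∷ n₀ ∷ n₁ ∷ []) (proj₂ (proj₂ components)) (tail-values o₁ o₁ o₁ o₁ (at₁ moore-n₀) (at₁ moore-n₁))

      -- Six kernel vectors together with T a and T b are dependent in the seven-dimensional V.
      abstract

        dependent-values : ∀ {a b} → V (T a) → V (T b) → m ∙ b ≢ 0# → ∃[ k ] (𝔽q k × m ∙ a ≡ k * (m ∙ b))
        dependent-values {a} {b} (ca , ea) (cb , eb) mb≢0 = conclude (dependent (ca ∷ cb ∷ proj₁ k₁ ∷ proj₁ k₂ ∷ proj₁ k₃ ∷ proj₁ k₄ ∷ proj₁ k₅ ∷ proj₁ k₆ ∷ []))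
            (cong₂ _∷_ ea (cong₂ _∷_ eb (cong₂ _∷_ (proj₂ k₁) (cong₂ _∷_ (proj₂ k₂) (cong₂ _∷_ (proj₂ k₃)
              (cong₂ _∷_ (proj₂ k₄) (cong₂ _∷_ (proj₂ k₅) (cong (_∷ []) (proj₂ k₆)))))))))
          where
          k₁ : V (E n₁ 𝟎 𝟎)
          k₁ = V-kernel (at₀ moore-n₁) (∙-𝟎 m′) (∙-𝟎 m″)
          k₂ : V (E n₂ 𝟎 𝟎)
          k₂ = V-kernel (at₀ moore-n₂) (∙-𝟎 m′) (∙-𝟎 m″)
          k₃ : V (E 𝟎 n₀ 𝟎)
          k₃ = V-kernel (∙-𝟎 m) (at₁ moore-n₀) (∙-𝟎 m″)
          k₄ : V (E 𝟎 n₂ 𝟎)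
          k₄ = V-kernel (∙-𝟎 m) (at₁ moore-n₂) (∙-𝟎 m″)
          k₅ : V (E 𝟎 𝟎 n₀)
          k₅ = V-kernel (∙-𝟎 m) (∙-𝟎 m′) (at₂ moore-n₀)
          k₆ : V (E 𝟎 𝟎 n₁)
          k₆ = V-kernel (∙-𝟎 m) (∙-𝟎 m′) (at₂ moore-n₁)
          conclude : ∀ {us} → ∃[ cs ] (cs ≢ 𝟎 × lincomb cs us ≡ 𝟎) → map (λ u → lincomb u basis) us ≡ zipE (firsts a b) (seconds a b) (thirds a b) →
            ∃[ k ] (𝔽q k × m ∙ a ≡ k * (m ∙ b))
          conclude {us} (cs@(x ∷ y ∷ c₁ ∷ c₂ ∷ c₃ ∷ c₄ ∷ c₅ ∷ c₆ ∷ []) , nz , e) us↦ = case x ≟ 0# of λ where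
              (yes x≡0) → contradiction (trivial x≡0) nz
              (no x≢0) → multiple x≢0
            where
            open Relation a b mb≢0 x y c₁ c₂ c₃ c₄ c₅ c₆ (trans (cong (lincomb cs) (sym us↦))
              (trans (sym (lincomb-lincomb cs us basis)) (trans (cong (λ z → lincomb z basis) e) (lincomb-𝟎 basis))))

      preimages : ∀ {k} (vs : Vec (Vec K 9) k) → All (All 𝔽q) vs → ∃[ as ] map T as ≡ vs
      preimages [] [] = [] , refl
      preimages (v ∷ vs) (fv ∷ fvs) =
        let a , e = fixed⇒T v fv
            as , es = preimages vs fvs
        in a ∷ as , cong₂ _∷_ e es

      as : Vec (Vec K 3) 7
      as = proj₁ (preimages basis basisOver𝔽q)

      T-as : map T as ≡ basis
      T-as = proj₂ (preimages basis basisOver𝔽q)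

      abstract

        V-as : All (λ a → V (T a)) as
        V-as = All.map⁻ (subst (All V) (sym T-as) (members basis))

        -- Otherwise the basis and three vectors on which the functionals m, m′, m″ do not vanish would be ten independent vectors of K⁹.
        not-all-at-infinity : ¬ All (λ a → m ∙ a ≡ 0#) as
        not-all-at-infinity zeros = conclude (dependent (basis ++ complement))
          where
          complement : Vec (Vec K 9) 3
          complement = E n₀ 𝟎 𝟎 ∷ E 𝟎 n₁ 𝟎 ∷ E 𝟎 𝟎 n₂ ∷ []
          annihilated : ∀ {k} (w : Vec K 3) (cs : Vec K k) vs → All (λ v → w ∙ v ≡ 0#) vs → w ∙ lincomb cs vs ≡ 0#
          annihilated w [] [] [] = ∙-𝟎 w
          annihilated w (c ∷ cs) (v ∷ vs) (e ∷ es) = trans (∙-+ w (c ·ᵛ v) (lincomb cs vs))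
            (trans (cong₂ _+_ (trans (∙-· w c v) (trans (cong (c *_) e) (zeroʳ c))) (annihilated w cs vs es)) (+-identityˡ 0#))
          once : ∀ {k} {as : Vec (Vec K 3) k} → All (λ a → m ∙ a ≡ 0#) as → All (λ a → m′ ∙ a ≡ 0#) (map frob as)
          once [] = []
          once {as = a ∷ as} (e ∷ es) = trans (sym (φ-∙ m a)) (trans (cong φ e) φ-0) ∷ once es
          twice : ∀ {k} {as : Vec (Vec K 3) k} → All (λ a → m ∙ a ≡ 0#) as → All (λ a → m″ ∙ a ≡ 0#) (map (frob ∘ frob) as)
          twice [] = []
          twice {as = a ∷ as} (e ∷ es) = trans (sym (φ-∙ m′ (frob a))) (trans (cong φ (trans (sym (φ-∙ m a)) (trans (cong φ e) φ-0))) φ-0) ∷ twice es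
          drop : ∀ v ds → ds ≡ 𝟎 → v +ᵛ lincomb ds complement ≡ v
          drop v _ refl = trans (cong (v +ᵛ_) (lincomb-𝟎 complement)) (+ᵛ-identityʳ v)
          vanish : ∀ {bs : Vec K 7} {x y z} → bs ≡ 𝟎 → x ≡ 0# → y ≡ 0# → z ≡ 0# → bs ++ (x ∷ y ∷ z ∷ []) ≡ 𝟎
          vanish refl refl refl refl = refl
          conclude : ¬ (∃[ cs ] (cs ≢ 𝟎 × lincomb cs (basis ++ complement) ≡ 𝟎))
          conclude (cs , nz , e) =
            let bs , ds , cs≡ = splitAt 7 cs
            in independent-split bs ds (nz ∘ trans cs≡) (trans (cong (λ z → lincomb z (basis ++ complement)) (sym cs≡)) e)
            where
            independent-split : ∀ (bs : Vec K 7) (ds : Vec K 3) → bs ++ ds ≢ 𝟎 → lincomb (bs ++ ds) (basis ++ complement) ≢ 𝟎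
            independent-split bs (x ∷ y ∷ z ∷ []) nz e = nz (vanish (LinIndep⇒kernel {vs = basis} basis-independent bs bs-zero) x≡0 y≡0 z≡0)
              where
              A B C : Vec K 3
              A = lincomb bs as
              B = lincomb bs (map frob as)
              C = lincomb bs (map (frob ∘ frob) as)
              relation : E (A +ᵛ x ·ᵛ n₀) (B +ᵛ y ·ᵛ n₁) (C +ᵛ z ·ᵛ n₂) ≡ 𝟎
              relation = begin
                E (A +ᵛ x ·ᵛ n₀) (B +ᵛ y ·ᵛ n₁) (C +ᵛ z ·ᵛ n₂)
                  ≡⟨ sym (E-+ A B C (x ·ᵛ n₀) (y ·ᵛ n₁) (z ·ᵛ n₂)) ⟩
                E A B C +ᵛ E (x ·ᵛ n₀) (y ·ᵛ n₁) (z ·ᵛ n₂)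
                  ≡⟨ cong₂ _+ᵛ_ (trans (sym (lincomb-T bs as)) (cong (lincomb bs) T-as)) (sym (span₃ x y z n₀ n₁ n₂)) ⟩
                lincomb bs basis +ᵛ lincomb (x ∷ y ∷ z ∷ []) complement
                  ≡⟨ sym (lincomb-++ bs (x ∷ y ∷ z ∷ []) basis complement) ⟩
                lincomb (bs ++ (x ∷ y ∷ z ∷ [])) (basis ++ complement)   ≡⟨ e ⟩
                𝟎 ∎
                where open ≡-Reasoning
              parts : A +ᵛ x ·ᵛ n₀ ≡ 𝟎 × B +ᵛ y ·ᵛ n₁ ≡ 𝟎 × C +ᵛ z ·ᵛ n₂ ≡ 𝟎
              parts = E-kernel {A +ᵛ x ·ᵛ n₀} {B +ᵛ y ·ᵛ n₁} {C +ᵛ z ·ᵛ n₂} relation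
              -- The form w vanishes on the combination of the basis and is 1 on the added vector,
              -- so it returns the coefficient of the latter.
              read : ∀ (w : Vec K 3) {v n} c → w ∙ v ≡ 0# → w ∙ n ≡ 1# → v +ᵛ c ·ᵛ n ≡ 𝟎 → c ≡ 0#
              read w {v} {n} c e₁ e₂ e₃ = begin
                c                          ≡⟨ solve 1 (λ c → c := 𝟘 :+ c :* 𝟙) refl c ⟩
                0# + c * 1#                ≡⟨ sym (cong₂ (λ u v → u + c * v) e₁ e₂) ⟩
                w ∙ v + c * (w ∙ n)        ≡⟨ sym (trans (∙-+ w v (c ·ᵛ n)) (cong (w ∙ v +_) (∙-· w c n))) ⟩
                w ∙ (v +ᵛ c ·ᵛ n)          ≡⟨ trans (cong (w ∙_) e₃) (∙-𝟎 w) ⟩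
                0#                         ∎
                where open ≡-Reasoning
              x≡0 : x ≡ 0#
              x≡0 = read m {A} {n₀} x (annihilated m bs as zeros) (at₀ moore-n₀) (proj₁ parts)
              y≡0 : y ≡ 0#
              y≡0 = read m′ {B} {n₁} y (annihilated m′ bs _ (once zeros)) (at₁ moore-n₁) (proj₁ (proj₂ parts))
              z≡0 : z ≡ 0#
              z≡0 = read m″ {C} {n₂} z (annihilated m″ bs _ (twice zeros)) (at₂ moore-n₂) (proj₂ (proj₂ parts))
              bs-zero : lincomb bs basis ≡ 𝟎
              bs-zero = trans (sym (drop (lincomb bs basis) (x ∷ y ∷ z ∷ []) (cong₂ _∷_ x≡0 (cong₂ _∷_ y≡0 (cong (_∷ []) z≡0)))))
                (trans (sym (lincomb-++ bs (x ∷ y ∷ z ∷ []) basis complement)) e)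

        affine-point : ∃[ a ] (V (T a) × m ∙ a ≢ 0#)
        affine-point = search as V-as not-all-at-infinity
          where
          search : ∀ {k} (as : Vec (Vec K 3) k) → All (λ a → V (T a)) as → ¬ All (λ a → m ∙ a ≡ 0#) as → ∃[ a ] (V (T a) × m ∙ a ≢ 0#)
          search [] [] none = contradiction [] none
          search (a ∷ as) (v ∷ vs) none = case m ∙ a ≟ 0# of λ where
            (no nz) → a , v , nz
            (yes z) → search as vs (none ∘ (z ∷_))

      a⋆ : Vec K 3
      a⋆ = proj₁ affine-point
      μ : K
      μ = m ∙ a⋆
      μ≢0 : μ ≢ 0#
      μ≢0 = proj₂ (proj₂ affine-point)

      -- The line at infinity with its dual coordinates scaled so that the affine points T a of Σ₆ have n ∙ a in F_q.
      n n′ n″ : Vec K 3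
      n = μ ⁻¹ ·ᵛ m
      n′ = frob n
      n″ = frob n′

      n∙a⋆ : n ∙ a⋆ ≡ 1#
      n∙a⋆ = trans (∙-·ˡ (μ ⁻¹) m a⋆) (*-inverseˡ μ≢0)

      n∙⇒m∙ : ∀ a → n ∙ a ≡ 0# → m ∙ a ≡ 0#
      n∙⇒m∙ a e = x*y≡0⇒y≡0 (⁻¹-≢0 μ≢0) (trans (sym (∙-·ˡ (μ ⁻¹) m a)) e)
      n′∙⇒m′∙ : ∀ a → n′ ∙ a ≡ 0# → m′ ∙ a ≡ 0#
      n′∙⇒m′∙ a e = x*y≡0⇒y≡0 (φ-≢0 (⁻¹-≢0 μ≢0)) (trans (sym (∙-·ˡ (φ (μ ⁻¹)) m′ a)) (trans (cong (_∙ a) (sym (frob-· (μ ⁻¹) m))) e))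
      n″∙⇒m″∙ : ∀ a → n″ ∙ a ≡ 0# → m″ ∙ a ≡ 0#
      n″∙⇒m″∙ a e = x*y≡0⇒y≡0 (φ-≢0 (φ-≢0 (⁻¹-≢0 μ≢0))) (trans (sym (∙-·ˡ (φ (φ (μ ⁻¹))) m″ a))
        (trans (cong (_∙ a) (sym (trans (cong frob (frob-· (μ ⁻¹) m)) (frob-· (φ (μ ⁻¹)) m′)))) e))

      n-independent : ∀ x → All 𝔽q x → n ∙ x ≡ 0# → x ≡ 𝟎
      n-independent x fx e = exterior x fx (n∙⇒m∙ x e)

      abstract

        n∙-rational : ∀ {a} → V (T a) → 𝔽q (n ∙ a)
        n∙-rational {a} Va =
          let k , fk , e = dependent-values {a} {a⋆} Va (proj₁ (proj₂ affine-point)) μ≢0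
          in subst 𝔽q (sym (trans (∙-·ˡ (μ ⁻¹) m a) (trans (cong (μ ⁻¹ *_) e) (cancel (μ ⁻¹) k μ (*-inverseˡ μ≢0))))) fk
          where
          cancel : ∀ i k u → i * u ≡ 1# → i * (k * u) ≡ k
          cancel i k u h = combine (k ⟪ h ⟫ done) (solve 3 (λ i k u → i :* (k :* u) := k :+ (k :* (i :* u :- 𝟙) :+ 𝟘)) refl i k u)

        -- Each basis vector is some `T a` with `n ∙ a` rational, so `n`, `n′`, `n″` agree on its
        -- three components, and linearity carries this to the span.
        Σ₆⋆⇒ : ∀ {P} → P ∈ Σ₆⋆ → ∃[ a ] ∃[ b ] ∃[ c ] ∃[ k ] (vec P ≡ E a b c × n ∙ a ≡ k × n′ ∙ b ≡ k × n″ ∙ c ≡ k)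
        Σ₆⋆⇒ {P} (cs , _ , d , _ , P≡) = lincomb ds as , lincomb ds (map frob as) , lincomb ds (map (frob ∘ frob) as) , ds ∙ map (n ∙_) as ,
            trans P≡ (trans (sym (lincomb-· d cs basis)) (trans (cong (lincomb ds) (sym T-as)) (lincomb-T ds as))) ,
            ∙-lincomb n ds as , trans (∙-lincomb n′ ds (map frob as)) (cong (ds ∙_) (once rational)) ,
            trans (∙-lincomb n″ ds (map (frob ∘ frob) as)) (cong (ds ∙_) (twice rational))
          where
          ds : Vec K 7
          ds = d ·ᵛ cs
          rational : All (λ a → 𝔽q (n ∙ a)) as
          rational = All.map n∙-rational V-as
          once : ∀ {k} {as : Vec (Vec K 3) k} → All (λ a → 𝔽q (n ∙ a)) as → map (n′ ∙_) (map frob as) ≡ map (n ∙_) as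
          once [] = refl
          once {as = a ∷ as} (f ∷ fs) = cong₂ _∷_ (trans (sym (φ-∙ n a)) f) (once fs)
          twice : ∀ {k} {as : Vec (Vec K 3) k} → All (λ a → 𝔽q (n ∙ a)) as → map (n″ ∙_) (map (frob ∘ frob) as) ≡ map (n ∙_) as
          twice [] = refl
          twice {as = a ∷ as} (f ∷ fs) = cong₂ _∷_ (trans (sym (φ-∙ n′ (frob a))) (trans (cong φ (trans (sym (φ-∙ n a)) f)) f)) (twice fs)

        -- The three forms all take the value k on k T(a⋆); subtracting it leaves a triple of kernel
        -- vectors.
        ⇒V : ∀ {a b c k} → n ∙ a ≡ k → n′ ∙ b ≡ k → n″ ∙ c ≡ k → V (E a b c)
        ⇒V {a} {b} {c} {k} ea eb ec = subst V (restore a b c) (V-+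
            (V-kernel (n∙⇒m∙ _ (shifted n a a⋆ ea n∙a⋆)) (n′∙⇒m′∙ _ (shifted n′ b (frob a⋆) eb n′∙)) (n″∙⇒m″∙ _ (shifted n″ c (frob (frob a⋆)) ec n″∙)))
            (V-· k (proj₁ (proj₂ affine-point))))
          where
          n′∙ : n′ ∙ frob a⋆ ≡ 1#
          n′∙ = trans (sym (φ-∙ n a⋆)) (trans (cong φ n∙a⋆) φ-1)
          n″∙ : n″ ∙ frob (frob a⋆) ≡ 1#
          n″∙ = trans (sym (φ-∙ n′ (frob a⋆))) (trans (cong φ n′∙) φ-1)
          shifted : ∀ (w a b : Vec K 3) → w ∙ a ≡ k → w ∙ b ≡ 1# → w ∙ (a +ᵛ (- k) ·ᵛ b) ≡ 0#
          shifted w a b e₁ e₂ = trans (∙-+ w a ((- k) ·ᵛ b)) (trans (cong₂ _+_ e₁ (trans (∙-· w (- k) b) (cong (- k *_) e₂)))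
            (solve 1 (λ k → k :+ (:- k) :* 𝟙 := 𝟘) refl k))
          cancel : ∀ {m} (a b : Vec K m) → (a +ᵛ (- k) ·ᵛ b) +ᵛ k ·ᵛ b ≡ a
          cancel [] [] = refl
          cancel (x ∷ a) (y ∷ b) = cong₂ _∷_ (solve 3 (λ x k y → (x :+ (:- k) :* y) :+ k :* y := x) refl x k y) (cancel a b)
          restore : ∀ a b c → E (a +ᵛ (- k) ·ᵛ a⋆) (b +ᵛ (- k) ·ᵛ frob a⋆) (c +ᵛ (- k) ·ᵛ frob (frob a⋆)) +ᵛ k ·ᵛ T a⋆ ≡ E a b c
          restore a b c = trans (cong (E (a +ᵛ (- k) ·ᵛ a⋆) (b +ᵛ (- k) ·ᵛ frob a⋆) (c +ᵛ (- k) ·ᵛ frob (frob a⋆)) +ᵛ_) (E-· k a⋆ (frob a⋆) (frob (frob a⋆))))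
            (trans (E-+ (a +ᵛ (- k) ·ᵛ a⋆) (b +ᵛ (- k) ·ᵛ frob a⋆) (c +ᵛ (- k) ·ᵛ frob (frob a⋆)) (k ·ᵛ a⋆) (k ·ᵛ frob a⋆) (k ·ᵛ frob (frob a⋆)))
              (trans (cong (λ z → E z ((b +ᵛ (- k) ·ᵛ frob a⋆) +ᵛ k ·ᵛ frob a⋆) ((c +ᵛ (- k) ·ᵛ frob (frob a⋆)) +ᵛ k ·ᵛ frob (frob a⋆))) (cancel a a⋆))
                (cong₂ (E a) (cancel b (frob a⋆)) (cancel c (frob (frob a⋆))))))

        ⇒Σ₆⋆ : ∀ {P a b c k} → vec P ≡ E a b c → n ∙ a ≡ k → n′ ∙ b ≡ k → n″ ∙ c ≡ k → P ∈ Σ₆⋆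
        ⇒Σ₆⋆ {P} {a} {b} {c} P≡ ea eb ec = let cs , e = ⇒V {a} {b} {c} ea eb ec in cs , all-U cs , ∼-reflexive (trans P≡ (sym e))

        Σ₆⇒ : ∀ {P} → P ∈ Σ₆ → ∃[ a ] (vec P ∼ T a × 𝔽q (n ∙ a))
        Σ₆⇒ {P} (cs , fcs , P∼) =
          let a , e = fixed⇒T (lincomb cs basis) (lincomb-𝔽q fcs basisOver𝔽q)
          in a , ∼-≡ P∼ (sym e) , n∙-rational {a} (cs , sym e)

        ⇒Σ₆ : ∀ {P a} → vec P ∼ T a → 𝔽q (n ∙ a) → P ∈ Σ₆
        ⇒Σ₆ {P} {a} P∼ fa =
          let cs , e = ⇒V {a} {frob a} {frob (frob a)} refl (trans (sym (φ-∙ n a)) fa) (trans (sym (φ-∙ n′ (frob a))) (trans (cong φ (trans (sym (φ-∙ n a)) fa)) fa))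
          in cs , LinIndep-𝔽q {vs = basis} basis-independent basisOver𝔽q (subst (All 𝔽q) (sym e) (T-𝔽q a)) , ∼-≡ P∼ (sym e)

-- Coefficient vectors of polynomial curves

module Varieties (q : ℕ) (q-pp : IsPrimePower q) (6≤q : 6 ℕ.≤ q)
                 (𝕂 : Field) (iso : Field.Carrier 𝕂 ↔ Fin (q ℕ.^ 3)) where

  open GaloisField q q-pp 6≤q 𝕂 iso
  open Moore q q-pp 6≤q 𝕂 iso
  open Forms q q-pp 6≤q 𝕂 iso
  open Conics q q-pp 6≤q 𝕂 iso
  open ConicParametrisation q q-pp 6≤q 𝕂 iso
  open BoseCoordinates q q-pp 6≤q 𝕂 iso
  open SixSpaceCoordinates q q-pp 6≤q 𝕂 iso

  𝔽q-^ : ∀ {x} k → 𝔽q x → 𝔽q (x ^ k)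
  𝔽q-^ zero fx = φ-1
  𝔽q-^ (suc k) fx = 𝔽q-* fx (𝔽q-^ k fx)

  monomials : K → ∀ r → Vec K (suc r)
  monomials θ r = tabulate λ i → θ ^ toℕ i

  ∞-coefficients : ∀ r → Vec K (suc r)
  ∞-coefficients r = replicate r 0# ∷ʳ 1#

  monomials-𝔽q : ∀ {θ} r → 𝔽q θ → All 𝔽q (monomials θ r)
  monomials-𝔽q r fθ = All.tabulate⁺ λ i → 𝔽q-^ (toℕ i) fθ

  ∞-coefficients-𝔽q : ∀ r → All 𝔽q (∞-coefficients r)
  ∞-coefficients-𝔽q zero = φ-1 ∷ []
  ∞-coefficients-𝔽q (suc r) = φ-0 ∷ ∞-coefficients-𝔽q r

  pt-𝔽q : ∀ {θ} → 𝔽q θ → All 𝔽q (pt θ)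
  pt-𝔽q fθ = φ-1 ∷ fθ ∷ 𝔽q-* fθ fθ ∷ []

  pt≢𝟎 : ∀ θ → pt θ ≢ 𝟎
  pt≢𝟎 θ = 1≢0 ∘ ∷-injectiveˡ
  e₂≢𝟎 : e₂ ≢ 𝟎
  e₂≢𝟎 = 1≢0 ∘ ∷-injectiveˡ ∘ ∷-injectiveʳ ∘ ∷-injectiveʳ

  -- Multiplication of quadratic polynomials, on coefficient vectors.
  product : Vec K 3 → Vec K 3 → Vec K 5
  product (v₀ ∷ v₁ ∷ v₂ ∷ []) (w₀ ∷ w₁ ∷ w₂ ∷ []) =
    v₀ * w₀ ∷ v₀ * w₁ + v₁ * w₀ ∷ v₀ * w₂ + v₁ * w₁ + v₂ * w₀ ∷ v₁ * w₂ + v₂ * w₁ ∷ v₂ * w₂ ∷ []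

  -- The coefficient vectors of g(θ)(1, θ, θ²) for a quartic g.
  shifts : Vec K 5 → Vec (Vec K 3) 7
  shifts (g₀ ∷ g₁ ∷ g₂ ∷ g₃ ∷ g₄ ∷ []) =
    (g₀ ∷ 0# ∷ 0# ∷ []) ∷ (g₁ ∷ g₀ ∷ 0# ∷ []) ∷ (g₂ ∷ g₁ ∷ g₀ ∷ []) ∷ (g₃ ∷ g₂ ∷ g₁ ∷ []) ∷ (g₄ ∷ g₃ ∷ g₂ ∷ []) ∷ (0# ∷ g₄ ∷ g₃ ∷ []) ∷ (0# ∷ 0# ∷ g₄ ∷ []) ∷ []

  quartic : Vec K 5 → K → K
  quartic (g₀ ∷ g₁ ∷ g₂ ∷ g₃ ∷ g₄ ∷ []) θ = g₀ + θ * (g₁ + θ * (g₂ + θ * (g₃ + θ * g₄)))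

  product-comm : ∀ v w → product v w ≡ product w v
  product-comm (v₀ ∷ v₁ ∷ v₂ ∷ []) (w₀ ∷ w₁ ∷ w₂ ∷ []) = cong₂ _∷_ (*-comm v₀ w₀) (cong₂ _∷_ (two v₀ v₁ w₀ w₁)
      (cong₂ _∷_ (solve 6 (λ v₀ v₁ v₂ w₀ w₁ w₂ → v₀ :* w₂ :+ v₁ :* w₁ :+ v₂ :* w₀ := w₀ :* v₂ :+ w₁ :* v₁ :+ w₂ :* v₀) refl v₀ v₁ v₂ w₀ w₁ w₂)
        (cong₂ _∷_ (two v₁ v₂ w₁ w₂) (cong (_∷ []) (*-comm v₂ w₂)))))
    where
    two : ∀ a b c d → a * d + b * c ≡ c * b + d * a
    two = solve 4 (λ a b c d → a :* d :+ b :* c := c :* b :+ d :* a) refl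

  frob-product : ∀ v w → frob (product v w) ≡ product (frob v) (frob w)
  frob-product (v₀ ∷ v₁ ∷ v₂ ∷ []) (w₀ ∷ w₁ ∷ w₂ ∷ []) = cong₂ _∷_ (φ-* v₀ w₀) (cong₂ _∷_ (two v₀ w₁ v₁ w₀)
      (cong₂ _∷_ (trans (φ-+ (v₀ * w₂ + v₁ * w₁) (v₂ * w₀)) (cong₂ _+_ (two v₀ w₂ v₁ w₁) (φ-* v₂ w₀)))
        (cong₂ _∷_ (two v₁ w₂ v₂ w₁) (cong (_∷ []) (φ-* v₂ w₂)))))
    where
    two : ∀ a b c d → φ (a * b + c * d) ≡ φ a * φ b + φ c * φ d
    two a b c d = trans (φ-+ (a * b) (c * d)) (cong₂ _+_ (φ-* a b) (φ-* c d))

  frob-shifts : ∀ g → map frob (shifts g) ≡ shifts (frob g)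
  frob-shifts (g₀ ∷ g₁ ∷ g₂ ∷ g₃ ∷ g₄ ∷ []) rewrite φ-0 = refl

  quartic-product : ∀ v w θ → quartic (product v w) θ ≡ (v ∙ pt θ) * (w ∙ pt θ)
  quartic-product (v₀ ∷ v₁ ∷ v₂ ∷ []) (w₀ ∷ w₁ ∷ w₂ ∷ []) θ = solve 7 (λ v₀ v₁ v₂ w₀ w₁ w₂ θ →
    v₀ :* w₀ :+ θ :* ((v₀ :* w₁ :+ v₁ :* w₀) :+ θ :* ((v₀ :* w₂ :+ v₁ :* w₁ :+ v₂ :* w₀) :+ θ :* ((v₁ :* w₂ :+ v₂ :* w₁) :+ θ :* (v₂ :* w₂))))
    := (v₀ :* 𝟙 :+ (v₁ :* θ :+ (v₂ :* (θ :* θ) :+ 𝟘))) :* (w₀ :* 𝟙 :+ (w₁ :* θ :+ (w₂ :* (θ :* θ) :+ 𝟘)))) refl v₀ v₁ v₂ w₀ w₁ w₂ θ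

  lincomb-monomials : ∀ g θ → lincomb (monomials θ 6) (shifts g) ≡ quartic g θ ·ᵛ pt θ
  lincomb-monomials (g₀ ∷ g₁ ∷ g₂ ∷ g₃ ∷ g₄ ∷ []) θ = cong₂ _∷_
    (solve 6 (λ θ g₀ g₁ g₂ g₃ g₄ →
      𝟙 :* g₀ :+ ((θ :* 𝟙) :* g₁ :+ ((θ :* (θ :* 𝟙)) :* g₂ :+ ((θ :* (θ :* (θ :* 𝟙))) :* g₃ :+ ((θ :* (θ :* (θ :* (θ :* 𝟙)))) :* g₄ :+ ((θ :* (θ :* (θ :* (θ :* (θ :* 𝟙))))) :* 𝟘 :+ ((θ :* (θ :* (θ :* (θ :* (θ :* (θ :* 𝟙)))))) :* 𝟘 :+ 𝟘))))))
      := (g₀ :+ θ :* (g₁ :+ θ :* (g₂ :+ θ :* (g₃ :+ θ :* g₄)))) :* 𝟙) refl θ g₀ g₁ g₂ g₃ g₄)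
    (cong₂ _∷_
    (solve 6 (λ θ g₀ g₁ g₂ g₃ g₄ →
      𝟙 :* 𝟘 :+ ((θ :* 𝟙) :* g₀ :+ ((θ :* (θ :* 𝟙)) :* g₁ :+ ((θ :* (θ :* (θ :* 𝟙))) :* g₂ :+ ((θ :* (θ :* (θ :* (θ :* 𝟙)))) :* g₃ :+ ((θ :* (θ :* (θ :* (θ :* (θ :* 𝟙))))) :* g₄ :+ ((θ :* (θ :* (θ :* (θ :* (θ :* (θ :* 𝟙)))))) :* 𝟘 :+ 𝟘))))))
      := (g₀ :+ θ :* (g₁ :+ θ :* (g₂ :+ θ :* (g₃ :+ θ :* g₄)))) :* θ) refl θ g₀ g₁ g₂ g₃ g₄)
    (cong (_∷ [])
    (solve 6 (λ θ g₀ g₁ g₂ g₃ g₄ →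
      𝟙 :* 𝟘 :+ ((θ :* 𝟙) :* 𝟘 :+ ((θ :* (θ :* 𝟙)) :* g₀ :+ ((θ :* (θ :* (θ :* 𝟙))) :* g₁ :+ ((θ :* (θ :* (θ :* (θ :* 𝟙)))) :* g₂ :+ ((θ :* (θ :* (θ :* (θ :* (θ :* 𝟙))))) :* g₃ :+ ((θ :* (θ :* (θ :* (θ :* (θ :* (θ :* 𝟙)))))) :* g₄ :+ 𝟘))))))
      := (g₀ :+ θ :* (g₁ :+ θ :* (g₂ :+ θ :* (g₃ :+ θ :* g₄)))) :* (θ :* θ)) refl θ g₀ g₁ g₂ g₃ g₄)))

  leading : Vec K 5 → K
  leading (g₀ ∷ g₁ ∷ g₂ ∷ g₃ ∷ g₄ ∷ []) = g₄

  leading-product : ∀ v w → leading (product v w) ≡ (v ∙ e₂) * (w ∙ e₂)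
  leading-product (v₀ ∷ v₁ ∷ v₂ ∷ []) (w₀ ∷ w₁ ∷ w₂ ∷ []) = solve 6 (λ v₀ v₁ v₂ w₀ w₁ w₂ → v₂ :* w₂
    := (v₀ :* 𝟘 :+ (v₁ :* 𝟘 :+ (v₂ :* 𝟙 :+ 𝟘))) :* (w₀ :* 𝟘 :+ (w₁ :* 𝟘 :+ (w₂ :* 𝟙 :+ 𝟘)))) refl v₀ v₁ v₂ w₀ w₁ w₂

  lincomb-∞ : ∀ g → lincomb (∞-coefficients 6) (shifts g) ≡ leading g ·ᵛ e₂
  lincomb-∞ (g₀ ∷ g₁ ∷ g₂ ∷ g₃ ∷ g₄ ∷ []) = cong₂ _∷_ (solve 5 (λ g₀ g₁ g₂ g₃ g₄ → 𝟘 :* g₀ :+ (𝟘 :* g₁ :+ (𝟘 :* g₂ :+ (𝟘 :* g₃ :+ (𝟘 :* g₄ :+ (𝟘 :* 𝟘 :+ (𝟙 :* 𝟘 :+ 𝟘)))))) := g₄ :* 𝟘) refl g₀ g₁ g₂ g₃ g₄)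
    (cong₂ _∷_ (solve 5 (λ g₀ g₁ g₂ g₃ g₄ → 𝟘 :* 𝟘 :+ (𝟘 :* g₀ :+ (𝟘 :* g₁ :+ (𝟘 :* g₂ :+ (𝟘 :* g₃ :+ (𝟘 :* g₄ :+ (𝟙 :* 𝟘 :+ 𝟘)))))) := g₄ :* 𝟘) refl g₀ g₁ g₂ g₃ g₄)
    (cong (_∷ []) (solve 5 (λ g₀ g₁ g₂ g₃ g₄ → 𝟘 :* 𝟘 :+ (𝟘 :* 𝟘 :+ (𝟘 :* g₀ :+ (𝟘 :* g₁ :+ (𝟘 :* g₂ :+ (𝟘 :* g₃ :+ (𝟙 :* g₄ :+ 𝟘)))))) := g₄ :* 𝟙) refl g₀ g₁ g₂ g₃ g₄)))

  -- Both sides are the coefficients of the product of the three quadratics.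
  values-cyclic : ∀ u v w → map (u ∙_) (shifts (product v w)) ≡ map (v ∙_) (shifts (product w u))
  values-cyclic (u₀ ∷ u₁ ∷ u₂ ∷ []) (v₀ ∷ v₁ ∷ v₂ ∷ []) (w₀ ∷ w₁ ∷ w₂ ∷ []) =
    cong₂ _∷_ (solve 9 (λ u₀ u₁ u₂ v₀ v₁ v₂ w₀ w₁ w₂ → u₀ :* (v₀ :* w₀) :+ (u₁ :* 𝟘 :+ (u₂ :* 𝟘 :+ 𝟘))
      := v₀ :* (w₀ :* u₀) :+ (v₁ :* 𝟘 :+ (v₂ :* 𝟘 :+ 𝟘))) refl u₀ u₁ u₂ v₀ v₁ v₂ w₀ w₁ w₂)
    (cong₂ _∷_ (solve 9 (λ u₀ u₁ u₂ v₀ v₁ v₂ w₀ w₁ w₂ → u₀ :* (v₀ :* w₁ :+ v₁ :* w₀) :+ (u₁ :* (v₀ :* w₀) :+ (u₂ :* 𝟘 :+ 𝟘))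
      := v₀ :* (w₀ :* u₁ :+ w₁ :* u₀) :+ (v₁ :* (w₀ :* u₀) :+ (v₂ :* 𝟘 :+ 𝟘))) refl u₀ u₁ u₂ v₀ v₁ v₂ w₀ w₁ w₂)
    (cong₂ _∷_ (solve 9 (λ u₀ u₁ u₂ v₀ v₁ v₂ w₀ w₁ w₂ → u₀ :* (v₀ :* w₂ :+ v₁ :* w₁ :+ v₂ :* w₀) :+ (u₁ :* (v₀ :* w₁ :+ v₁ :* w₀) :+ (u₂ :* (v₀ :* w₀) :+ 𝟘))
      := v₀ :* (w₀ :* u₂ :+ w₁ :* u₁ :+ w₂ :* u₀) :+ (v₁ :* (w₀ :* u₁ :+ w₁ :* u₀) :+ (v₂ :* (w₀ :* u₀) :+ 𝟘))) refl u₀ u₁ u₂ v₀ v₁ v₂ w₀ w₁ w₂)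
    (cong₂ _∷_ (solve 9 (λ u₀ u₁ u₂ v₀ v₁ v₂ w₀ w₁ w₂ → u₀ :* (v₁ :* w₂ :+ v₂ :* w₁) :+ (u₁ :* (v₀ :* w₂ :+ v₁ :* w₁ :+ v₂ :* w₀) :+ (u₂ :* (v₀ :* w₁ :+ v₁ :* w₀) :+ 𝟘))
      := v₀ :* (w₁ :* u₂ :+ w₂ :* u₁) :+ (v₁ :* (w₀ :* u₂ :+ w₁ :* u₁ :+ w₂ :* u₀) :+ (v₂ :* (w₀ :* u₁ :+ w₁ :* u₀) :+ 𝟘))) refl u₀ u₁ u₂ v₀ v₁ v₂ w₀ w₁ w₂)
    (cong₂ _∷_ (solve 9 (λ u₀ u₁ u₂ v₀ v₁ v₂ w₀ w₁ w₂ → u₀ :* (v₂ :* w₂) :+ (u₁ :* (v₁ :* w₂ :+ v₂ :* w₁) :+ (u₂ :* (v₀ :* w₂ :+ v₁ :* w₁ :+ v₂ :* w₀) :+ 𝟘))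
      := v₀ :* (w₂ :* u₂) :+ (v₁ :* (w₁ :* u₂ :+ w₂ :* u₁) :+ (v₂ :* (w₀ :* u₂ :+ w₁ :* u₁ :+ w₂ :* u₀) :+ 𝟘))) refl u₀ u₁ u₂ v₀ v₁ v₂ w₀ w₁ w₂)
    (cong₂ _∷_ (solve 9 (λ u₀ u₁ u₂ v₀ v₁ v₂ w₀ w₁ w₂ → u₀ :* 𝟘 :+ (u₁ :* (v₂ :* w₂) :+ (u₂ :* (v₁ :* w₂ :+ v₂ :* w₁) :+ 𝟘))
      := v₀ :* 𝟘 :+ (v₁ :* (w₂ :* u₂) :+ (v₂ :* (w₁ :* u₂ :+ w₂ :* u₁) :+ 𝟘))) refl u₀ u₁ u₂ v₀ v₁ v₂ w₀ w₁ w₂)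
    (cong (_∷ []) (solve 9 (λ u₀ u₁ u₂ v₀ v₁ v₂ w₀ w₁ w₂ → u₀ :* 𝟘 :+ (u₁ :* 𝟘 :+ (u₂ :* (v₂ :* w₂) :+ 𝟘))
      := v₀ :* 𝟘 :+ (v₁ :* 𝟘 :+ (v₂ :* (w₂ :* u₂) :+ 𝟘))) refl u₀ u₁ u₂ v₀ v₁ v₂ w₀ w₁ w₂)))))))

  lincomb-shifts : ∀ g c₀ c₁ c₂ c₃ c₄ c₅ c₆ → lincomb (c₀ ∷ c₁ ∷ c₂ ∷ c₃ ∷ c₄ ∷ c₅ ∷ c₆ ∷ []) (shifts g)
    ≡ g ∙ (c₀ ∷ c₁ ∷ c₂ ∷ c₃ ∷ c₄ ∷ []) ∷ g ∙ (c₁ ∷ c₂ ∷ c₃ ∷ c₄ ∷ c₅ ∷ []) ∷ g ∙ (c₂ ∷ c₃ ∷ c₄ ∷ c₅ ∷ c₆ ∷ []) ∷ []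
  lincomb-shifts (g₀ ∷ g₁ ∷ g₂ ∷ g₃ ∷ g₄ ∷ []) c₀ c₁ c₂ c₃ c₄ c₅ c₆ = cong₂ _∷_
    (solve 12 (λ g₀ g₁ g₂ g₃ g₄ c₀ c₁ c₂ c₃ c₄ c₅ c₆ → c₀ :* g₀ :+ (c₁ :* g₁ :+ (c₂ :* g₂ :+ (c₃ :* g₃ :+ (c₄ :* g₄ :+ (c₅ :* 𝟘 :+ (c₆ :* 𝟘 :+ 𝟘))))))
      := g₀ :* c₀ :+ (g₁ :* c₁ :+ (g₂ :* c₂ :+ (g₃ :* c₃ :+ (g₄ :* c₄ :+ 𝟘))))) refl g₀ g₁ g₂ g₃ g₄ c₀ c₁ c₂ c₃ c₄ c₅ c₆)
    (cong₂ _∷_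
    (solve 12 (λ g₀ g₁ g₂ g₃ g₄ c₀ c₁ c₂ c₃ c₄ c₅ c₆ → c₀ :* 𝟘 :+ (c₁ :* g₀ :+ (c₂ :* g₁ :+ (c₃ :* g₂ :+ (c₄ :* g₃ :+ (c₅ :* g₄ :+ (c₆ :* 𝟘 :+ 𝟘))))))
      := g₀ :* c₁ :+ (g₁ :* c₂ :+ (g₂ :* c₃ :+ (g₃ :* c₄ :+ (g₄ :* c₅ :+ 𝟘))))) refl g₀ g₁ g₂ g₃ g₄ c₀ c₁ c₂ c₃ c₄ c₅ c₆)
    (cong (_∷ [])
    (solve 12 (λ g₀ g₁ g₂ g₃ g₄ c₀ c₁ c₂ c₃ c₄ c₅ c₆ → c₀ :* 𝟘 :+ (c₁ :* 𝟘 :+ (c₂ :* g₀ :+ (c₃ :* g₁ :+ (c₄ :* g₂ :+ (c₅ :* g₃ :+ (c₆ :* g₄ :+ 𝟘))))))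
      := g₀ :* c₂ :+ (g₁ :* c₃ :+ (g₂ :* c₄ :+ (g₃ :* c₅ :+ (g₄ :* c₆ :+ 𝟘))))) refl g₀ g₁ g₂ g₃ g₄ c₀ c₁ c₂ c₃ c₄ c₅ c₆)))

  -- The Hankel matrix with entries c_(i+j), applied to u.
  row : Vec K 3 → Vec K 5 → Vec K 3
  row u (c₀ ∷ c₁ ∷ c₂ ∷ c₃ ∷ c₄ ∷ []) = u ∙ (c₀ ∷ c₁ ∷ c₂ ∷ []) ∷ u ∙ (c₁ ∷ c₂ ∷ c₃ ∷ []) ∷ u ∙ (c₂ ∷ c₃ ∷ c₄ ∷ []) ∷ []

  -- As a bilinear form on polynomials, a Hankel matrix depends only on their product.
  ∙-row : ∀ u v c → v ∙ row u c ≡ product u v ∙ c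
  ∙-row (u₀ ∷ u₁ ∷ u₂ ∷ []) (v₀ ∷ v₁ ∷ v₂ ∷ []) (c₀ ∷ c₁ ∷ c₂ ∷ c₃ ∷ c₄ ∷ []) = solve 11 (λ u₀ u₁ u₂ v₀ v₁ v₂ c₀ c₁ c₂ c₃ c₄ →
      v₀ :* (u₀ :* c₀ :+ (u₁ :* c₁ :+ (u₂ :* c₂ :+ 𝟘))) :+ (v₁ :* (u₀ :* c₁ :+ (u₁ :* c₂ :+ (u₂ :* c₃ :+ 𝟘))) :+ (v₂ :* (u₀ :* c₂ :+ (u₁ :* c₃ :+ (u₂ :* c₄ :+ 𝟘))) :+ 𝟘))
      := (u₀ :* v₀) :* c₀ :+ ((u₀ :* v₁ :+ u₁ :* v₀) :* c₁ :+ ((u₀ :* v₂ :+ u₁ :* v₁ :+ u₂ :* v₀) :* c₂ :+ ((u₁ :* v₂ :+ u₂ :* v₁) :* c₃ :+ ((u₂ :* v₂) :* c₄ :+ 𝟘))))) refl u₀ u₁ u₂ v₀ v₁ v₂ c₀ c₁ c₂ c₃ c₄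

  -- Proportional rows of a Hankel matrix are multiples of a point of the parabola.
  hankel-rank-one : ∀ {p₀ p₁ p₂ d₀ d₁ d₂ d₃ d₄ h₀ h₁ h₂} → p₁ * p₁ ≢ p₀ * p₂ →
    d₀ ∷ d₁ ∷ d₂ ∷ [] ≡ h₀ ·ᵛ (p₀ ∷ p₁ ∷ p₂ ∷ []) → d₁ ∷ d₂ ∷ d₃ ∷ [] ≡ h₁ ·ᵛ (p₀ ∷ p₁ ∷ p₂ ∷ []) → d₂ ∷ d₃ ∷ d₄ ∷ [] ≡ h₂ ·ᵛ (p₀ ∷ p₁ ∷ p₂ ∷ []) →
    h₀ ≡ 0# × h₁ ≡ 0# × h₂ ≡ 0#
  hankel-rank-one {p₀} {p₁} {p₂} {h₀ = h₀} {h₁} {h₂} Δ≢0 r₀ r₁ r₂ = zero-of (first p₀ p₁ p₂ h₀ h₁ e₀₁ e₀₂) ,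
    zero-of (second p₀ p₁ p₂ h₀ h₁ e₀₁ e₀₂) , zero-of (third p₀ p₁ p₂ h₁ h₂ e₁₂ e₂₀)
    where
    Δ = p₁ * p₁ + - (p₀ * p₂)
    zero-of : ∀ {h} → Δ * h ≡ 0# → h ≡ 0#
    zero-of = x*y≡0⇒y≡0 {x = Δ} (Δ≢0 ∘ difference⇒≡)
    -- Consecutive rows share two entries; equating their two expressions gives this equation and
    -- the next three.
    e₀₁ : h₀ * p₁ ≡ h₁ * p₀
    e₀₁ = trans (sym (∷-injectiveˡ (∷-injectiveʳ r₀))) (∷-injectiveˡ r₁)
    e₀₂ : h₀ * p₂ ≡ h₁ * p₁
    e₀₂ = trans (sym (∷-injectiveˡ (∷-injectiveʳ (∷-injectiveʳ r₀)))) (∷-injectiveˡ (∷-injectiveʳ r₁))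
    e₁₂ : h₁ * p₁ ≡ h₂ * p₀
    e₁₂ = trans (sym (∷-injectiveˡ (∷-injectiveʳ r₁))) (∷-injectiveˡ r₂)
    e₂₀ : h₁ * p₂ ≡ h₂ * p₁
    e₂₀ = trans (sym (∷-injectiveˡ (∷-injectiveʳ (∷-injectiveʳ r₁)))) (∷-injectiveˡ (∷-injectiveʳ r₂))
    first : ∀ p₀ p₁ p₂ h₀ h₁ → h₀ * p₁ ≡ h₁ * p₀ → h₀ * p₂ ≡ h₁ * p₁ → (p₁ * p₁ + - (p₀ * p₂)) * h₀ ≡ 0#
    first p₀ p₁ p₂ h₀ h₁ e f = combine (p₁ ⟪ e ⟫ - p₀ ⟪ f ⟫ done)
      (solve 5 (λ p₀ p₁ p₂ h₀ h₁ → (p₁ :* p₁ :- p₀ :* p₂) :* h₀ := 𝟘 :+ (p₁ :* (h₀ :* p₁ :- h₁ :* p₀) :+ ((:- p₀) :* (h₀ :* p₂ :- h₁ :* p₁) :+ 𝟘))) refl p₀ p₁ p₂ h₀ h₁)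
    second : ∀ p₀ p₁ p₂ h₀ h₁ → h₀ * p₁ ≡ h₁ * p₀ → h₀ * p₂ ≡ h₁ * p₁ → (p₁ * p₁ + - (p₀ * p₂)) * h₁ ≡ 0#
    second p₀ p₁ p₂ h₀ h₁ e f = combine (p₂ ⟪ e ⟫ - p₁ ⟪ f ⟫ done)
      (solve 5 (λ p₀ p₁ p₂ h₀ h₁ → (p₁ :* p₁ :- p₀ :* p₂) :* h₁ := 𝟘 :+ (p₂ :* (h₀ :* p₁ :- h₁ :* p₀) :+ ((:- p₁) :* (h₀ :* p₂ :- h₁ :* p₁) :+ 𝟘))) refl p₀ p₁ p₂ h₀ h₁)
    third : ∀ p₀ p₁ p₂ h₁ h₂ → h₁ * p₁ ≡ h₂ * p₀ → h₁ * p₂ ≡ h₂ * p₁ → (p₁ * p₁ + - (p₀ * p₂)) * h₂ ≡ 0#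
    third p₀ p₁ p₂ h₁ h₂ e f = combine (p₂ ⟪ e ⟫ - p₁ ⟪ f ⟫ done)
      (solve 5 (λ p₀ p₁ p₂ h₁ h₂ → (p₁ :* p₁ :- p₀ :* p₂) :* h₂ := 𝟘 :+ (p₂ :* (h₁ :* p₁ :- h₂ :* p₀) :+ ((:- p₁) :* (h₁ :* p₂ :- h₂ :* p₁) :+ 𝟘))) refl p₀ p₁ p₂ h₁ h₂)

  frob-pt : ∀ θ → frob (pt θ) ≡ pt (φ θ)
  frob-pt θ = cong₂ (λ x y → x ∷ φ θ ∷ y ∷ []) φ-1 (φ-* θ θ)

  -- Vieta's relations, in a form that stays valid when the leading coefficient vanishes.
  two-roots : ∀ {w₀ w₁ w₂ r s} → r ≢ s → (w₀ ∷ w₁ ∷ w₂ ∷ []) ∙ pt r ≡ 0# → (w₀ ∷ w₁ ∷ w₂ ∷ []) ∙ pt s ≡ 0# →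
    w₁ ≡ - (w₂ * (r + s)) × w₀ ≡ w₂ * (r * s)
  two-roots {w₀} {w₁} {w₂} {r} {s} r≢s e f = w₁≡ , w₀≡
    where
    slope : w₁ + w₂ * (r + s) ≡ 0#
    slope = x*y≡0⇒y≡0 {x = r + - s} (r≢s ∘ difference⇒≡) (combine (1# ⟪ e ⟫ - 1# ⟪ f ⟫ done)
      (solve 5 (λ w₀ w₁ w₂ r s → (r :- s) :* (w₁ :+ w₂ :* (r :+ s)) :=
        𝟘 :+ (𝟙 :* ((w₀ :* 𝟙 :+ (w₁ :* r :+ (w₂ :* (r :* r) :+ 𝟘))) :- 𝟘) :+ ((:- 𝟙) :* ((w₀ :* 𝟙 :+ (w₁ :* s :+ (w₂ :* (s :* s) :+ 𝟘))) :- 𝟘) :+ 𝟘))) refl w₀ w₁ w₂ r s))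
    w₁≡ : w₁ ≡ - (w₂ * (r + s))
    w₁≡ = combine (1# ⟪ slope ⟫ done)
      (solve 4 (λ w₁ w₂ r s → w₁ := :- (w₂ :* (r :+ s)) :+ (𝟙 :* ((w₁ :+ w₂ :* (r :+ s)) :- 𝟘) :+ 𝟘)) refl w₁ w₂ r s)
    w₀≡ : w₀ ≡ w₂ * (r * s)
    w₀≡ = combine (1# ⟪ e ⟫ - r ⟪ slope ⟫ done)
      (solve 5 (λ w₀ w₁ w₂ r s → w₀ := w₂ :* (r :* s) :+ (𝟙 :* ((w₀ :* 𝟙 :+ (w₁ :* r :+ (w₂ :* (r :* r) :+ 𝟘))) :- 𝟘)
        :+ ((:- r) :* ((w₁ :+ w₂ :* (r :+ s)) :- 𝟘) :+ 𝟘))) refl w₀ w₁ w₂ r s)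

  factored : ∀ (w : Vec K 3) {r s} → r ≢ s → w ∙ pt r ≡ 0# → w ∙ pt s ≡ 0# → ∀ θ → w ∙ pt θ ≡ (w ∙ e₂) * ((θ + - r) * (θ + - s))
  factored (w₀ ∷ w₁ ∷ w₂ ∷ []) {r} {s} r≢s e f θ = lemma w₂ r s θ (proj₂ (two-roots r≢s e f)) (proj₁ (two-roots r≢s e f))
    where
    lemma : ∀ {w₀ w₁} w₂ r s θ → w₀ ≡ w₂ * (r * s) → w₁ ≡ - (w₂ * (r + s)) →
      w₀ * 1# + (w₁ * θ + (w₂ * (θ * θ) + 0#)) ≡ (w₀ * 0# + (w₁ * 0# + (w₂ * 1# + 0#))) * ((θ + - r) * (θ + - s))
    lemma w₂ r s θ refl refl = solve 4 (λ w₂ r s θ → w₂ :* (r :* s) :* 𝟙 :+ ((:- (w₂ :* (r :+ s))) :* θ :+ (w₂ :* (θ :* θ) :+ 𝟘))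
      := (w₂ :* (r :* s) :* 𝟘 :+ ((:- (w₂ :* (r :+ s))) :* 𝟘 :+ (w₂ :* 𝟙 :+ 𝟘))) :* ((θ :- r) :* (θ :- s))) refl w₂ r s θ

  -- The coefficient vectors of e (θ - t)(1, θ, θ²).
  cubic : K → K → Vec (Vec K 3) 4
  cubic e t = (e * - t ∷ 0# ∷ 0# ∷ []) ∷ (e ∷ e * - t ∷ 0# ∷ []) ∷ (0# ∷ e ∷ e * - t ∷ []) ∷ (0# ∷ 0# ∷ e ∷ []) ∷ []

  frob-cubic : ∀ e t → map frob (cubic e t) ≡ cubic (φ e) (φ t)
  frob-cubic e t rewrite φ-0 | φ-* e (- t) | φ-neg t = refl

  lincomb-cubic : ∀ e t c₀ c₁ c₂ c₃ → lincomb (c₀ ∷ c₁ ∷ c₂ ∷ c₃ ∷ []) (cubic e t)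
    ≡ e * (c₁ + - (t * c₀)) ∷ e * (c₂ + - (t * c₁)) ∷ e * (c₃ + - (t * c₂)) ∷ []
  lincomb-cubic e t c₀ c₁ c₂ c₃ = cong₂ _∷_
    (solve 6 (λ e t c₀ c₁ c₂ c₃ → c₀ :* (e :* (:- t)) :+ (c₁ :* e :+ (c₂ :* 𝟘 :+ (c₃ :* 𝟘 :+ 𝟘))) := e :* (c₁ :- t :* c₀)) refl e t c₀ c₁ c₂ c₃)
    (cong₂ _∷_
    (solve 6 (λ e t c₀ c₁ c₂ c₃ → c₀ :* 𝟘 :+ (c₁ :* (e :* (:- t)) :+ (c₂ :* e :+ (c₃ :* 𝟘 :+ 𝟘))) := e :* (c₂ :- t :* c₁)) refl e t c₀ c₁ c₂ c₃)
    (cong (_∷ [])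
    (solve 6 (λ e t c₀ c₁ c₂ c₃ → c₀ :* 𝟘 :+ (c₁ :* 𝟘 :+ (c₂ :* (e :* (:- t)) :+ (c₃ :* e :+ 𝟘))) := e :* (c₃ :- t :* c₂)) refl e t c₀ c₁ c₂ c₃)))

  cubic-monomials : ∀ e t θ → lincomb (monomials θ 3) (cubic e t) ≡ (e * (θ + - t)) ·ᵛ pt θ
  cubic-monomials e t θ = trans (lincomb-cubic e t 1# (θ * 1#) (θ * (θ * 1#)) (θ * (θ * (θ * 1#)))) (cong₂ _∷_
    (solve 3 (λ e t θ → e :* (θ :* 𝟙 :- t :* 𝟙) := e :* (θ :- t) :* 𝟙) refl e t θ)
    (cong₂ _∷_
    (solve 3 (λ e t θ → e :* (θ :* (θ :* 𝟙) :- t :* (θ :* 𝟙)) := e :* (θ :- t) :* θ) refl e t θ)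
    (cong (_∷ [])
    (solve 3 (λ e t θ → e :* (θ :* (θ :* (θ :* 𝟙)) :- t :* (θ :* (θ :* 𝟙))) := e :* (θ :- t) :* (θ :* θ)) refl e t θ))))

  cubic-∞ : ∀ e t → lincomb (∞-coefficients 3) (cubic e t) ≡ e ·ᵛ e₂
  cubic-∞ e t = trans (lincomb-cubic e t 0# 0# 0# 1#) (cong₂ _∷_ (low e t) (cong₂ _∷_ (low e t) (cong (_∷ [])
    (solve 2 (λ e t → e :* (𝟙 :- t :* 𝟘) := e :* 𝟙) refl e t))))
    where
    low : ∀ e t → e * (0# + - (t * 0#)) ≡ e * 0#
    low = solve 2 (λ e t → e :* (𝟘 :- t :* 𝟘) := e :* 𝟘) refl

  -- Pairing the quadratic w, with roots r and s, with e (θ - t)(1, θ, θ²) multiplies the two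
  -- polynomials. As e inverts the leading coefficient of w, the result is the monic cubic with
  -- roots t, r and s.
  cubic-values : ∀ (w : Vec K 3) {e t r s} → r ≢ s → w ∙ pt r ≡ 0# → w ∙ pt s ≡ 0# → (w ∙ e₂) * e ≡ 1# →
    map (w ∙_) (cubic e t) ≡ - (t * (r * s)) ∷ t * r + t * s + r * s ∷ - (t + r + s) ∷ 1# ∷ []
  cubic-values (w₀ ∷ w₁ ∷ w₂ ∷ []) {e} {t} {r} {s} r≢s h₁ h₂ h₃ =
    lemma w₂ e t r s (proj₂ (two-roots r≢s h₁ h₂)) (proj₁ (two-roots r≢s h₁ h₂))
      (trans (solve 4 (λ w₀ w₁ w₂ e → w₂ :* e := (w₀ :* 𝟘 :+ (w₁ :* 𝟘 :+ (w₂ :* 𝟙 :+ 𝟘))) :* e) refl w₀ w₁ w₂ e) h₃)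
    where
    lemma : ∀ {w₀ w₁} w₂ e t r s → w₀ ≡ w₂ * (r * s) → w₁ ≡ - (w₂ * (r + s)) → w₂ * e ≡ 1# →
      map ((w₀ ∷ w₁ ∷ w₂ ∷ []) ∙_) (cubic e t) ≡ - (t * (r * s)) ∷ t * r + t * s + r * s ∷ - (t + r + s) ∷ 1# ∷ []
    lemma w₂ e t r s refl refl h = cong₂ _∷_
      (combine (- (t * (r * s)) ⟪ h ⟫ done) (solve 5 (λ w e t r s →
        w :* (r :* s) :* (e :* (:- t)) :+ ((:- (w :* (r :+ s))) :* 𝟘 :+ (w :* 𝟘 :+ 𝟘)) := :- (t :* (r :* s)) :+ ((:- (t :* (r :* s))) :* (w :* e :- 𝟙) :+ 𝟘)) refl w₂ e t r s))
      (cong₂ _∷_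
      (combine ((t * r + t * s + r * s) ⟪ h ⟫ done) (solve 5 (λ w e t r s →
        w :* (r :* s) :* e :+ ((:- (w :* (r :+ s))) :* (e :* (:- t)) :+ (w :* 𝟘 :+ 𝟘)) := t :* r :+ t :* s :+ r :* s :+ ((t :* r :+ t :* s :+ r :* s) :* (w :* e :- 𝟙) :+ 𝟘)) refl w₂ e t r s))
      (cong₂ _∷_
      (combine (- (t + r + s) ⟪ h ⟫ done) (solve 5 (λ w e t r s →
        w :* (r :* s) :* 𝟘 :+ ((:- (w :* (r :+ s))) :* e :+ (w :* (e :* (:- t)) :+ 𝟘)) := :- (t :+ r :+ s) :+ ((:- (t :+ r :+ s)) :* (w :* e :- 𝟙) :+ 𝟘)) refl w₂ e t r s))
      (cong (_∷ [])
      (combine (1# ⟪ h ⟫ done) (solve 4 (λ w e r s →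
        w :* (r :* s) :* 𝟘 :+ ((:- (w :* (r :+ s))) :* 𝟘 :+ (w :* e :+ 𝟘)) := 𝟙 :+ (𝟙 :* (w :* e :- 𝟙) :+ 𝟘)) refl w₂ e r s)))))

  -- `φ` permutes the three conjugates cyclically, so it fixes their elementary symmetric functions.
  symmetric-rational : ∀ t → All 𝔽q (- (t * (φ t * φ (φ t))) ∷ t * φ t + t * φ (φ t) + φ t * φ (φ t) ∷ - (t + φ t + φ (φ t)) ∷ 1# ∷ [])
  symmetric-rational t = third ∷ second ∷ first ∷ φ-1 ∷ []
    where
    rotate₃ : ∀ x y z → y * (z * x) ≡ x * (y * z)
    rotate₃ = solve 3 (λ x y z → y :* (z :* x) := x :* (y :* z)) refl
    rotate₂ : ∀ x y z → y * z + y * x + z * x ≡ x * y + x * z + y * z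
    rotate₂ = solve 3 (λ x y z → y :* z :+ y :* x :+ z :* x := x :* y :+ x :* z :+ y :* z) refl
    rotate₁ : ∀ x y z → y + z + x ≡ x + y + z
    rotate₁ = solve 3 (λ x y z → y :+ z :+ x := x :+ y :+ z) refl
    t₁ = φ t ; t₂ = φ (φ t)
    third : 𝔽q (- (t * (t₁ * t₂)))
    third = trans (φ-neg (t * (t₁ * t₂))) (cong -_ (trans (φ-* t (t₁ * t₂)) (trans (cong (t₁ *_) (trans (φ-* t₁ t₂) (cong (t₂ *_) (φ³ t)))) (rotate₃ t t₁ t₂))))
    second : 𝔽q (t * t₁ + t * t₂ + t₁ * t₂)
    second = trans (φ-+ (t * t₁ + t * t₂) (t₁ * t₂)) (trans (cong₂ _+_ (trans (φ-+ (t * t₁) (t * t₂)) (cong₂ _+_ (φ-* t t₁) (trans (φ-* t t₂) (cong (t₁ *_) (φ³ t)))))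
      (trans (φ-* t₁ t₂) (cong (t₂ *_) (φ³ t)))) (rotate₂ t t₁ t₂))
    first : 𝔽q (- (t + t₁ + t₂))
    first = trans (φ-neg (t + t₁ + t₂)) (cong -_ (trans (φ-+ (t + t₁) t₂) (trans (cong₂ _+_ (φ-+ t t₁) (φ³ t)) (rotate₁ t t₁ t₂))))

  scalar-zero : ∀ {m c} {v : Vec K m} → v ≢ 𝟎 → c ·ᵛ v ≡ 𝟎 → c ≡ 0#
  scalar-zero {c = c} v≢𝟎 e = case c ≟ 0# of λ where
    (yes z) → z
    (no nz) → contradiction (·ᵛ-≡𝟎 nz e) v≢𝟎

  -- The variety of the conic inside the 6-space

  module InVariety (bose : Bose) (M : Vec (Vec K 3) 3) (M-ind : LinIndep 𝔽q³ M) (ℓ∞ : Point 3)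
                   (exterior : ∀ x → All 𝔽q x → map (vec ℓ∞ ∙_) M ∙ x ≡ 0# → x ≡ 𝟎)
                   (Σ₆,q : Bose.AtInfinity.SixSpace bose ℓ∞)
                   {C C⁺ : PointSet 3} (C≐ : C ≐ curve 𝔽q 2 M) (C⁺≐ : C⁺ ≐ curve 𝔽q³ 2 M)
                   {B : Vec (Vec K 3) 3} {ε : K} (ε≢0 : ε ≢ 0#) (semilinear-M : ∀ y → semilinear B (lincomb y M) ≡ ε ·ᵛ lincomb (frob y) M)
                   {As : Vec (Form 9) 9} (variety : Bose.IsVarietyOf bose B C C⁺ As) where

    open Bose bose
    open AtInfinity ℓ∞
    open Coordinates bose M M-ind
    open InSixSpace bose M M-ind ℓ∞ exterior
    open Affine Σ₆,q hiding (as)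
    open SixSpace Σ₆,q
    open IsVarietyOf variety
    module N = Independent n n-independent

    T-lincomb : ∀ {k} {cs : Vec K k} → All 𝔽q cs → ∀ as → lincomb cs (map T as) ≡ T (lincomb cs as)
    T-lincomb [] [] = sym (trans (cong₂ (E 𝟎) frob-𝟎 (trans (cong frob frob-𝟎) frob-𝟎)) E-𝟎)
    T-lincomb {cs = c ∷ cs} (fc ∷ fcs) (a ∷ as) = trans (cong₂ _+ᵛ_ (sym (T-· a fc)) (T-lincomb fcs as)) (sym (T-+ (c ·ᵛ a) (lincomb cs as)))

    -- The first components produce the scalar k; the second components compare it with its
    -- conjugate.
    T-proportional : ∀ {a b} → a ≢ 𝟎 → T b ∼ T a → ∃[ k ] (𝔽q k × b ≡ k ·ᵛ a)
    T-proportional {a} {b} a≢𝟎 (k , k≢0 , e) = k , rational , b≡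
      where
      components : b ≡ k ·ᵛ a × frob b ≡ k ·ᵛ frob a × frob (frob b) ≡ k ·ᵛ frob (frob a)
      components = E-injective {b} {frob b} {frob (frob b)} {k ·ᵛ a} {k ·ᵛ frob a} {k ·ᵛ frob (frob a)}
        (trans e (E-· k a (frob a) (frob (frob a))))
      b≡ : b ≡ k ·ᵛ a
      b≡ = proj₁ components
      scalar : ∀ {m} {w : Vec K m} {x y} → w ≢ 𝟎 → x ·ᵛ w ≡ y ·ᵛ w → x ≡ y
      scalar {w = w} {x} {y} w≢𝟎 e = case (x + - y) ≟ 0# of λ where
        (yes z) → difference⇒≡ z
        (no nz) → contradiction (·ᵛ-≡𝟎 nz (trans (·ᵛ-distribʳ x (- y) w)
          (trans (cong (_+ᵛ (- y) ·ᵛ w) e) (trans (sym (·ᵛ-distribʳ y (- y) w)) (trans (cong (_·ᵛ w) (-‿inverseʳ y)) (·ᵛ-zeroˡ w)))))) w≢𝟎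
      rational : 𝔽q k
      rational = scalar (frob-nonzero a≢𝟎) (trans (sym (frob-· k a)) (trans (cong frob (sym b≡)) (proj₁ (proj₂ components))))

    data ConicVector : Vec K 3 → Set where
      affine  : ∀ {θ} → 𝔽q θ → ConicVector (pt θ)
      ∞-point : ConicVector e₂

    conic-vector-𝔽q : ∀ {y} → ConicVector y → All 𝔽q y
    conic-vector-𝔽q (affine fθ) = pt-𝔽q fθ
    conic-vector-𝔽q ∞-point = e₂-𝔽q

    conic-vector≢𝟎 : ∀ {y} → ConicVector y → y ≢ 𝟎
    conic-vector≢𝟎 (affine {θ} _) = pt≢𝟎 θ
    conic-vector≢𝟎 ∞-point = e₂≢𝟎

    n∙≢0 : ∀ {y} → ConicVector y → n ∙ y ≢ 0#
    n∙≢0 {y} cy = conic-vector≢𝟎 cy ∘ n-independent y (conic-vector-𝔽q cy)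

    nonzero-M : ∀ {y} → y ≢ 𝟎 → lincomb y M ≢ 𝟎
    nonzero-M {y} y≢𝟎 = y≢𝟎 ∘ LinIndep⇒kernel {vs = M} M-ind y

    on-C : ∀ {y} (cy : ConicVector y) → point (lincomb y M) (nonzero-M (conic-vector≢𝟎 cy)) ∈ C
    on-C (affine {θ} fθ) = proj₂ C≐ (curve-finite M {P = point (lincomb (pt θ) M) (nonzero-M (pt≢𝟎 θ))} θ fθ (∼-reflexive refl))
    on-C ∞-point = proj₂ C≐ (inj₂ (∼-reflexive refl))

    from-C : ∀ {X} → X ∈ C → ∃[ y ] (ConicVector y × vec X ∼ lincomb y M)
    from-C {X} X∈C = case curve-points M {P = X} (proj₁ C≐ X∈C) of λ where
      (inj₁ (θ , fθ , X∼)) → pt θ , affine fθ , X∼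
      (inj₂ X∼) → e₂ , ∞-point , X∼

    -- The spread presents the point as `T (s ·ᵛ y)`, the 6-space as `T a` with `n ∙ a` rational.
    -- The two vectors s y and a differ by a factor in GF(q), so the value of `n` at s y is rational
    -- too.
    𝒱⇒ : ∀ {P} → P ∈ 𝒱 As → ∃[ y ] ∃[ s ] (ConicVector y × vec P ∼ T (s ·ᵛ y) × 𝔽q (n ∙ (s ·ᵛ y)))
    𝒱⇒ {P} (P∈Zeros , P∈Σ₆) =
      let a , P∼Ta , fa = Σ₆⇒ {P} P∈Σ₆
          X , X∈C , P∈⟦X⟧ = proj₁ points {P} (P∈Zeros , T a , T-𝔽q a , P∼Ta)
          y , cy , X∼ = from-C {X} X∈C
          s , P∼ = spread-point {P} {y} {vec X} X∼ P∈⟦X⟧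
          k , fk , sy≡ = T-proportional {a} {s ·ᵛ y} (a≢𝟎 P∼Ta) (cancel P∼ P∼Ta)
      in y , s , cy , P∼ , subst 𝔽q (sym (trans (cong (n ∙_) sy≡) (∙-· n k a))) (𝔽q-* fk fa)
      where
      a≢𝟎 : ∀ {a} → vec P ∼ T a → a ≢ 𝟎
      a≢𝟎 (c , _ , e) refl = nonzero P (trans e (trans (cong (c ·ᵛ_) (sym (T-lincomb [] []))) (·ᵛ-zeroʳ c)))
      cancel : ∀ {u v w : Vec K 9} → u ∼ v → u ∼ w → v ∼ w
      cancel {u} {v} {w} (c , c≢0 , u≡) (d , d≢0 , u≡′) = c ⁻¹ * d , *-≢0 (⁻¹-≢0 c≢0) d≢0 ,
        trans (sym (·ᵛ-inverse v c≢0)) (trans (cong (c ⁻¹ ·ᵛ_) (trans (sym u≡) u≡′)) (·ᵛ-assoc (c ⁻¹) d w))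

    ⇒𝒱 : ∀ {P y s} → ConicVector y → vec P ∼ T (s ·ᵛ y) → 𝔽q (n ∙ (s ·ᵛ y)) → P ∈ 𝒱 As
    ⇒𝒱 {P} {y} {s} cy P∼ f = proj₁ (proj₂ points {P} (point (lincomb y M) (nonzero-M (conic-vector≢𝟎 cy)) , on-C cy , point-on-spread {P} s y P∼)) ,
      ⇒Σ₆ {P} {s ·ᵛ y} P∼ f

    -- Serves both cases: `as` holds the coefficients of a polynomial curve s(θ)(1, θ, θ²) on which
    -- `n` takes rational values, where s vanishes at no point of C.
    rational-normal-curve : ∀ r (as : Vec (Vec K 3) (suc r)) → All (λ a → 𝔽q (n ∙ a)) as → LinIndep 𝔽q (map T as) →
      (∀ θ → 𝔽q θ → ∃[ s ] (s ≢ 0# × lincomb (monomials θ r) as ≡ s ·ᵛ pt θ)) →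
      ∃[ s ] (s ≢ 0# × lincomb (∞-coefficients r) as ≡ s ·ᵛ e₂) →
      IsNRC 𝔽q r Σ₆ (𝒱 As)
    rational-normal-curve r as fas ind affine-points ∞-points = map T as , All.map⁺ (All.universal T-𝔽q as) , ind , (λ {P} → in-Σ₆ {P}) , (λ {P} → ⊆-curve {P}) , (λ {P} → curve-⊆ {P})
      where
      n∙lincomb : ∀ {cs} → All 𝔽q cs → 𝔽q (n ∙ lincomb cs as)
      n∙lincomb {cs} fcs = subst 𝔽q (sym (∙-lincomb n cs as)) (∙-𝔽q fcs (All.map⁺ fas))
      in-Σ₆ : SpanOver 𝔽q (map T as) ⊆ Σ₆
      in-Σ₆ {P} (cs , fcs , P∼) = ⇒Σ₆ {P} {lincomb cs as} (∼-≡ P∼ (T-lincomb fcs as)) (n∙lincomb fcs)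
      -- The curve and the variety pick multiples s y and s′ y of the same vector with rational n-value, so s and s′ differ by an element of F_q.
      parallel : ∀ {P y s s′ cs} → ConicVector y → vec P ∼ T (s ·ᵛ y) → 𝔽q (n ∙ (s ·ᵛ y)) →
        All 𝔽q cs → s′ ≢ 0# → lincomb cs as ≡ s′ ·ᵛ y → vec P ∼ lincomb cs (map T as)
      parallel {P} {y} {s} {s′} {cs} cy (d , d≢0 , P≡) fs fcs s′≢0 e = d * k , *-≢0 d≢0 k≢0 ,
          trans P≡ (trans (cong (λ z → d ·ᵛ T z) sy≡) (trans (cong (d ·ᵛ_) (T-· (s′ ·ᵛ y) fk)) (trans (·ᵛ-assoc d k (T (s′ ·ᵛ y)))
            (cong ((d * k) ·ᵛ_) (trans (cong T (sym e)) (sym (T-lincomb fcs as)))))))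
        where
        value≢0 : n ∙ (s′ ·ᵛ y) ≢ 0#
        value≢0 z = *-≢0 s′≢0 (n∙≢0 cy) (trans (sym (∙-· n s′ y)) z)
        k : K
        k = (n ∙ (s ·ᵛ y)) * (n ∙ (s′ ·ᵛ y)) ⁻¹
        fk : 𝔽q k
        fk = 𝔽q-* fs (𝔽q-⁻¹ value≢0 (subst (λ z → 𝔽q (n ∙ z)) e (n∙lincomb fcs)))
        s≡ : s ≡ k * s′
        s≡ = *-cancelˡ (n∙≢0 cy) (lemma (n ∙ y) s s′ (n ∙ (s ·ᵛ y)) (n ∙ (s′ ·ᵛ y)) ((n ∙ (s′ ·ᵛ y)) ⁻¹) (∙-· n s y) (∙-· n s′ y) (*-inverseʳ value≢0))
          where
          lemma : ∀ l s s′ u v i → u ≡ s * l → v ≡ s′ * l → v * i ≡ 1# → l * s ≡ l * (u * i * s′)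
          lemma l s s′ _ _ i refl refl h = combine (- (l * s) ⟪ h ⟫ done)
            (solve 4 (λ l s s′ i → l :* s := l :* (s :* l :* i :* s′) :+ ((:- (l :* s)) :* (s′ :* l :* i :- 𝟙) :+ 𝟘)) refl l s s′ i)
        sy≡ : s ·ᵛ y ≡ k ·ᵛ (s′ ·ᵛ y)
        sy≡ = trans (cong (_·ᵛ y) s≡) (sym (·ᵛ-assoc k s′ y))
        k≢0 : k ≢ 0#
        k≢0 k≡0 = nonzero P (trans P≡ (trans (cong (λ z → d ·ᵛ T z) (trans sy≡ (trans (cong (_·ᵛ (s′ ·ᵛ y)) k≡0) (·ᵛ-zeroˡ (s′ ·ᵛ y)))))
          (trans (cong (d ·ᵛ_) (sym (T-lincomb [] []))) (·ᵛ-zeroʳ d))))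
      ⊆-curve : 𝒱 As ⊆ curve 𝔽q r (map T as)
      ⊆-curve {P} P∈𝒱 = case 𝒱⇒ {P} P∈𝒱 of λ where
        (_ , s , affine {θ} fθ , P∼ , f) → let s′ , s′≢0 , e = affine-points θ fθ in inj₁ (θ , fθ , parallel {P} {s = s} (affine fθ) P∼ f (monomials-𝔽q r fθ) s′≢0 e)
        (_ , s , ∞-point , P∼ , f) → let s′ , s′≢0 , e = ∞-points in inj₂ (parallel {P} {s = s} ∞-point P∼ f (∞-coefficients-𝔽q r) s′≢0 e)
      curve-⊆ : curve 𝔽q r (map T as) ⊆ 𝒱 As
      curve-⊆ {P} (inj₁ (θ , fθ , P∼)) =
        let s , _ , e = affine-points θ fθ
        in ⇒𝒱 {P} {pt θ} {s} (affine fθ) (∼-≡ P∼ (trans (T-lincomb (monomials-𝔽q r fθ) as) (cong T e))) (subst (λ z → 𝔽q (n ∙ z)) e (n∙lincomb (monomials-𝔽q r fθ)))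
      curve-⊆ {P} (inj₂ P∼) =
        let s , _ , e = ∞-points
        in ⇒𝒱 {P} {e₂} {s} ∞-point (∼-≡ P∼ (trans (T-lincomb (∞-coefficients-𝔽q r) as) (cong T e))) (subst (λ z → 𝔽q (n ∙ z)) e (n∙lincomb (∞-coefficients-𝔽q r)))

    n′∙frob : ∀ y → n′ ∙ frob y ≡ φ (n ∙ y)
    n′∙frob y = sym (φ-∙ n y)
    n″∙frob : ∀ y → n″ ∙ frob y ≡ φ (n′ ∙ y)
    n″∙frob y = sym (φ-∙ n′ y)

    n′∙≢0 : ∀ {y} → ConicVector y → n′ ∙ y ≢ 0#
    n′∙≢0 {y} cy e = φ-≢0 (n∙≢0 cy) (trans (sym (n′∙frob y)) (trans (cong (n′ ∙_) (frob-fixed (conic-vector-𝔽q cy))) e))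
    n″∙≢0 : ∀ {y} → ConicVector y → n″ ∙ y ≢ 0#
    n″∙≢0 {y} cy e = φ-≢0 (n′∙≢0 cy) (trans (sym (n″∙frob y)) (trans (cong (n″ ∙_) (frob-fixed (conic-vector-𝔽q cy))) e))

    -- The vertex n′ ∙ p = n″ ∙ p = 0 of the triangle of conjugate lines at infinity decides between the two cases.
    p : Vec K 3
    p = proj₁ (N.moore-surjective (1# ∷ 0# ∷ 0# ∷ []))
    moore-p : N.moore p ≡ 1# ∷ 0# ∷ 0# ∷ []
    moore-p = proj₂ (N.moore-surjective (1# ∷ 0# ∷ 0# ∷ []))

    OnConic : Vec K 3 → Set
    OnConic (y₀ ∷ y₁ ∷ y₂ ∷ []) = y₁ * y₁ ≡ y₀ * y₂

    -- The generic case: a normal rational curve of degree 6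

    sextic : Vec (Vec K 3) 7
    sextic = shifts (product n′ n″)

    -- The values are the coefficients of L₀ L₁ L₂, whose factors Frobenius permutes cyclically.
    sextic-rational : All (λ a → 𝔽q (n ∙ a)) sextic
    sextic-rational = All.map⁻ (fixed⇒All (begin
        frob (map (n ∙_) sextic)                          ≡⟨ frob-values sextic ⟩
        map (n′ ∙_) (map frob sextic)                     ≡⟨ cong (map (n′ ∙_)) (trans (frob-shifts (product n′ n″)) (cong shifts (frob-product n′ n″))) ⟩
        map (n′ ∙_) (shifts (product n″ (frob n″)))       ≡⟨ cong (λ z → map (n′ ∙_) (shifts (product n″ z))) (frob³ n) ⟩
        map (n′ ∙_) (shifts (product n″ n))               ≡⟨ sym (values-cyclic n n′ n″) ⟩
        map (n ∙_) sextic                                 ∎))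
      where
      open ≡-Reasoning
      frob-values : ∀ {k} (as : Vec (Vec K 3) k) → frob (map (n ∙_) as) ≡ map (n′ ∙_) (map frob as)
      frob-values [] = refl
      frob-values (a ∷ as) = cong₂ _∷_ (φ-∙ n a) (frob-values as)

    -- A rational relation makes L₁ L₂, and by conjugation L₂ L₀ and L₀ L₁, vanish on each window of
    -- five consecutive coefficients. So `n′` and `n″` kill the Hankel product `row n c`, which is
    -- therefore a multiple of `p`, and for `p` off the conic the multiples are zero.
    sextic-independent : ¬ OnConic p → LinIndep 𝔽q (map T sextic)
    sextic-independent off (c₀ ∷ c₁ ∷ c₂ ∷ c₃ ∷ c₄ ∷ c₅ ∷ c₆ ∷ []) fcs@(f₀ ∷ f₁ ∷ f₂ ∷ f₃ ∷ f₄ ∷ f₅ ∷ f₆ ∷ []) e =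
        assemble window₀ window₁ window₂ window₃ window₄
      where
      cs : Vec K 7
      cs = c₀ ∷ c₁ ∷ c₂ ∷ c₃ ∷ c₄ ∷ c₅ ∷ c₆ ∷ []
      q₀ q₁ q₂ : Vec K 5
      q₀ = c₀ ∷ c₁ ∷ c₂ ∷ c₃ ∷ c₄ ∷ []
      q₁ = c₁ ∷ c₂ ∷ c₃ ∷ c₄ ∷ c₅ ∷ []
      q₂ = c₂ ∷ c₃ ∷ c₄ ∷ c₅ ∷ c₆ ∷ []
      vanishing : lincomb cs sextic ≡ 𝟎
      vanishing = proj₁ (E-kernel {lincomb cs sextic} {frob (lincomb cs sextic)} {frob (frob (lincomb cs sextic))} (trans (sym (T-lincomb fcs sextic)) e))
      equations : product n′ n″ ∙ q₀ ∷ product n′ n″ ∙ q₁ ∷ product n′ n″ ∙ q₂ ∷ [] ≡ 𝟎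
      equations = trans (sym (lincomb-shifts (product n′ n″) c₀ c₁ c₂ c₃ c₄ c₅ c₆)) vanishing
      proportional : ∀ c → All 𝔽q c → product n′ n″ ∙ c ≡ 0# → row n c ≡ (n ∙ row n c) ·ᵛ p
      proportional c fc e = N.moore-injective (begin
          N.moore (row n c)                   ≡⟨ cong₂ (λ x y → n ∙ row n c ∷ x ∷ y ∷ []) (trans (∙-row n n′ c) second) (trans (∙-row n n″ c) (trans (cong (_∙ c) (product-comm n n″)) first)) ⟩
          n ∙ row n c ∷ 0# ∷ 0# ∷ []          ≡⟨ cong₂ _∷_ (sym (*-identityʳ _)) (cong₂ (λ x y → x ∷ y ∷ []) (sym (zeroʳ _)) (sym (zeroʳ _))) ⟩
          (n ∙ row n c) ·ᵛ (1# ∷ 0# ∷ 0# ∷ [])   ≡⟨ cong ((n ∙ row n c) ·ᵛ_) (sym moore-p) ⟩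
          (n ∙ row n c) ·ᵛ N.moore p          ≡⟨ sym (homogeneous N.moore-linear (n ∙ row n c) p) ⟩
          N.moore ((n ∙ row n c) ·ᵛ p)        ∎)
        where
        open ≡-Reasoning
        conjugate : ∀ {g} → g ∙ c ≡ 0# → frob g ∙ c ≡ 0#
        conjugate {g} e = trans (cong (frob g ∙_) (sym (frob-fixed fc))) (trans (sym (φ-∙ g c)) (trans (cong φ e) φ-0))
        first : product n″ n ∙ c ≡ 0#
        first = trans (cong (_∙ c) (sym (trans (frob-product n′ n″) (cong (product n″) (frob³ n))))) (conjugate {product n′ n″} e)
        second : product n n′ ∙ c ≡ 0#
        second = trans (cong (_∙ c) (sym (trans (frob-product n″ n) (cong (λ z → product z n′) (frob³ n))))) (conjugate {product n″ n} first)
      row₀ : row n q₀ ≡ (n ∙ row n q₀) ·ᵛ p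
      row₀ = proportional q₀ (f₀ ∷ f₁ ∷ f₂ ∷ f₃ ∷ f₄ ∷ []) (∷-injectiveˡ equations)
      row₁ : row n q₁ ≡ (n ∙ row n q₁) ·ᵛ p
      row₁ = proportional q₁ (f₁ ∷ f₂ ∷ f₃ ∷ f₄ ∷ f₅ ∷ []) (∷-injectiveˡ (∷-injectiveʳ equations))
      row₂ : row n q₂ ≡ (n ∙ row n q₂) ·ᵛ p
      row₂ = proportional q₂ (f₂ ∷ f₃ ∷ f₄ ∷ f₅ ∷ f₆ ∷ []) (∷-injectiveˡ (∷-injectiveʳ (∷-injectiveʳ equations)))
      rank-one : ∀ p {d₀ d₁ d₂ d₃ d₄ h₀ h₁ h₂} → ¬ OnConic p → d₀ ∷ d₁ ∷ d₂ ∷ [] ≡ h₀ ·ᵛ p → d₁ ∷ d₂ ∷ d₃ ∷ [] ≡ h₁ ·ᵛ p → d₂ ∷ d₃ ∷ d₄ ∷ [] ≡ h₂ ·ᵛ p →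
        h₀ ≡ 0# × h₁ ≡ 0# × h₂ ≡ 0#
      rank-one (_ ∷ _ ∷ _ ∷ []) = hankel-rank-one
      multipliers : n ∙ row n q₀ ≡ 0# × n ∙ row n q₁ ≡ 0# × n ∙ row n q₂ ≡ 0#
      multipliers = rank-one p off row₀ row₁ row₂
      zero-row : ∀ {r : Vec K 3} {h} → r ≡ h ·ᵛ p → h ≡ 0# → r ≡ 𝟎
      zero-row r≡ refl = trans r≡ (·ᵛ-zeroˡ p)
      zero₀ = zero-row row₀ (proj₁ multipliers)
      zero₂ = zero-row row₂ (proj₂ (proj₂ multipliers))
      -- The entries of a vanishing row are `n` applied to three consecutive rational coefficients,
      -- and `n` is independent over GF(q).
      window₀ : c₀ ∷ c₁ ∷ c₂ ∷ [] ≡ 𝟎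
      window₀ = n-independent _ (f₀ ∷ f₁ ∷ f₂ ∷ []) (∷-injectiveˡ zero₀)
      window₁ : c₁ ∷ c₂ ∷ c₃ ∷ [] ≡ 𝟎
      window₁ = n-independent _ (f₁ ∷ f₂ ∷ f₃ ∷ []) (∷-injectiveˡ (∷-injectiveʳ zero₀))
      window₂ : c₂ ∷ c₃ ∷ c₄ ∷ [] ≡ 𝟎
      window₂ = n-independent _ (f₂ ∷ f₃ ∷ f₄ ∷ []) (∷-injectiveˡ zero₂)
      window₃ : c₃ ∷ c₄ ∷ c₅ ∷ [] ≡ 𝟎
      window₃ = n-independent _ (f₃ ∷ f₄ ∷ f₅ ∷ []) (∷-injectiveˡ (∷-injectiveʳ zero₂))
      window₄ : c₄ ∷ c₅ ∷ c₆ ∷ [] ≡ 𝟎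
      window₄ = n-independent _ (f₄ ∷ f₅ ∷ f₆ ∷ []) (∷-injectiveˡ (∷-injectiveʳ (∷-injectiveʳ zero₂)))
      assemble : c₀ ∷ c₁ ∷ c₂ ∷ [] ≡ 𝟎 → c₁ ∷ c₂ ∷ c₃ ∷ [] ≡ 𝟎 → c₂ ∷ c₃ ∷ c₄ ∷ [] ≡ 𝟎 → c₃ ∷ c₄ ∷ c₅ ∷ [] ≡ 𝟎 → c₄ ∷ c₅ ∷ c₆ ∷ [] ≡ 𝟎 → cs ≡ 𝟎
      assemble refl refl refl refl refl = refl

    generic-case : ¬ OnConic p → IsNRC 𝔽q 6 Σ₆ (𝒱 As)
    generic-case off = rational-normal-curve 6 sextic sextic-rational (sextic-independent off)
      (λ θ fθ → (n′ ∙ pt θ) * (n″ ∙ pt θ) , *-≢0 (n′∙≢0 (affine fθ)) (n″∙≢0 (affine fθ)) ,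
        trans (lincomb-monomials (product n′ n″) θ) (cong (_·ᵛ pt θ) (quartic-product n′ n″ θ)))
      ((n′ ∙ e₂) * (n″ ∙ e₂) , *-≢0 (n′∙≢0 ∞-point) (n″∙≢0 ∞-point) ,
        trans (lincomb-∞ (product n′ n″)) (cong (_·ᵛ e₂) (leading-product n′ n″)))

    -- The parameter is finite: `e₂` represents a point of the subplane, and `n′` does not vanish at
    -- such points.
    vertex : ∀ y → OnConic y → n ∙ y ≢ 0# → n′ ∙ y ≡ 0# → ∃[ t ] ∃[ a ] (a ≢ 0# × y ≡ a ·ᵛ pt t)
    vertex y@(y₀ ∷ y₁ ∷ y₂ ∷ []) on n∙y≢0 n′∙y≡0 = view (on-parabola y₀ y₁ y₂ on) n∙y≢0 n′∙y≡0
      where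
      view : ∀ {y} → OnParabola y → n ∙ y ≢ 0# → n′ ∙ y ≡ 0# → ∃[ t ] ∃[ a ] (a ≢ 0# × y ≡ a ·ᵛ pt t)
      view (finite {a} t a≢0) _ _ = t , a , a≢0 , refl
      view (infinite c) n≢0 n′≡0 = contradiction (x*y≡0⇒y≡0 c≢0 (trans (sym (∙-· n′ c e₂)) n′≡0)) (n′∙≢0 ∞-point)
        where
        c≢0 : c ≢ 0#
        c≢0 c≡0 = n≢0 (trans (∙-· n c e₂) (trans (cong (_* (n ∙ e₂)) c≡0) (zeroˡ (n ∙ e₂))))

    transversal-union : ∀ i {P} → P ∈ transversal i → P ∈ (g ∪ (conj g ∪ conj (conj g)))
    transversal-union zero = inj₁
    transversal-union (suc zero) = inj₂ ∘ inj₁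
    transversal-union (suc (suc zero)) = inj₂ ∘ inj₂

    T-line : ∀ {u v} (u≢𝟎 : u ≢ 𝟎) (v≢𝟎 : v ≢ 𝟎) → LinIndep 𝔽q³ {2} (u ∷ v ∷ []) → ∀ i j → i ≢ j →
      point u u≢𝟎 ∈ transversal i → point v v≢𝟎 ∈ transversal j → IsTLine ⟨ u ∷ v ∷ [] ⟩
    T-line {u} {v} u≢𝟎 v≢𝟎 ind i j i≢j u∈ v∈ = (u ∷ v ∷ [] , ind , (λ z → z) , (λ z → z)) , (λ {P} → at-infinity {P}) , i , j , i≢j ,
        (point u u≢𝟎 , (1# ∷ 0# ∷ [] , all-U _ , ∼-reflexive (sym (trans (cong₂ _+ᵛ_ (·ᵛ-identity u) (trans (cong (_+ᵛ 𝟎) (·ᵛ-zeroˡ v)) (+ᵛ-identityˡ 𝟎))) (+ᵛ-identityʳ u)))) , u∈) ,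
        (point v v≢𝟎 , (0# ∷ 1# ∷ [] , all-U _ , ∼-reflexive (sym (trans (cong₂ _+ᵛ_ (·ᵛ-zeroˡ u) (trans (cong (_+ᵛ 𝟎) (·ᵛ-identity v)) (+ᵛ-identityʳ v))) (+ᵛ-identityˡ v)))) , v∈)
      where
      at-infinity : ⟨ u ∷ v ∷ [] ⟩ ⊆ Σ∞⋆
      at-infinity {P} (cs , _ , d , _ , P≡) = 2 , point u u≢𝟎 ∷ point v v≢𝟎 ∷ [] , d ·ᵛ cs ,
        transversal-union i u∈ ∷ transversal-union j v∈ ∷ [] , trans P≡ (sym (lincomb-· d cs (u ∷ v ∷ [])))

    pair : ∀ s t a b c a′ b′ c′ → lincomb (s ∷ t ∷ []) (E a b c ∷ E a′ b′ c′ ∷ []) ≡ E (s ·ᵛ a +ᵛ t ·ᵛ a′) (s ·ᵛ b +ᵛ t ·ᵛ b′) (s ·ᵛ c +ᵛ t ·ᵛ c′)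
    pair s t a b c a′ b′ c′ = trans (cong₂ _+ᵛ_ (E-· s a b c) (trans (+ᵛ-identityʳ (t ·ᵛ E a′ b′ c′)) (E-· t a′ b′ c′))) (E-+ (s ·ᵛ a) (s ·ᵛ b) (s ·ᵛ c) (t ·ᵛ a′) (t ·ᵛ b′) (t ·ᵛ c′))

    left : ∀ s t (x : Vec K 3) → s ·ᵛ x +ᵛ t ·ᵛ 𝟎 ≡ s ·ᵛ x
    left s t x = trans (cong (s ·ᵛ x +ᵛ_) (·ᵛ-zeroʳ t)) (+ᵛ-identityʳ (s ·ᵛ x))
    right : ∀ s t (x : Vec K 3) → s ·ᵛ 𝟎 +ᵛ t ·ᵛ x ≡ t ·ᵛ x
    right s t x = trans (cong (_+ᵛ t ·ᵛ x) (·ᵛ-zeroʳ s)) (+ᵛ-identityˡ (t ·ᵛ x))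
    neither : ∀ s t → s ·ᵛ 𝟎 +ᵛ t ·ᵛ 𝟎 ≡ 𝟎 {3}
    neither s t = trans (right s t 𝟎) (·ᵛ-zeroʳ t)

    pair₁₂ : ∀ s t x → lincomb (s ∷ t ∷ []) (E x 𝟎 𝟎 ∷ E 𝟎 x 𝟎 ∷ []) ≡ E (s ·ᵛ x) (t ·ᵛ x) 𝟎
    pair₁₂ s t x = trans (pair s t x 𝟎 𝟎 𝟎 x 𝟎) (E-cong (left s t x) (right s t x) (neither s t))
    pair₁₃ : ∀ s t x → lincomb (s ∷ t ∷ []) (E x 𝟎 𝟎 ∷ E 𝟎 𝟎 x ∷ []) ≡ E (s ·ᵛ x) 𝟎 (t ·ᵛ x)
    pair₁₃ s t x = trans (pair s t x 𝟎 𝟎 𝟎 𝟎 x) (E-cong (left s t x) (neither s t) (right s t x))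
    pair₂₃ : ∀ s t x → lincomb (s ∷ t ∷ []) (E 𝟎 x 𝟎 ∷ E 𝟎 𝟎 x ∷ []) ≡ E 𝟎 (s ·ᵛ x) (t ·ᵛ x)
    pair₂₃ s t x = trans (pair s t 𝟎 x 𝟎 𝟎 𝟎 x) (E-cong (neither s t) (left s t x) (right s t x))

    E-kernel₁ : ∀ {a b c} → E a b c ≡ 𝟎 → a ≡ 𝟎
    E-kernel₁ {a} {b} {c} e = proj₁ (E-kernel {a} {b} {c} e)
    E-kernel₂ : ∀ {a b c} → E a b c ≡ 𝟎 → b ≡ 𝟎
    E-kernel₂ {a} {b} {c} e = proj₁ (proj₂ (E-kernel {a} {b} {c} e))
    E-kernel₃ : ∀ {a b c} → E a b c ≡ 𝟎 → c ≡ 𝟎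
    E-kernel₃ {a} {b} {c} e = proj₂ (proj₂ (E-kernel {a} {b} {c} e))

    from-C⁺ : ∀ {X} → X ∈ C⁺ → (∃[ θ ] vec X ∼ lincomb (pt θ) M) ⊎ vec X ∼ lincomb e₂ M
    from-C⁺ {X} X∈C⁺ = case curve-points M {P = X} (proj₁ C⁺≐ X∈C⁺) of λ where
      (inj₁ (θ , _ , X∼)) → inj₁ (θ , X∼)
      (inj₂ X∼) → inj₂ X∼

    on-C⁺ : ∀ θ → point (lincomb (pt θ) M) (nonzero-M (pt≢𝟎 θ)) ∈ C⁺
    on-C⁺ θ = proj₂ C⁺≐ (curve-finite M {P = point (lincomb (pt θ) M) (nonzero-M (pt≢𝟎 θ))} θ _ (∼-reflexive refl))
    e₂-on-C⁺ : point (lincomb e₂ M) (nonzero-M e₂≢𝟎) ∈ C⁺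
    e₂-on-C⁺ = proj₂ C⁺≐ (inj₂ (∼-reflexive refl))

    -- Since components are unique, the equations of the 6-space become conditions on the three
    -- multiples of y.
    𝒱⋆⇒ : ∀ {P y X} → vec X ∼ lincomb y M → P ∈ scrollPlane B (vec X) → P ∈ Σ₆⋆ →
      ∃[ s ] ∃[ t ] ∃[ u ] ∃[ k ] (vec P ≡ E (s ·ᵛ y) (t ·ᵛ y) (u ·ᵛ y) × s * (n ∙ y) ≡ k × t * (n′ ∙ y) ≡ k × u * (n″ ∙ y) ≡ k)
    𝒱⋆⇒ {P} {y} {X} X∼ P∈scroll P∈Σ₆⋆ =
      let s , t , u , P≡ = scroll-point ε≢0 semilinear-M {P} {y} {vec X} X∼ P∈scroll
          a , b , c , k , P≡′ , ea , eb , ec = Σ₆⋆⇒ {P} P∈Σ₆⋆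
          a≡ , b≡ , c≡ = E-injective {s ·ᵛ y} {t ·ᵛ y} {u ·ᵛ y} {a} {b} {c} (trans (sym P≡) P≡′)
      in s , t , u , k , P≡ , trans (sym (∙-· n s y)) (trans (cong (n ∙_) a≡) ea) ,
         trans (sym (∙-· n′ t y)) (trans (cong (n′ ∙_) b≡) eb) , trans (sym (∙-· n″ u y)) (trans (cong (n″ ∙_) c≡) ec)

    in-extension : ∀ {P} s t u θ → vec P ≡ E (s ·ᵛ pt θ) (t ·ᵛ pt θ) (u ·ᵛ pt θ) → P ∈ Zeros As
    in-extension {P} s t u θ P≡ = proj₂ extension {P} (point (lincomb (pt θ) M) (nonzero-M (pt≢𝟎 θ)) , on-C⁺ θ ,
      point-on-scroll ε≢0 semilinear-M {P} s t u (pt θ) P≡)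

    e₂-in-extension : ∀ {P} s t u → vec P ≡ E (s ·ᵛ e₂) (t ·ᵛ e₂) (u ·ᵛ e₂) → P ∈ Zeros As
    e₂-in-extension {P} s t u P≡ = proj₂ extension {P} (point (lincomb e₂ M) (nonzero-M e₂≢𝟎) , e₂-on-C⁺ ,
      point-on-scroll ε≢0 semilinear-M {P} s t u e₂ P≡)

    -- The special case: a twisted cubic and three T-lines

    module Special (t : K) (n∙t≢0 : n ∙ pt t ≢ 0#) (n′∙t : n′ ∙ pt t ≡ 0#) (n″∙t : n″ ∙ pt t ≡ 0#) where

      t₁ t₂ : K
      t₁ = φ t
      t₂ = φ t₁

      n∙t₁ : n ∙ pt t₁ ≡ 0#
      n∙t₁ = trans (cong (n ∙_) (sym (frob-pt t))) (trans (N.m∙frob (pt t)) (trans (cong φ n″∙t) φ-0))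
      n∙t₂ : n ∙ pt t₂ ≡ 0#
      n∙t₂ = trans (cong (n ∙_) (sym (trans (cong frob (frob-pt t)) (frob-pt t₁)))) (trans (N.m∙frob² (pt t)) (trans (cong (φ ∘ φ) n′∙t) (trans (cong φ φ-0) φ-0)))
      n′∙t₁≢0 : n′ ∙ pt t₁ ≢ 0#
      n′∙t₁≢0 e = φ-≢0 n∙t≢0 (trans (sym (n′∙frob (pt t))) (trans (cong (n′ ∙_) (frob-pt t)) e))
      n′∙t₂ : n′ ∙ pt t₂ ≡ 0#
      n′∙t₂ = trans (cong (n′ ∙_) (sym (frob-pt t₁))) (trans (n′∙frob (pt t₁)) (trans (cong φ n∙t₁) φ-0))
      n″∙t₁ : n″ ∙ pt t₁ ≡ 0#
      n″∙t₁ = trans (cong (n″ ∙_) (sym (frob-pt t))) (trans (n″∙frob (pt t)) (trans (cong φ n′∙t) φ-0))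
      n″∙t₂≢0 : n″ ∙ pt t₂ ≢ 0#
      n″∙t₂≢0 e = φ-≢0 n′∙t₁≢0 (trans (sym (n″∙frob (pt t₁))) (trans (cong (n″ ∙_) (frob-pt t₁)) e))

      t≢t₁ : t ≢ t₁
      t≢t₁ e = n∙t≢0 (trans (cong (λ z → n ∙ pt z) e) n∙t₁)
      t≢t₂ : t ≢ t₂
      t≢t₂ e = n∙t≢0 (trans (cong (λ z → n ∙ pt z) e) n∙t₂)
      t₁≢t₂ : t₁ ≢ t₂
      t₁≢t₂ e = n′∙t₁≢0 (trans (cong (λ z → n′ ∙ pt z) e) n′∙t₂)

      -- The inverses of the leading coefficients of L₀, L₁ and L₂.
      e e′ e″ : K
      e = (n ∙ e₂) ⁻¹
      e′ = φ e
      e″ = φ e′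

      n∙e₂*e : (n ∙ e₂) * e ≡ 1#
      n∙e₂*e = *-inverseʳ (n∙≢0 ∞-point)
      n′∙e₂*e′ : (n′ ∙ e₂) * e′ ≡ 1#
      n′∙e₂*e′ = trans (cong (_* e′) (trans (cong (n′ ∙_) (sym (frob-fixed e₂-𝔽q))) (n′∙frob e₂))) (trans (sym (φ-* (n ∙ e₂) e)) (trans (cong φ n∙e₂*e) φ-1))
      n″∙e₂*e″ : (n″ ∙ e₂) * e″ ≡ 1#
      n″∙e₂*e″ = trans (cong (_* e″) (trans (cong (n″ ∙_) (sym (frob-fixed e₂-𝔽q))) (n″∙frob e₂))) (trans (sym (φ-* (n′ ∙ e₂) e′)) (trans (cong φ n′∙e₂*e′) φ-1))

      e≢0 : e ≢ 0#
      e≢0 = ⁻¹-≢0 (n∙≢0 ∞-point)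

      -- L₁ L₂ is a multiple of (θ - t)² (θ - t₁)(θ - t₂). Dividing by the common factor (θ - t)(θ -
      -- t₁)(θ - t₂) and by all three leading coefficients leaves e (θ - t).
      as : Vec (Vec K 3) 4
      as = cubic e t

      as-rational : All (λ a → 𝔽q (n ∙ a)) as
      as-rational = All.map⁻ (subst (All 𝔽q) (sym (cubic-values n {e} {t} {t₁} {t₂} t₁≢t₂ n∙t₁ n∙t₂ n∙e₂*e)) (symmetric-rational t))

      expand : ∀ cs → lincomb cs (map T as) ≡ E (lincomb cs as) (lincomb cs (cubic e′ t₁)) (lincomb cs (cubic e″ t₂))
      expand cs = trans (lincomb-T cs as) (cong₂ (E (lincomb cs as)) (cong (lincomb cs) (frob-cubic e t))
        (cong (lincomb cs) (trans (map-∘ frob frob as) (trans (cong (map frob) (frob-cubic e t)) (frob-cubic e′ t₁)))))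

      -- The first component makes c₀, c₁, c₂, c₃ a geometric progression of ratio t, and the second
      -- one of ratio t₁ ≠ t. So c₀ = 0, and the others follow.
      independent-K : LinIndep 𝔽q³ (map T as)
      independent-K cs@(c₀ ∷ c₁ ∷ c₂ ∷ c₃ ∷ []) _ h = assemble c₀≡0 (step c₀≡0 (∷-injectiveˡ first)) (step c₁≡0 (∷-injectiveˡ (∷-injectiveʳ first))) (step c₂≡0 (∷-injectiveˡ (∷-injectiveʳ (∷-injectiveʳ first))))
        where
        relation : E (lincomb cs as) (lincomb cs (cubic e′ t₁)) (lincomb cs (cubic e″ t₂)) ≡ 𝟎
        relation = trans (sym (expand cs)) h
        first : e * (c₁ + - (t * c₀)) ∷ e * (c₂ + - (t * c₁)) ∷ e * (c₃ + - (t * c₂)) ∷ [] ≡ 𝟎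
        first = trans (sym (lincomb-cubic e t c₀ c₁ c₂ c₃)) (E-kernel₁ {lincomb cs as} {lincomb cs (cubic e′ t₁)} {lincomb cs (cubic e″ t₂)} relation)
        second : e′ * (c₁ + - (t₁ * c₀)) ∷ e′ * (c₂ + - (t₁ * c₁)) ∷ e′ * (c₃ + - (t₁ * c₂)) ∷ [] ≡ 𝟎
        second = trans (sym (lincomb-cubic e′ t₁ c₀ c₁ c₂ c₃)) (E-kernel₂ {lincomb cs as} {lincomb cs (cubic e′ t₁)} {lincomb cs (cubic e″ t₂)} relation)
        difference-zero : ∀ t t₁ c₀ c₁ → c₁ + - (t * c₀) ≡ 0# → c₁ + - (t₁ * c₀) ≡ 0# → (t + - t₁) * c₀ ≡ 0#
        difference-zero t t₁ c₀ c₁ h₁ h₂ = combine (- 1# ⟪ h₁ ⟫ 1# ⟪ h₂ ⟫ done)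
          (solve 4 (λ t t₁ c₀ c₁ → (t :- t₁) :* c₀ := 𝟘 :+ ((:- 𝟙) :* ((c₁ :- t :* c₀) :- 𝟘) :+ (𝟙 :* ((c₁ :- t₁ :* c₀) :- 𝟘) :+ 𝟘))) refl t t₁ c₀ c₁)
        c₀≡0 : c₀ ≡ 0#
        c₀≡0 = x*y≡0⇒y≡0 {x = t + - t₁} (t≢t₁ ∘ difference⇒≡) (difference-zero t t₁ c₀ c₁ (x*y≡0⇒y≡0 e≢0 (∷-injectiveˡ first)) (x*y≡0⇒y≡0 (φ-≢0 e≢0) (∷-injectiveˡ second)))
        step : ∀ {c d} → c ≡ 0# → e * (d + - (t * c)) ≡ 0# → d ≡ 0#
        step {d = d} refl h = trans (solve 2 (λ d t → d := d :- t :* 𝟘) refl d t) (x*y≡0⇒y≡0 e≢0 h)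
        c₁≡0 : c₁ ≡ 0#
        c₁≡0 = step c₀≡0 (∷-injectiveˡ first)
        c₂≡0 : c₂ ≡ 0#
        c₂≡0 = step c₁≡0 (∷-injectiveˡ (∷-injectiveʳ first))
        assemble : ∀ {c₀ c₁ c₂ c₃ : K} → c₀ ≡ 0# → c₁ ≡ 0# → c₂ ≡ 0# → c₃ ≡ 0# → c₀ ∷ c₁ ∷ c₂ ∷ c₃ ∷ [] ≡ 𝟎
        assemble refl refl refl refl = refl

      rational-curve : IsNRC 𝔽q 3 Σ₆ (𝒱 As)
      rational-curve = rational-normal-curve 3 as as-rational (λ cs _ → independent-K cs (all-U cs))
        -- A rational θ equal to t would give t = φ t.
        (λ θ fθ → e * (θ + - t) , *-≢0 e≢0 (λ z → t≢t₁ (sym (subst 𝔽q (difference⇒≡ z) fθ))) , cubic-monomials e t θ)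
        (e , e≢0 , cubic-∞ e t)

      vs : Vec (Vec K 9) 4
      vs = map T as

      𝒩 : PointSet 9
      𝒩 = curve 𝔽q³ 3 vs

      V-vs : All V vs
      V-vs = All.map⁺ (All.map (λ {a} f → ⇒V {a} {frob a} {frob (frob a)} refl (trans (n′∙frob a) f)
        (trans (n″∙frob (frob a)) (trans (cong φ (trans (n′∙frob a) f)) f))) as-rational)

      span-in-Σ₆⋆ : SpanOver 𝔽q³ vs ⊆ Σ₆⋆
      span-in-Σ₆⋆ {P} (cs , _ , P∼) =
        let ds , h = V-lincomb cs vs V-vs in ds , all-U ds , ∼-≡ P∼ (sym h)
        where
        V-lincomb : ∀ {k} (cs : Vec K k) vs → All V vs → V (lincomb cs vs)
        V-lincomb [] [] [] = V-𝟎
        V-lincomb (c ∷ cs) (v ∷ vs) (h ∷ hs) = V-+ (V-· c h) (V-lincomb cs vs hs)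

      extended-curve : IsNRC 𝔽q³ 3 Σ₆⋆ 𝒩
      extended-curve = vs , All.universal all-U vs , independent-K , (λ {P} → span-in-Σ₆⋆ {P}) , (λ z → z) , (λ z → z)

      -- At θ = t both L₁ and L₂ vanish but L₀ does not, so the common value of the three forms is
      -- 0, the first coefficient is 0 and the other two are free. The parameters t₁ and t₂ are the
      -- conjugate cases.
      𝓉₁ 𝓉₂ 𝓉₃ : PointSet 9
      𝓉₁ = ⟨ E 𝟎 (pt t) 𝟎 ∷ E 𝟎 𝟎 (pt t) ∷ [] ⟩
      𝓉₂ = ⟨ E (pt t₁) 𝟎 𝟎 ∷ E 𝟎 𝟎 (pt t₁) ∷ [] ⟩
      𝓉₃ = ⟨ E (pt t₂) 𝟎 𝟎 ∷ E 𝟎 (pt t₂) 𝟎 ∷ [] ⟩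

      g₁ : ∀ {θ} → n ∙ pt θ ≡ 0# → point (E (pt θ) 𝟎 𝟎) (E₁-nonzero (pt≢𝟎 θ)) ∈ g
      g₁ {θ} h = on-g {point (E (pt θ) 𝟎 𝟎) (E₁-nonzero (pt≢𝟎 θ))} {pt θ} (pt≢𝟎 θ) (n∙⇒m∙ (pt θ) h) refl
      g₂ : ∀ {θ} → n′ ∙ pt θ ≡ 0# → point (E 𝟎 (pt θ) 𝟎) (E₂-nonzero (pt≢𝟎 θ)) ∈ conj g
      g₂ {θ} h = on-g′ {point (E 𝟎 (pt θ) 𝟎) (E₂-nonzero (pt≢𝟎 θ))} {pt θ} (pt≢𝟎 θ) (n′∙⇒m′∙ (pt θ) h) refl
      g₃ : ∀ {θ} → n″ ∙ pt θ ≡ 0# → point (E 𝟎 𝟎 (pt θ)) (E₃-nonzero (pt≢𝟎 θ)) ∈ conj (conj g)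
      g₃ {θ} h = on-g″ {point (E 𝟎 𝟎 (pt θ)) (E₃-nonzero (pt≢𝟎 θ))} {pt θ} (pt≢𝟎 θ) (n″∙⇒m″∙ (pt θ) h) refl

      both : ∀ {s u θ} → s ·ᵛ pt θ ≡ 𝟎 → u ·ᵛ pt θ ≡ 𝟎 → s ∷ u ∷ [] ≡ 𝟎
      both {θ = θ} h₁ h₂ = cong₂ (λ x y → x ∷ y ∷ []) (scalar-zero (pt≢𝟎 θ) h₁) (scalar-zero (pt≢𝟎 θ) h₂)

      𝓉₁-T-line : IsTLine 𝓉₁
      𝓉₁-T-line = T-line (E₂-nonzero (pt≢𝟎 t)) (E₃-nonzero (pt≢𝟎 t)) ind (suc zero) (suc (suc zero)) (λ ()) (g₂ {t} n′∙t) (g₃ {t} n″∙t)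
        where
        ind : LinIndep 𝔽q³ (E 𝟎 (pt t) 𝟎 ∷ E 𝟎 𝟎 (pt t) ∷ [])
        ind (s ∷ u ∷ []) _ h = both {s} {u} {t} (E-kernel₂ {𝟎} {s ·ᵛ pt t} {u ·ᵛ pt t} h′) (E-kernel₃ {𝟎} {s ·ᵛ pt t} {u ·ᵛ pt t} h′)
          where
          h′ : E 𝟎 (s ·ᵛ pt t) (u ·ᵛ pt t) ≡ 𝟎
          h′ = trans (sym (pair₂₃ s u (pt t))) h

      𝓉₂-T-line : IsTLine 𝓉₂
      𝓉₂-T-line = T-line (E₁-nonzero (pt≢𝟎 t₁)) (E₃-nonzero (pt≢𝟎 t₁)) ind zero (suc (suc zero)) (λ ()) (g₁ {t₁} n∙t₁) (g₃ {t₁} n″∙t₁)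
        where
        ind : LinIndep 𝔽q³ (E (pt t₁) 𝟎 𝟎 ∷ E 𝟎 𝟎 (pt t₁) ∷ [])
        ind (s ∷ u ∷ []) _ h = both {s} {u} {t₁} (E-kernel₁ {s ·ᵛ pt t₁} {𝟎} {u ·ᵛ pt t₁} h′) (E-kernel₃ {s ·ᵛ pt t₁} {𝟎} {u ·ᵛ pt t₁} h′)
          where
          h′ : E (s ·ᵛ pt t₁) 𝟎 (u ·ᵛ pt t₁) ≡ 𝟎
          h′ = trans (sym (pair₁₃ s u (pt t₁))) h

      𝓉₃-T-line : IsTLine 𝓉₃
      𝓉₃-T-line = T-line (E₁-nonzero (pt≢𝟎 t₂)) (E₂-nonzero (pt≢𝟎 t₂)) ind zero (suc zero) (λ ()) (g₁ {t₂} n∙t₂) (g₂ {t₂} n′∙t₂)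
        where
        ind : LinIndep 𝔽q³ (E (pt t₂) 𝟎 𝟎 ∷ E 𝟎 (pt t₂) 𝟎 ∷ [])
        ind (s ∷ u ∷ []) _ h = both {s} {u} {t₂} (E-kernel₁ {s ·ᵛ pt t₂} {u ·ᵛ pt t₂} {𝟎} h′) (E-kernel₂ {s ·ᵛ pt t₂} {u ·ᵛ pt t₂} {𝟎} h′)
          where
          h′ : E (s ·ᵛ pt t₂) (u ·ᵛ pt t₂) 𝟎 ≡ 𝟎
          h′ = trans (sym (pair₁₂ s u (pt t₂))) h

      on-𝓉₁ : ∀ {P} → P ∈ 𝓉₁ → ∃[ s ] ∃[ u ] vec P ≡ E 𝟎 (s ·ᵛ pt t) (u ·ᵛ pt t)
      on-𝓉₁ (s ∷ u ∷ [] , _ , d , _ , P≡) = d * s , d * u , trans P≡ (trans (sym (lincomb-· d (s ∷ u ∷ []) (E 𝟎 (pt t) 𝟎 ∷ E 𝟎 𝟎 (pt t) ∷ []))) (pair₂₃ (d * s) (d * u) (pt t)))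
      on-𝓉₂ : ∀ {P} → P ∈ 𝓉₂ → ∃[ s ] ∃[ u ] vec P ≡ E (s ·ᵛ pt t₁) 𝟎 (u ·ᵛ pt t₁)
      on-𝓉₂ (s ∷ u ∷ [] , _ , d , _ , P≡) = d * s , d * u , trans P≡ (trans (sym (lincomb-· d (s ∷ u ∷ []) (E (pt t₁) 𝟎 𝟎 ∷ E 𝟎 𝟎 (pt t₁) ∷ []))) (pair₁₃ (d * s) (d * u) (pt t₁)))
      on-𝓉₃ : ∀ {P} → P ∈ 𝓉₃ → ∃[ s ] ∃[ u ] vec P ≡ E (s ·ᵛ pt t₂) (u ·ᵛ pt t₂) 𝟎
      on-𝓉₃ (s ∷ u ∷ [] , _ , d , _ , P≡) = d * s , d * u , trans P≡ (trans (sym (lincomb-· d (s ∷ u ∷ []) (E (pt t₂) 𝟎 𝟎 ∷ E 𝟎 (pt t₂) 𝟎 ∷ []))) (pair₁₂ (d * s) (d * u) (pt t₂)))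

      ⇒𝓉₁ : ∀ {P} s u → vec P ≡ E 𝟎 (s ·ᵛ pt t) (u ·ᵛ pt t) → P ∈ 𝓉₁
      ⇒𝓉₁ s u P≡ = s ∷ u ∷ [] , all-U _ , ∼-reflexive (trans P≡ (sym (pair₂₃ s u (pt t))))
      ⇒𝓉₂ : ∀ {P} s u → vec P ≡ E (s ·ᵛ pt t₁) 𝟎 (u ·ᵛ pt t₁) → P ∈ 𝓉₂
      ⇒𝓉₂ s u P≡ = s ∷ u ∷ [] , all-U _ , ∼-reflexive (trans P≡ (sym (pair₁₃ s u (pt t₁))))
      ⇒𝓉₃ : ∀ {P} s u → vec P ≡ E (s ·ᵛ pt t₂) (u ·ᵛ pt t₂) 𝟎 → P ∈ 𝓉₃
      ⇒𝓉₃ s u P≡ = s ∷ u ∷ [] , all-U _ , ∼-reflexive (trans P≡ (sym (pair₁₂ s u (pt t₂))))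

      -- The point of `𝓉₁` supported on the second component is not on `𝓉₂`, where that component is
      -- zero. The other two pairs are told apart in the same way.
      𝓉₁≢𝓉₂ : ¬ (𝓉₁ ≐ 𝓉₂)
      𝓉₁≢𝓉₂ (sub , _) =
        let P = point (E 𝟎 (pt t) 𝟎) (E₂-nonzero (pt≢𝟎 t))
            s , u , h = on-𝓉₂ {P} (sub {P} (⇒𝓉₁ {P} 1# 0# (sym (cong₂ (E 𝟎) (·ᵛ-identity (pt t)) (·ᵛ-zeroˡ (pt t))))))
        in pt≢𝟎 t (proj₁ (proj₂ (E-injective {𝟎} {pt t} {𝟎} {s ·ᵛ pt t₁} {𝟎} {u ·ᵛ pt t₁} h)))
      𝓉₂≢𝓉₃ : ¬ (𝓉₂ ≐ 𝓉₃)
      𝓉₂≢𝓉₃ (sub , _) =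
        let P = point (E 𝟎 𝟎 (pt t₁)) (E₃-nonzero (pt≢𝟎 t₁))
            s , u , h = on-𝓉₃ {P} (sub {P} (⇒𝓉₂ {P} 0# 1# (sym (cong₂ (λ x y → E x 𝟎 y) (·ᵛ-zeroˡ (pt t₁)) (·ᵛ-identity (pt t₁))))))
        in pt≢𝟎 t₁ (proj₂ (proj₂ (E-injective {𝟎} {𝟎} {pt t₁} {s ·ᵛ pt t₂} {u ·ᵛ pt t₂} {𝟎} h)))
      𝓉₁≢𝓉₃ : ¬ (𝓉₁ ≐ 𝓉₃)
      𝓉₁≢𝓉₃ (sub , _) =
        let P = point (E 𝟎 𝟎 (pt t)) (E₃-nonzero (pt≢𝟎 t))
            s , u , h = on-𝓉₃ {P} (sub {P} (⇒𝓉₁ {P} 0# 1# (sym (cong₂ (E 𝟎) (·ᵛ-zeroˡ (pt t)) (·ᵛ-identity (pt t))))))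
        in pt≢𝟎 t (proj₂ (proj₂ (E-injective {𝟎} {𝟎} {pt t} {s ·ᵛ pt t₂} {u ·ᵛ pt t₂} {𝟎} h)))

      monomial-point : ∀ θ → lincomb (monomials θ 3) vs ≡ E ((e * (θ + - t)) ·ᵛ pt θ) ((e′ * (θ + - t₁)) ·ᵛ pt θ) ((e″ * (θ + - t₂)) ·ᵛ pt θ)
      monomial-point θ = trans (expand (monomials θ 3)) (E-cong (cubic-monomials e t θ) (cubic-monomials e′ t₁ θ) (cubic-monomials e″ t₂ θ))
      ∞-curve-point : lincomb (∞-coefficients 3) vs ≡ E (e ·ᵛ e₂) (e′ ·ᵛ e₂) (e″ ·ᵛ e₂)
      ∞-curve-point = trans (expand (∞-coefficients 3)) (E-cong (cubic-∞ e t) (cubic-∞ e′ t₁) (cubic-∞ e″ t₂))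

      nonzero-multiple : ∀ {P : Point 9} {v} k → vec P ≡ k ·ᵛ v → vec P ∼ v
      nonzero-multiple {P} {v} k P≡ = k , (λ k≡0 → nonzero P (trans P≡ (trans (cong (_·ᵛ v) k≡0) (·ᵛ-zeroˡ v)))) , P≡

      E-scale : ∀ k {s t u s′ t′ u′} (y : Vec K 3) → s ≡ k * s′ → t ≡ k * t′ → u ≡ k * u′ →
        E (s ·ᵛ y) (t ·ᵛ y) (u ·ᵛ y) ≡ k ·ᵛ E (s′ ·ᵛ y) (t′ ·ᵛ y) (u′ ·ᵛ y)
      E-scale k {s′ = s′} {t′} {u′} y refl refl refl = sym (trans (E-· k (s′ ·ᵛ y) (t′ ·ᵛ y) (u′ ·ᵛ y))
        (trans (cong (λ z → E z (k ·ᵛ (t′ ·ᵛ y)) (k ·ᵛ (u′ ·ᵛ y))) (·ᵛ-assoc k s′ y)) (cong₂ (E ((k * s′) ·ᵛ y)) (·ᵛ-assoc k t′ y) (·ᵛ-assoc k u′ y))))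

      -- Away from t, t₁ and t₂ the coefficients are k / Lᵢ(θ). As i inverts (θ - t)(θ - t₁)(θ -
      -- t₂), they equal k i times e (θ - t) and its conjugate analogues, which is the point of the
      -- cubic with parameter θ.
      parametric-point : ∀ {P} θ s u w k → vec P ≡ E (s ·ᵛ pt θ) (u ·ᵛ pt θ) (w ·ᵛ pt θ) →
        s * (n ∙ pt θ) ≡ k → u * (n′ ∙ pt θ) ≡ k → w * (n″ ∙ pt θ) ≡ k → P ∈ (𝒩 ∪ (𝓉₁ ∪ (𝓉₂ ∪ 𝓉₃)))
      parametric-point {P} θ s u w k P≡ hs hu hw = case θ ≟ t of λ where
          (yes θ≡t) → inj₂ (inj₁ (⇒𝓉₁ {P} u w (at-t θ≡t hs hu P≡)))
          (no θ≢t) → case θ ≟ t₁ of λ where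
            (yes θ≡t₁) → inj₂ (inj₂ (inj₁ (⇒𝓉₂ {P} s w (at-t₁ θ≡t₁ hs hu P≡))))
            (no θ≢t₁) → case θ ≟ t₂ of λ where
              (yes θ≡t₂) → inj₂ (inj₂ (inj₂ (⇒𝓉₃ {P} s u (at-t₂ θ≡t₂ hs hw P≡))))
              (no θ≢t₂) → inj₁ (inj₁ (θ , _ , on-curve′ θ≢t θ≢t₁ θ≢t₂))
        where
        vanish : ∀ {c x} → x ≢ 0# → c * x ≡ k → k ≡ 0# → c ·ᵛ pt θ ≡ 𝟎
        vanish {c} {x} x≢0 h k≡0 = trans (cong (_·ᵛ pt θ) (x*y≡0⇒y≡0 x≢0 (trans (*-comm x c) (trans h k≡0)))) (·ᵛ-zeroˡ (pt θ))
        zero-k : ∀ {c x} → c * x ≡ k → x ≡ 0# → k ≡ 0#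
        zero-k {c} h refl = trans (sym h) (zeroʳ c)
        -- `n′` vanishes at t, so k = 0; `n` does not, so s = 0.
        at-t : θ ≡ t → s * (n ∙ pt θ) ≡ k → u * (n′ ∙ pt θ) ≡ k → vec P ≡ E (s ·ᵛ pt θ) (u ·ᵛ pt θ) (w ·ᵛ pt θ) → vec P ≡ E 𝟎 (u ·ᵛ pt t) (w ·ᵛ pt t)
        at-t refl hs hu P≡ = trans P≡ (cong (λ z → E z (u ·ᵛ pt t) (w ·ᵛ pt t)) (vanish n∙t≢0 hs (zero-k hu n′∙t)))
        at-t₁ : θ ≡ t₁ → s * (n ∙ pt θ) ≡ k → u * (n′ ∙ pt θ) ≡ k → vec P ≡ E (s ·ᵛ pt θ) (u ·ᵛ pt θ) (w ·ᵛ pt θ) → vec P ≡ E (s ·ᵛ pt t₁) 𝟎 (w ·ᵛ pt t₁)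
        at-t₁ refl hs hu P≡ = trans P≡ (cong (λ z → E (s ·ᵛ pt t₁) z (w ·ᵛ pt t₁)) (vanish n′∙t₁≢0 hu (zero-k hs n∙t₁)))
        at-t₂ : θ ≡ t₂ → s * (n ∙ pt θ) ≡ k → w * (n″ ∙ pt θ) ≡ k → vec P ≡ E (s ·ᵛ pt θ) (u ·ᵛ pt θ) (w ·ᵛ pt θ) → vec P ≡ E (s ·ᵛ pt t₂) (u ·ᵛ pt t₂) 𝟎
        at-t₂ refl hs hw P≡ = trans P≡ (cong (E (s ·ᵛ pt t₂) (u ·ᵛ pt t₂)) (vanish n″∙t₂≢0 hw (zero-k hs n∙t₂)))
        solved : ∀ c l e x y z k i → c * (l * (y * z)) ≡ k → l * e ≡ 1# → x * (y * z) * i ≡ 1# → c ≡ k * i * (e * x)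
        solved c l e x y z k i h₁ h₂ h₃ = combine (- (i * (e * x)) ⟪ sym h₁ ⟫ - (c * (x * (y * z) * i)) ⟪ h₂ ⟫ - c ⟪ h₃ ⟫ done)
          (solve 8 (λ c l e x y z k i → c := k :* i :* (e :* x) :+ ((:- (i :* (e :* x))) :* (k :- c :* (l :* (y :* z)))
            :+ ((:- (c :* (x :* (y :* z) :* i))) :* (l :* e :- 𝟙) :+ ((:- c) :* (x :* (y :* z) :* i :- 𝟙) :+ 𝟘)))) refl c l e x y z k i)
        on-curve′ : θ ≢ t → θ ≢ t₁ → θ ≢ t₂ → vec P ∼ lincomb (monomials θ 3) vs
        on-curve′ θ≢t θ≢t₁ θ≢t₂ = nonzero-multiple {P} (k * i) (trans P≡ (trans
            (E-scale (k * i) (pt θ)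
              (solved s (n ∙ e₂) e x y z k i (trans (cong (s *_) (sym (factored n t₁≢t₂ n∙t₁ n∙t₂ θ))) hs) n∙e₂*e xyz)
              (solved u (n′ ∙ e₂) e′ y x z k i (trans (cong (u *_) (sym (factored n′ t≢t₂ n′∙t n′∙t₂ θ))) hu) n′∙e₂*e′ (trans (cong (_* i) (swap x y z)) xyz))
              (solved w (n″ ∙ e₂) e″ z x y k i (trans (cong (w *_) (sym (factored n″ t≢t₁ n″∙t n″∙t₁ θ))) hw) n″∙e₂*e″ (trans (cong (_* i) (rotate x y z)) xyz)))
            (cong ((k * i) ·ᵛ_) (sym (monomial-point θ)))))
          where
          x y z i : K
          x = θ + - t
          y = θ + - t₁
          z = θ + - t₂
          i = (x * (y * z)) ⁻¹
          xyz : x * (y * z) * i ≡ 1#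
          xyz = *-inverseʳ (*-≢0 (θ≢t ∘ difference⇒≡) (*-≢0 (θ≢t₁ ∘ difference⇒≡) (θ≢t₂ ∘ difference⇒≡)))
          swap : ∀ x y z → y * (x * z) ≡ x * (y * z)
          swap = solve 3 (λ x y z → y :* (x :* z) := x :* (y :* z)) refl
          rotate : ∀ x y z → z * (x * y) ≡ x * (y * z)
          rotate = solve 3 (λ x y z → z :* (x :* y) := x :* (y :* z)) refl

      -- At the infinite parameter the Lᵢ reduce to their leading coefficients, whose inverses are
      -- `e`, `e′` and `e″`.
      infinite-point : ∀ {P} s u w k → vec P ≡ E (s ·ᵛ e₂) (u ·ᵛ e₂) (w ·ᵛ e₂) →
        s * (n ∙ e₂) ≡ k → u * (n′ ∙ e₂) ≡ k → w * (n″ ∙ e₂) ≡ k → P ∈ 𝒩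
      infinite-point {P} s u w k P≡ hs hu hw = inj₂ (nonzero-multiple {P} k (trans P≡ (trans
        (E-scale k e₂ (solved s (n ∙ e₂) e hs n∙e₂*e) (solved u (n′ ∙ e₂) e′ hu n′∙e₂*e′) (solved w (n″ ∙ e₂) e″ hw n″∙e₂*e″)) (cong (k ·ᵛ_) (sym ∞-curve-point)))))
        where
        solved : ∀ c l e → c * l ≡ k → l * e ≡ 1# → c ≡ k * e
        solved c l e h₁ h₂ = combine (- e ⟪ sym h₁ ⟫ - c ⟪ h₂ ⟫ done)
          (solve 4 (λ c l e k → c := k :* e :+ ((:- e) :* (k :- c :* l) :+ ((:- c) :* (l :* e :- 𝟙) :+ 𝟘))) refl c l e k)

      𝒱⋆⊆ : 𝒱⋆ As ⊆ (𝒩 ∪ (𝓉₁ ∪ (𝓉₂ ∪ 𝓉₃)))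
      𝒱⋆⊆ {P} (P∈Zeros , P∈Σ₆⋆) =
        let X , X∈C⁺ , P∈scroll = proj₁ extension {P} P∈Zeros
        in case from-C⁺ {X} X∈C⁺ of λ where
          (inj₁ (θ , X∼)) → let s , u , w , k , P≡ , hs , hu , hw = 𝒱⋆⇒ {P} {pt θ} {X} X∼ P∈scroll P∈Σ₆⋆ in parametric-point {P} θ s u w k P≡ hs hu hw
          (inj₂ X∼) → let s , u , w , k , P≡ , hs , hu , hw = 𝒱⋆⇒ {P} {e₂} {X} X∼ P∈scroll P∈Σ₆⋆ in inj₁ (infinite-point {P} s u w k P≡ hs hu hw)

      absorb : ∀ {P : Point 9} {s u w y} → vec P ∼ E (s ·ᵛ y) (u ·ᵛ y) (w ·ᵛ y) → ∃[ d ] vec P ≡ E ((d * s) ·ᵛ y) ((d * u) ·ᵛ y) ((d * w) ·ᵛ y)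
      absorb {y = y} (d , _ , P≡) = d , trans P≡ (sym (E-scale d y refl refl refl))

      𝒩⊆ : 𝒩 ⊆ 𝒱⋆ As
      𝒩⊆ {P} (inj₁ (θ , _ , P∼)) =
        let d , P≡ = absorb {P} {e * (θ + - t)} {e′ * (θ + - t₁)} {e″ * (θ + - t₂)} {pt θ} (∼-≡ P∼ (monomial-point θ))
        in in-extension {P} _ _ _ θ P≡ , span-in-Σ₆⋆ {P} (monomials θ 3 , all-U _ , P∼)
      𝒩⊆ {P} (inj₂ P∼) =
        let d , P≡ = absorb {P} {e} {e′} {e″} {e₂} (∼-≡ P∼ ∞-curve-point)
        in e₂-in-extension {P} _ _ _ P≡ , span-in-Σ₆⋆ {P} (∞-coefficients 3 , all-U _ , P∼)

      scaled-zero : ∀ (w : Vec K 3) s {y} → w ∙ y ≡ 0# → w ∙ (s ·ᵛ y) ≡ 0#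
      scaled-zero w s {y} h = trans (∙-· w s y) (trans (cong (s *_) h) (zeroʳ s))

      ⊆𝒱⋆ : (𝒩 ∪ (𝓉₁ ∪ (𝓉₂ ∪ 𝓉₃))) ⊆ 𝒱⋆ As
      ⊆𝒱⋆ {P} (inj₁ P∈𝒩) = 𝒩⊆ {P} P∈𝒩
      ⊆𝒱⋆ {P} (inj₂ (inj₁ P∈𝓉₁)) =
        let s , u , P≡ = on-𝓉₁ {P} P∈𝓉₁
        in in-extension {P} 0# s u t (trans P≡ (cong (λ z → E z (s ·ᵛ pt t) (u ·ᵛ pt t)) (sym (·ᵛ-zeroˡ (pt t))))) ,
           ⇒Σ₆⋆ {P} {𝟎} {s ·ᵛ pt t} {u ·ᵛ pt t} {0#} P≡ (∙-𝟎 n) (scaled-zero n′ s n′∙t) (scaled-zero n″ u n″∙t)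
      ⊆𝒱⋆ {P} (inj₂ (inj₂ (inj₁ P∈𝓉₂))) =
        let s , u , P≡ = on-𝓉₂ {P} P∈𝓉₂
        in in-extension {P} s 0# u t₁ (trans P≡ (cong (λ z → E (s ·ᵛ pt t₁) z (u ·ᵛ pt t₁)) (sym (·ᵛ-zeroˡ (pt t₁))))) ,
           ⇒Σ₆⋆ {P} {s ·ᵛ pt t₁} {𝟎} {u ·ᵛ pt t₁} {0#} P≡ (scaled-zero n s n∙t₁) (∙-𝟎 n′) (scaled-zero n″ u n″∙t₁)
      ⊆𝒱⋆ {P} (inj₂ (inj₂ (inj₂ P∈𝓉₃))) =
        let s , u , P≡ = on-𝓉₃ {P} P∈𝓉₃
        in in-extension {P} s u 0# t₂ (trans P≡ (cong (E (s ·ᵛ pt t₂) (u ·ᵛ pt t₂)) (sym (·ᵛ-zeroˡ (pt t₂))))) ,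
           ⇒Σ₆⋆ {P} {s ·ᵛ pt t₂} {u ·ᵛ pt t₂} {𝟎} {0#} P≡ (scaled-zero n s n∙t₂) (scaled-zero n′ u n′∙t₂) (∙-𝟎 n″)

    TwistedCubicWithTLines : Set₁
    TwistedCubicWithTLines = IsNRC 𝔽q 3 Σ₆ (𝒱 As)
       × ∃[ N ] ∃[ t₁ ] ∃[ t₂ ] ∃[ t₃ ]
           (IsNRC 𝔽q³ 3 Σ₆⋆ N
            × IsTLine t₁ × IsTLine t₂ × IsTLine t₃
            × ¬ (t₁ ≐ t₂) × ¬ (t₂ ≐ t₃) × ¬ (t₁ ≐ t₃)
            × 𝒱⋆ As ≐ (N ∪ (t₁ ∪ (t₂ ∪ t₃))))

    special-case : OnConic p → TwistedCubicWithTLines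
    special-case on = rational-curve , 𝒩 , 𝓉₁ , 𝓉₂ , 𝓉₃ , extended-curve , 𝓉₁-T-line , 𝓉₂-T-line , 𝓉₃-T-line ,
        𝓉₁≢𝓉₂ , 𝓉₂≢𝓉₃ , 𝓉₁≢𝓉₃ , (λ {P} → 𝒱⋆⊆ {P}) , (λ {P} → ⊆𝒱⋆ {P})
      where
      n∙p≢0 : n ∙ p ≢ 0#
      n∙p≢0 e = 1≢0 (trans (sym (∷-injectiveˡ moore-p)) e)
      n′∙p≡0 : n′ ∙ p ≡ 0#
      n′∙p≡0 = ∷-injectiveˡ (∷-injectiveʳ moore-p)
      n″∙p≡0 : n″ ∙ p ≡ 0#
      n″∙p≡0 = ∷-injectiveˡ (∷-injectiveʳ (∷-injectiveʳ moore-p))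
      vertex-p : ∃[ t ] ∃[ a ] (a ≢ 0# × p ≡ a ·ᵛ pt t)
      vertex-p = vertex p on n∙p≢0 n′∙p≡0
      t a : K
      t = proj₁ vertex-p
      a = proj₁ (proj₂ vertex-p)
      p∙ : ∀ w → w ∙ p ≡ a * (w ∙ pt t)
      p∙ w = trans (cong (w ∙_) (proj₂ (proj₂ (proj₂ vertex-p)))) (∙-· w a (pt t))
      root : ∀ w → w ∙ p ≡ 0# → w ∙ pt t ≡ 0#
      root w e = x*y≡0⇒y≡0 (proj₁ (proj₂ (proj₂ vertex-p))) (trans (sym (p∙ w)) e)
      open Special t (λ e → n∙p≢0 (trans (p∙ n) (trans (cong (a *_) e) (zeroʳ a)))) (root n′ n′∙p≡0) (root n″ n″∙p≡0)

    classification : IsNRC 𝔽q 6 Σ₆ (𝒱 As) ⊎ TwistedCubicWithTLines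
    classification = case on-conic? p of λ where
        (no off) → inj₁ (generic-case off)
        (yes on) → inj₂ (special-case on)
      where
      on-conic? : ∀ y → Dec (OnConic y)
      on-conic? (y₀ ∷ y₁ ∷ y₂ ∷ []) = y₁ * y₁ ≟ y₀ * y₂

open import Data.Nat.Base using (_≤_; _^_)

theorem4p5 :
    (q : ℕ) → IsPrimePower q → 6 ≤ q →
    (𝕂 : Field) → Field.Carrier 𝕂 ↔ Fin (q ^ 3) →
    let open Geometry 𝕂 q in
    (bose : Bose) (ℓ∞ : Point 3) →
    let open Bose bose
        open AtInfinity ℓ∞ in
    (Σ₆,q : SixSpace) →
    let open SixSpace Σ₆,q in
    (π C : PointSet 3) → IsSubplane q π → Exterior π ℓ∞ → IsConicOf π C →
    (C⁺ : PointSet 3) → IsConic C⁺ → C ⊆ C⁺ →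
    (B : Vec (Vec (Field.Carrier 𝕂) 3) 3) → IsConjugacy π B →
    (As : Vec (Form 9) 9) → IsVarietyOf B C C⁺ As →
      IsNRC 𝔽q 6 Σ₆ (𝒱 As)
    ⊎ (IsNRC 𝔽q 3 Σ₆ (𝒱 As)
       × ∃[ N ] ∃[ t₁ ] ∃[ t₂ ] ∃[ t₃ ]
           (IsNRC 𝔽q³ 3 Σ₆⋆ N
            × IsTLine t₁ × IsTLine t₂ × IsTLine t₃
            × ¬ (t₁ ≐ t₂) × ¬ (t₂ ≐ t₃) × ¬ (t₁ ≐ t₃)
            × 𝒱⋆ As ≐ (N ∪ (t₁ ∪ (t₂ ∪ t₃)))))
theorem4p5 q q-pp 6≤q 𝕂 iso bose ℓ∞ Σ₆,q π C _ disjoint conic C⁺ conic⁺ C⊆C⁺ B conjugacy As variety =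
  Varieties.InVariety.classification q q-pp 6≤q 𝕂 iso bose M M-ind ℓ∞ exterior Σ₆,q C≐ C⁺≐ ε≢0 semilinear-M variety
  where
  open GaloisField q q-pp 6≤q 𝕂 iso
  open Moore q q-pp 6≤q 𝕂 iso
  open Conics q q-pp 6≤q 𝕂 iso
  open ConicParametrisation q q-pp 6≤q 𝕂 iso
  open BoseCoordinates q q-pp 6≤q 𝕂 iso
  open SixSpaceCoordinates q q-pp 6≤q 𝕂 iso
  open Varieties q q-pp 6≤q 𝕂 iso

  parametrisation : ∃[ M ] Parametrised π C M
  parametrisation = parametrise conic
  M : Vec (Vec K 3) 3
  M = proj₁ parametrisation
  M-ind : LinIndep 𝔽q³ M
  M-ind = proj₁ (proj₂ parametrisation)
  M⊆π : SpanOver 𝔽q M ⊆ π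
  M⊆π = proj₂ (proj₁ (proj₂ (proj₂ parametrisation)))

  -- A nonzero rational combination of `M` on the line at infinity would be a point of π on it.
  exterior : ∀ x → All 𝔽q x → map (vec ℓ∞ ∙_) M ∙ x ≡ 0# → x ≡ 𝟎
  exterior x fx e = case 𝟎? x of λ where
    (yes z) → z
    (no x≢𝟎) → ⊥-elim (disjoint {point (lincomb x M) (x≢𝟎 ∘ LinIndep⇒kernel {vs = M} M-ind x)}
      (M⊆π (x , fx , ∼-reflexive refl) , trans (∙-lincomb (vec ℓ∞) x M) (trans (∙-comm x _) e)))

  C≐ : C ≐ curve 𝔽q 2 M
  C≐ = proj₂ (proj₂ (proj₂ parametrisation))
  C⁺≐ : C⁺ ≐ curve 𝔽q³ 2 M
  -- The exterior line also supplies the four elements of GF(q) at which the equation of the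
  -- extended conic is tested.
  C⁺≐ = extend (Independent.four-elements (map (vec ℓ∞ ∙_) M) exterior) {π} {C} {C⁺} {M} (proj₂ parametrisation) conic⁺ C⊆C⁺

  eigen : ∃[ μ ] (μ ≢ 0# × ∀ y → semilinear B (lincomb y M) ≡ μ ·ᵛ lincomb (frob y) M)
  eigen = eigenvalue {π} {B} {M} conjugacy M-ind M⊆π
  ε≢0 : proj₁ eigen ≢ 0#
  ε≢0 = proj₁ (proj₂ eigen)
  semilinear-M : ∀ y → semilinear B (lincomb y M) ≡ proj₁ eigen ·ᵛ lincomb (frob y) M
  semilinear-M = proj₂ (proj₂ eigen)
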